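{- For every $\alpha\ge 0$, write $L_{2\alpha+1}=\sum_{j\ge 1} l_j(2\alpha+1)G^j$. Then every coefficient $l_j(2\alpha+1)$ is an integer divisible by $5^{\alpha+1}$.
   Context: Let $(z;q)_\infty=\prod_{j\ge0}(1-zq^j)$. Define the power series $F=q\frac{(q;q)_\infty^3(q^{50};q^{50})_\infty^2}{(q^2;q^2)_\infty^2(q^{25};q^{25})_\infty^3}$ and $G=q\frac{(q;q)_\infty^2(q^{10};q^{10})_\infty^4}{(q^2;q^2)_\infty^4(q^5;q^5)_\infty^2}$ (i.e. $F=\eta(\tau)^3\eta(50\tau)^2/(\eta(2\tau)^2\eta(25\tau)^3)$, $G=\eta(\tau)^2\eta(10\tau)^4/(\eta(2\tau)^4\eta(5\tau)^2)$ with $q=e^{2\pi i\tau}$). The operator $U_5$ acts on power series by $\sum a(n)q^n\mid U_5=\sum a(5n)q^n$. Define $L_0=1$, and for $\alpha\ge 0$, $L_{2\alpha+1}=(FL_{2\alpha})\mid U_5$, $L_{2\alpha+2}=L_{2\alpha+1}\mid U_5$. Each $L_\nu$ with $\nu\ge1$ is a polynomial in $G$ with zero constant term (e.g. $L_1=5G$), and $l_j(\nu)$ denotes the coefficient of $G^j$ in $L_\nu$ (these coefficients are uniquely determined since $G$ is nonconstant). -}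

module Defs where

open import Algebra.Definitions.RawMonoid using (sum)
open import Data.Fin.Base using (Fin; zero; suc; toℕ)
open import Data.Integer.Base as ℤ using (ℤ; 0ℤ; 1ℤ)
import Data.Integer.Properties as ℤ
open import Data.Nat.Base as ℕ using (ℕ; zero; suc; parity; NonZero)
import Data.Nat.Properties as ℕ
open import Data.Parity.Base using (Parity; 0ℙ; 1ℙ)
open import Data.Rational.Base as ℚ using (ℚ)
open import Data.Vec.Base using (Vec; []; _∷_; head; lookup)
open import Data.Vec.Functional using (Vector)
open import Relation.Nullary.Decidable using (does)
open import Data.Bool.Base using (if_then_else_)
open import Relation.Binary.PropositionalEquality

sumℤ : ∀ {n} → Vector ℤ n → ℤ
sumℤ = sum ℤ.+-0-rawMonoid

sumℚ : ∀ {n} → Vector ℚ n → ℚ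
sumℚ = sum ℚ.+-0-rawMonoid

-- The formal power series Σ f(n) qⁿ in ℤ[[q]].
Series : Set
Series = ℕ → ℤ

infixl 6 _-_
infixl 7 _*_ _/_
infixr 8 _^_

q^_ : ℕ → Series
(q^ k) n = if does (k ℕ.≟ n) then 1ℤ else 0ℤ

1# : Series
1# = q^ 0

_-_ : Series → Series → Series
(f - g) n = f n ℤ.- g n

_*_ : Series → Series → Series
(f * g) n = sumℤ {suc n} λ i → f (toℕ i) ℤ.* g (n ℕ.∸ toℕ i)

_^_ : Series → ℕ → Series
f ^ zero  = 1#
f ^ suc k = f * (f ^ k)

-- The coefficients g(n), …, g(0) (in this order) of the reciprocal g of a
-- series f with constant term 1, from g(n+1) = - Σ_{i=0}^{n} f(i+1) g(n-i).
reciprocalPrefix : Series → (n : ℕ) → Vec ℤ (suc n)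
reciprocalPrefix f zero    = 1ℤ ∷ []
reciprocalPrefix f (suc n) =
  ℤ.- sumℤ (λ i → f (suc (toℕ i)) ℤ.* lookup (reciprocalPrefix f n) i)
    ∷ reciprocalPrefix f n

-- Meaningful only when f has constant term 1; see reciprocal-inverse.
reciprocal : Series → Series
reciprocal f n = head (reciprocalPrefix f n)

_/_ : Series → Series → Series
f / g = f * reciprocal g

∏[j<_]_ : ℕ → (ℕ → Series) → Series
∏[j< zero  ] φ = 1#
∏[j< suc k ] φ = (∏[j< k ] φ) * φ k

-- (q^a; q^m)_∞ = ∏_{j≥0} (1 - q^(a+mj)) for a, m ≥ 1.  The factors with
-- j ≥ n have the form 1 + O(q^(n+1)), so they do not affect the coefficient
-- of qⁿ.
⟨q^_⨾q^_⟩∞ : (a m : ℕ) .{{_ : NonZero a}} .{{_ : NonZero m}} → Series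
⟨q^ a ⨾q^ m ⟩∞ n = (∏[j< n ] λ j → 1# - q^ (a ℕ.+ m ℕ.* j)) n

E : (m : ℕ) .{{_ : NonZero m}} → Series
E m = ⟨q^ m ⨾q^ m ⟩∞

F : Series
F = q^ 1 * ((E 1 ^ 3 * E 50 ^ 2) / (E 2 ^ 2 * E 25 ^ 3))

G : Series
G = q^ 1 * ((E 1 ^ 2 * E 10 ^ 4) / (E 2 ^ 4 * E 5 ^ 2))

U₅ : Series → Series
U₅ f n = f (5 ℕ.* n)

L-step : Parity → Series → Series
L-step 0ℙ f = U₅ (F * f)
L-step 1ℙ f = U₅ f

L : ℕ → Series
L zero    = 1#
L (suc ν) = L-step (parity ν) (L ν)

-- f = Σ_{j=1}^{d} l_j G^j in ℚ[[q]].  The polynomial has zero constant term: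
-- the entry l i is the coefficient of G^(1+i).
_≈_[G] : ∀ {d} → Series → Vector ℚ d → Set
f ≈ l [G] = ∀ n → f n ℚ./ 1 ≡ sumℚ λ i → l i ℚ.* ((G ^ suc (toℕ i)) n ℚ./ 1)

private
  sumℤ-cong : ∀ {n} {u v : Vector ℤ n} → (∀ i → u i ≡ v i) → sumℤ u ≡ sumℤ v
  sumℤ-cong {zero}  eq = refl
  sumℤ-cong {suc n} eq = cong₂ ℤ._+_ (eq zero) (sumℤ-cong (λ i → eq (suc i)))

  lookup-prefix : ∀ f n i →
    lookup (reciprocalPrefix f n) i ≡ reciprocal f (n ℕ.∸ toℕ i)
  lookup-prefix f zero    zero    = refl
  lookup-prefix f (suc n) zero    = refl
  lookup-prefix f (suc n) (suc i) = lookup-prefix f n i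

  parity-2* : ∀ α → parity (2 ℕ.* α) ≡ 0ℙ
  parity-2* zero    = refl
  parity-2* (suc α) rewrite ℕ.+-suc α (α ℕ.+ 0) = parity-2* α

  parity-2*+1 : ∀ α → parity (suc (2 ℕ.* α)) ≡ 1ℙ
  parity-2*+1 zero    = refl
  parity-2*+1 (suc α) rewrite ℕ.+-suc α (α ℕ.+ 0) = parity-2*+1 α

reciprocal-inverse : ∀ f → f 0 ≡ 1ℤ → ∀ n → (f * reciprocal f) n ≡ 1# n
reciprocal-inverse f f₀ zero    rewrite f₀ = refl
reciprocal-inverse f f₀ (suc n) rewrite f₀ = begin
  1ℤ ℤ.* (ℤ.- s) ℤ.+ t  ≡⟨ cong (ℤ._+ t) (ℤ.*-identityˡ (ℤ.- s)) ⟩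
  ℤ.- s ℤ.+ t           ≡⟨ cong (ℤ._+_ (ℤ.- s)) t≡s ⟩
  ℤ.- s ℤ.+ s           ≡⟨ ℤ.+-inverseˡ s ⟩
  0ℤ                    ∎
  where
  open ≡-Reasoning
  s t : ℤ
  s = sumℤ (λ i → f (suc (toℕ i)) ℤ.* lookup (reciprocalPrefix f n) i)
  t = sumℤ {suc n} (λ i → f (suc (toℕ i)) ℤ.* reciprocal f (n ℕ.∸ toℕ i))
  t≡s : t ≡ s
  t≡s = sumℤ-cong λ i → cong (f (suc (toℕ i)) ℤ.*_) (sym (lookup-prefix f n i))

private
  E₀ : ∀ m .{{_ : NonZero m}} → E m 0 ≡ 1ℤ
  E₀ m = refl

  *₀ : ∀ {f g} → f 0 ≡ 1ℤ → g 0 ≡ 1ℤ → (f * g) 0 ≡ 1ℤ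
  *₀ f₀ g₀ = cong₂ (λ x y → x ℤ.* y ℤ.+ 0ℤ) f₀ g₀

  ^₀ : ∀ {f} k → f 0 ≡ 1ℤ → (f ^ k) 0 ≡ 1ℤ
  ^₀     zero    f₀ = refl
  ^₀ {f} (suc k) f₀ = *₀ {f} {f ^ k} f₀ (^₀ {f} k f₀)

F-denominator : (E 2 ^ 2 * E 25 ^ 3) 0 ≡ 1ℤ
F-denominator = *₀ {E 2 ^ 2} {E 25 ^ 3} (^₀ {E 2} 2 (E₀ 2)) (^₀ {E 25} 3 (E₀ 25))

G-denominator : (E 2 ^ 4 * E 5 ^ 2) 0 ≡ 1ℤ
G-denominator = *₀ {E 2 ^ 4} {E 5 ^ 2} (^₀ {E 2} 4 (E₀ 2)) (^₀ {E 5} 2 (E₀ 5))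

L-odd : ∀ α → L (suc (2 ℕ.* α)) ≡ U₅ (F * L (2 ℕ.* α))
L-odd α = cong (λ p → L-step p (L (2 ℕ.* α))) (parity-2* α)

L-even : ∀ α → L (suc (suc (2 ℕ.* α))) ≡ U₅ (L (suc (2 ℕ.* α)))
L-even α = cong (λ p → L-step p (L (suc (2 ℕ.* α)))) (parity-2*+1 α)

{-# OPTIONS --safe #-}
module Submission where

-- Let ψ = E₂²/E₁, so that G = q ψ(q⁵)²/ψ(q)².  By Euler and Gauss, E₁ and ψ are
-- the theta series Σ (-1)^a q^(a(3a+1)/2) and Σ q^(a(2a+1)) over the integers.
-- Sorting the exponents in E₂² = E₁ψ modulo 5 gives the relation between the
-- Rogers–Ramanujan continued fractions R(q) and R(q²), by which all 5-dissections
-- become rational in K = q/(R(q)R(q²)²).  Counting Gaussian integers of given norm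
-- gives q/G = K + q - q²/K.  It follows that u with Gu² = G(q⁵) is a root of a monic
-- quintic over ℤ[G(q⁵)], hence so is G, and U₅(Gʲ) and U₅(FGʲ) obey the same five-term
-- recurrence over ℤ[G].
--
-- The ℤ-spans M(c) of the 5ʷGᵏ with 5k ≤ 6w + c satisfy M(c)M(d) ⊆ M(c+d), and the
-- coefficient of Gⁱ in the quintic for G lies in M(5-i).  So U₅(Gʲ) ∈ M(j+6) and
-- U₅(FGʲ) ∈ M(j+4) follow from five initial values each.  With the extra factor 5 in
-- U₅(FG) this yields, inductively, L_{2α+1} ∈ 5^(α+1) M(11) and L_{2α+2} ∈ 5^(α+1) M(8).

-- Only a passage through F gains a factor 5, and only on the first power of G: 5 divides U(FG),
-- whereas U(FG²) ≡ -G modulo 5. Divisibility of all coefficients by a power of 5 is therefore not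
-- inductive by itself; the higher powers of G must carry additional factors 5, and the bound 5k ≤
-- 6w + c records how many. Its slope is that of the extreme monomials 5ⁱG^(i+1) in the quintic for
-- G. Since Gʲ lies in M(5j) and U sends it to M(j+6), the operator contracts, so fixed thresholds
-- can be maintained. M(8) admits G with a coefficient prime to 5 but not G², exactly what the next
-- passage through F requires.
--
-- The square root u = q²ψ(q)ψ(q²⁵)/ψ(q⁵)² of G(q⁵)/G is easier to reach than G: it is linear in ψ,
-- so that only three residue classes of exponents occur in it, and it clears the denominator of F.
--
-- The place of the theory of modular functions is taken by one arithmetic input: ψ² is an
-- eigenfunction of the Hecke operator at 5, with eigenvalue 2. This is what ties K to G.

open import Defs renaming (_*_ to _⊛_; _^_ to _⊛^_; _-_ to _⊖_; _/_ to _⊘_)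
open import Algebra.Bundles using (AbelianGroup; CommutativeRing)
import Algebra.Properties.Group
import Algebra.Solver.Ring
open import Algebra.Solver.Ring.AlmostCommutativeRing using (fromCommutativeRing; _-Raw-AlmostCommutative⟶_)
open import Algebra.Structures using (IsCommutativeRing)
open import Data.Bool.Base using (if_then_else_)
open import Data.Empty using (⊥-elim)
open import Data.Fin.Base using (Fin; zero; suc; toℕ; fromℕ<)
import Data.Fin.Properties as Fin
open import Data.Integer.Base as ℤ using (ℤ; 0ℤ; 1ℤ; +_; -[1+_])
open import Data.Integer.DivMod using (_/ℕ_; n%ℕd<d; a≡a%ℕn+[a/ℕn]*n)
open import Data.Integer.Divisibility using (_∣_)
open import Data.Integer.Divisibility.Signed using (divides; _∣?_; ∣⇒∣ᵤ) renaming (_∣_ to _∣ₛ_)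
import Data.Integer.Properties as ℤ
open import Data.Integer.Solver using () renaming (module +-*-Solver to ℤ-Solver)
open import Data.List.Base using (List; []; _∷_; _++_; map; filter; cartesianProduct)
open import Data.List.Membership.Propositional using (_∈_)
open import Data.List.Membership.Propositional.Properties using (∈-map⁺; ∈-map⁻; ∈-filter⁺; ∈-filter⁻; ∈-cartesianProduct⁺)
open import Data.List.Membership.Propositional.Properties.WithK using (unique∧set⇒bag)
open import Data.List.Relation.Binary.BagAndSetEquality using (∼bag⇒↭)
open import Data.List.Relation.Binary.Permutation.Propositional as Perm using (_↭_)
open import Data.List.Relation.Unary.All using (All; []; _∷_; all?)
open import Data.List.Relation.Unary.AllPairs using ([]; _∷_)
open import Data.List.Relation.Unary.Any using (here; there)
open import Data.List.Relation.Unary.Unique.Propositional using (Unique)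
open import Data.List.Relation.Unary.Unique.Propositional.Properties using (map⁺; filter⁺; cartesianProduct⁺)
open import Data.Maybe.Base using (Maybe; just; nothing)
open import Data.Nat.Base using (ℕ) renaming (_*_ to _*ℕ_; _+_ to _+ℕ_; _^_ to _^ℕ_)
open import Data.Nat.Base as ℕ using (zero; suc; NonZero)
open import Data.Nat.DivMod using (_%_; m≡m%n+[m/n]*n; m%n<n) renaming (_/_ to _div_)
import Data.Nat.Properties as ℕ
open import Data.Nat.Solver using () renaming (module +-*-Solver to ℕ-Solver)
open import Data.Product.Base using (_,_; _×_; proj₁; proj₂; ∃-syntax; Σ-syntax)
open import Data.Rational.Base using (ℚ) renaming (_/_ to _/ℚ_)
open import Data.Rational.Base as ℚ using (0ℚ; 1ℚ)
import Data.Rational.Properties as ℚ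
open import Data.Rational.Unnormalised.Base as ℚᵘ using (mkℚᵘ; *≡*)
import Data.Rational.Unnormalised.Properties as ℚᵘ
open import Data.Sum.Base using (inj₁; inj₂)
open import Data.Vec.Base using (Vec; []; _∷_) renaming (map to mapᵥ)
open import Data.Vec.Functional using (Vector)
open import Data.Vec.Properties using (lookup-map)
open import Function.Base using (_∘_)
open import Function.Bundles using (mk⇔)
open import Level using (0ℓ)
open import Relation.Binary.Definitions using (tri<; tri≈; tri>)
open import Relation.Binary.PropositionalEquality
import Relation.Binary.Reasoning.Setoid
open import Relation.Nullary using (¬_)
open import Relation.Nullary.Decidable using (Dec; yes; no; does; ¬?; True; toWitness; from-yes; dec-true; dec-false; _→-dec_; _×-dec_)

-- The ring of power series

infix 4 _≋_

-- A record rather than a function type, so that `f` and `g` can be inferred from a proof.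
record _≋_ (f g : Series) : Set where
  constructor pointwise
  field at : ∀ n → f n ≡ g n

open _≋_ public

infixl 6 _+_ _-_
infix 8 -_

-- Opaque, so that unification does not unfold series to their coefficients.
opaque
  _+_ : Series → Series → Series
  (f + g) n = f n ℤ.+ g n

  -_ : Series → Series
  (- f) n = ℤ.- f n

_-_ : Series → Series → Series
f - g = f + - g

C : ℤ → Series
C c zero    = c
C c (suc n) = 0ℤ

-- A constant series, so that it is literally what `con 0ℤ` denotes in the ring solver.
0# : Series
0# = C 0ℤ

infixl 7 _·_

_·_ : ℤ → Series → Series
(c · f) n = c ℤ.* f n

tl : Series → Series
tl f n = f (suc n)

module _ where
  open ℤ-Solver

  opaque
    unfolding _+_ -_

    ⊛-distribʳ-at : ∀ f g h n → ((f + g) ⊛ h) n ≡ (f ⊛ h) n ℤ.+ (g ⊛ h) n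
    ⊛-distribʳ-at f g h zero = solve 3
      (λ x y z → (x :+ y) :* z :+ con 0ℤ := (x :* z :+ con 0ℤ) :+ (y :* z :+ con 0ℤ)) refl (f 0) (g 0) (h 0)
    ⊛-distribʳ-at f g h (suc n) = trans
      (cong (λ z → (f 0 ℤ.+ g 0) ℤ.* h (suc n) ℤ.+ z) (⊛-distribʳ-at (tl f) (tl g) h n))
      (solve 5 (λ x y z u v → (x :+ y) :* z :+ (u :+ v) := (x :* z :+ u) :+ (y :* z :+ v)) refl
        (f 0) (g 0) (h (suc n)) ((tl f ⊛ h) n) ((tl g ⊛ h) n))

    ·-⊛-at : ∀ c f g n → ((c · f) ⊛ g) n ≡ c ℤ.* (f ⊛ g) n
    ·-⊛-at c f g zero = solve 3
      (λ x y z → (x :* y) :* z :+ con 0ℤ := x :* (y :* z :+ con 0ℤ)) refl c (f 0) (g 0)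
    ·-⊛-at c f g (suc n) = trans
      (cong (λ z → (c ℤ.* f 0) ℤ.* g (suc n) ℤ.+ z) (·-⊛-at c (tl f) g n))
      (solve 4 (λ x y z u → (x :* y) :* z :+ x :* u := x :* (y :* z :+ u)) refl
        c (f 0) (g (suc n)) ((tl f ⊛ g) n))

    -- The convolution unfolds along its left factor by definition. This is the recursion along the
    -- right factor; matching the two gives commutativity by induction.
    ⊛-sucʳ : ∀ f g n → (f ⊛ g) (suc n) ≡ f (suc n) ℤ.* g 0 ℤ.+ (f ⊛ tl g) n
    ⊛-sucʳ f g zero = solve 4
      (λ x y z w → x :* w :+ (y :* z :+ con 0ℤ) := y :* z :+ (x :* w :+ con 0ℤ)) refl
      (f 0) (f 1) (g 0) (g 1)
    ⊛-sucʳ f g (suc n) = trans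
      (cong (λ z → f 0 ℤ.* g (suc (suc n)) ℤ.+ z) (⊛-sucʳ (tl f) g n))
      (solve 3 (λ x y z → x :+ (y :+ z) := y :+ (x :+ z)) refl
        (f 0 ℤ.* g (suc (suc n))) (f (suc (suc n)) ℤ.* g 0) ((tl f ⊛ tl g) n))

    ⊛-comm-at : ∀ f g n → (f ⊛ g) n ≡ (g ⊛ f) n
    ⊛-comm-at f g zero    = cong (ℤ._+ 0ℤ) (ℤ.*-comm (f 0) (g 0))
    ⊛-comm-at f g (suc n) = trans
      (cong₂ ℤ._+_ (ℤ.*-comm (f 0) (g (suc n))) (⊛-comm-at (tl f) g n))
      (sym (⊛-sucʳ g f n))

    ⊛-assoc-at : ∀ f g h n → ((f ⊛ g) ⊛ h) n ≡ (f ⊛ (g ⊛ h)) n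
    ⊛-assoc-at f g h zero = solve 3
      (λ x y z → (x :* y :+ con 0ℤ) :* z :+ con 0ℤ := x :* (y :* z :+ con 0ℤ) :+ con 0ℤ) refl
      (f 0) (g 0) (h 0)
    ⊛-assoc-at f g h (suc n) = trans
      (cong (λ z → (f ⊛ g) 0 ℤ.* h (suc n) ℤ.+ z)
        (trans (⊛-distribʳ-at (f 0 · tl g) (tl f ⊛ g) h n)
          (cong₂ ℤ._+_ (·-⊛-at (f 0) (tl g) h n) (⊛-assoc-at (tl f) g h n))))
      (solve 5 (λ x y z u v → (x :* y :+ con 0ℤ) :* z :+ (x :* u :+ v) := x :* (y :* z :+ u) :+ v) refl
        (f 0) (g 0) (h (suc n)) ((tl g ⊛ h) n) ((tl f ⊛ (g ⊛ h)) n))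

-- The hypotheses stop at `n` so that products also respect equality modulo a power of `q`.
⊛-cong-at : ∀ {f f′ g g′} n → (∀ i → i ℕ.≤ n → f i ≡ f′ i) → (∀ i → i ℕ.≤ n → g i ≡ g′ i) →
            (f ⊛ g) n ≡ (f′ ⊛ g′) n
⊛-cong-at zero p r = cong₂ (λ x y → x ℤ.* y ℤ.+ 0ℤ) (p 0 ℕ.z≤n) (r 0 ℕ.z≤n)
⊛-cong-at (suc n) p r = cong₂ ℤ._+_
  (cong₂ ℤ._*_ (p 0 ℕ.z≤n) (r (suc n) ℕ.≤-refl))
  (⊛-cong-at n (λ i i≤n → p (suc i) (ℕ.s≤s i≤n)) (λ i i≤n → r i (ℕ.m≤n⇒m≤1+n i≤n)))

C0-at : ∀ n → C 0ℤ n ≡ 0ℤ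
C0-at zero    = refl
C0-at (suc n) = refl

C-⊛-at : ∀ c f n → (C c ⊛ f) n ≡ c ℤ.* f n
C-⊛-at c f zero    = ℤ.+-identityʳ _
C-⊛-at c f (suc n) = trans (cong (λ z → c ℤ.* f (suc n) ℤ.+ z) (zero-⊛ n)) (ℤ.+-identityʳ _)
  where
  zero-⊛ : ∀ n → (tl (C c) ⊛ f) n ≡ 0ℤ
  zero-⊛ zero    = ℤ.+-identityʳ _
  zero-⊛ (suc n) = trans (cong (λ z → 0ℤ ℤ.* f (suc n) ℤ.+ z) (zero-⊛ n)) refl

infixl 7 _*_
infixr 8 _^_

opaque
  unfolding _+_ -_

  _*_ : Series → Series → Series
  _*_ = _⊛_

  *≡⊛ : ∀ f g → f * g ≡ f ⊛ g
  *≡⊛ f g = refl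

  *-cong-at : ∀ {f f′ g g′} n → (∀ i → i ℕ.≤ n → f i ≡ f′ i) → (∀ i → i ℕ.≤ n → g i ≡ g′ i) →
              (f * g) n ≡ (f′ * g′) n
  *-cong-at = ⊛-cong-at

  *-distribʳ-at : ∀ f g h n → ((f + g) * h) n ≡ (f * h) n ℤ.+ (g * h) n
  *-distribʳ-at = ⊛-distribʳ-at

  *-comm-at : ∀ f g n → (f * g) n ≡ (g * f) n
  *-comm-at = ⊛-comm-at

  *-assoc-at : ∀ f g h n → ((f * g) * h) n ≡ (f * (g * h)) n
  *-assoc-at = ⊛-assoc-at

  C-*-at : ∀ c f n → (C c * f) n ≡ c ℤ.* f n
  C-*-at = C-⊛-at

  *-at-0 : ∀ f g → (f * g) 0 ≡ f 0 ℤ.* g 0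
  *-at-0 f g = ℤ.+-identityʳ _

  *-at-suc : ∀ f g n → (f * g) (suc n) ≡ f 0 ℤ.* g (suc n) ℤ.+ (tl f * g) n
  *-at-suc f g n = refl

  +-at : ∀ f g n → (f + g) n ≡ f n ℤ.+ g n
  +-at f g n = refl

  neg-at : ∀ f n → (- f) n ≡ ℤ.- f n
  neg-at f n = refl

  ⊖≡- : ∀ f g → f ⊖ g ≡ f - g
  ⊖≡- f g = refl

_^_ : Series → ℕ → Series
f ^ zero  = 1#
f ^ suc k = f * f ^ k

opaque
  unfolding _+_ -_

  C1 : C 1ℤ ≋ 1#
  C1 = pointwise λ { zero → refl ; (suc n) → refl }

  ≋-refl : ∀ {f} → f ≋ f
  ≋-refl = pointwise λ n → refl

  ≋-sym : ∀ {f g} → f ≋ g → g ≋ f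
  ≋-sym p = pointwise λ n → sym (at p n)

  ≋-trans : ∀ {f g h} → f ≋ g → g ≋ h → f ≋ h
  ≋-trans p r = pointwise λ n → trans (at p n) (at r n)

  *-cong : ∀ {f f′ g g′} → f ≋ f′ → g ≋ g′ → f * g ≋ f′ * g′
  *-cong p r = pointwise λ n → *-cong-at n (λ i _ → at p i) (λ i _ → at r i)

  +-cong : ∀ {f f′ g g′} → f ≋ f′ → g ≋ g′ → f + g ≋ f′ + g′
  +-cong p r = pointwise λ n → cong₂ ℤ._+_ (at p n) (at r n)

  -‿cong : ∀ {f f′} → f ≋ f′ → - f ≋ - f′
  -‿cong p = pointwise λ n → cong ℤ.-_ (at p n)

  *-identityˡ : ∀ f → 1# * f ≋ f
  *-identityˡ f = ≋-trans (*-cong (≋-sym C1) ≋-refl)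
    (pointwise λ n → trans (C-*-at 1ℤ f n) (ℤ.*-identityˡ (f n)))

  *-comm : ∀ f g → f * g ≋ g * f
  *-comm f g = pointwise (*-comm-at f g)

  *-distribʳ : ∀ h f g → (f + g) * h ≋ f * h + g * h
  *-distribʳ h f g = pointwise (*-distribʳ-at f g h)

  seriesIsCommutativeRing : IsCommutativeRing _≋_ _+_ _*_ -_ 0# 1#
  seriesIsCommutativeRing = record
    { isRing = record
      { +-isAbelianGroup = record
        { isGroup = record
          { isMonoid = record
            { isSemigroup = record
              { isMagma = record
                { isEquivalence = record { refl = ≋-refl ; sym = ≋-sym ; trans = ≋-trans }
                ; ∙-cong = +-cong }
              ; assoc = λ f g h → pointwise λ n → ℤ.+-assoc (f n) (g n) (h n) }
            ; identity = (λ f → pointwise λ n → trans (cong (ℤ._+ f n) (C0-at n)) (ℤ.+-identityˡ (f n)))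
                       , (λ f → pointwise λ n → trans (cong (λ z → f n ℤ.+ z) (C0-at n)) (ℤ.+-identityʳ (f n))) }
          ; inverse = (λ f → pointwise λ n → trans (ℤ.+-inverseˡ (f n)) (sym (C0-at n)))
                    , (λ f → pointwise λ n → trans (ℤ.+-inverseʳ (f n)) (sym (C0-at n)))
          ; ⁻¹-cong = -‿cong }
        ; comm = λ f g → pointwise λ n → ℤ.+-comm (f n) (g n) }
      ; *-cong = *-cong
      ; *-assoc = λ f g h → pointwise (*-assoc-at f g h)
      ; *-identity = *-identityˡ , (λ f → ≋-trans (*-comm f 1#) (*-identityˡ f))
      ; distrib = (λ h f g → ≋-trans (*-comm h (f + g))
                    (≋-trans (*-distribʳ h f g) (+-cong (*-comm f h) (*-comm g h))))
                , *-distribʳ }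
    ; *-comm = *-comm }

seriesRing : CommutativeRing 0ℓ 0ℓ
seriesRing = record { isCommutativeRing = seriesIsCommutativeRing }

open CommutativeRing seriesRing public
  using (*-assoc; +-assoc; *-identityʳ; +-identityˡ; +-identityʳ; zeroˡ; zeroʳ; distribˡ; *-congˡ; +-congˡ)

opaque
  unfolding _+_ -_

  C-+ : ∀ c d → C (c ℤ.+ d) ≋ C c + C d
  C-+ c d = pointwise λ { zero → refl ; (suc n) → refl }

  C-* : ∀ c d → C (c ℤ.* d) ≋ C c * C d
  C-* c d = pointwise λ { zero → sym (C-*-at c (C d) 0)
                        ; (suc n) → sym (trans (C-*-at c (C d) (suc n)) (ℤ.*-zeroʳ c)) }

  C-neg : ∀ c → C (ℤ.- c) ≋ - C c
  C-neg c = pointwise λ { zero → refl ; (suc n) → refl }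

coefficientMorphism : ℤ.+-*-rawRing -Raw-AlmostCommutative⟶ fromCommutativeRing seriesRing
coefficientMorphism = record
  { ⟦_⟧ = C ; +-homo = C-+ ; *-homo = C-* ; -‿homo = C-neg ; 0-homo = ≋-refl ; 1-homo = C1 }

coefficient≟ : ∀ c d → Maybe (C c ≋ C d)
coefficient≟ c d with c ℤ.≟ d
... | yes c≡d = just (pointwise λ n → cong (λ z → C z n) c≡d)
... | no _    = nothing

module Solver = Algebra.Solver.Ring ℤ.+-*-rawRing (fromCommutativeRing seriesRing)
  coefficientMorphism coefficient≟

module ≋-Reasoning = Relation.Binary.Reasoning.Setoid (CommutativeRing.setoid seriesRing)

q : Series
q = q^ 1

q^-*-zero : ∀ k f → (q^ suc k * f) 0 ≡ 0ℤ
q^-*-zero k f = *-at-0 (q^ suc k) f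

q^-*-suc : ∀ k f n → (q^ suc k * f) (suc n) ≡ (q^ k * f) n
q^-*-suc k f n = trans (*-at-suc (q^ suc k) f n) (ℤ.+-identityˡ _)

q^-*-shift : ∀ k f n → (q^ k * f) (k ℕ.+ n) ≡ f n
q^-*-shift zero    f n = at (*-identityˡ f) n
q^-*-shift (suc k) f n = trans (q^-*-suc k f (k ℕ.+ n)) (q^-*-shift k f n)

q^-*-cancel : ∀ k {f g} → q^ k * f ≋ q^ k * g → f ≋ g
q^-*-cancel k {f} {g} p = pointwise λ n →
  trans (sym (q^-*-shift k f n)) (trans (at p (k ℕ.+ n)) (q^-*-shift k g n))

q^-+ : ∀ a b → q^ (a ℕ.+ b) ≋ q^ a * q^ b
q^-+ zero    b = ≋-sym (*-identityˡ (q^ b))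
q^-+ (suc a) b = pointwise λ
  { zero    → sym (q^-*-zero a (q^ b))
  ; (suc n) → trans (at (q^-+ a b) n) (sym (q^-*-suc a (q^ b) n)) }

q^≋q^ : ∀ k → q^ k ≋ q ^ k
q^≋q^ zero    = ≋-refl
q^≋q^ (suc k) = ≋-trans (q^-+ 1 k) (*-congˡ (q^≋q^ k))

-- Equality modulo powers of `q`

infix 4 _≡[_]_

record _≡[_]_ (f : Series) (N : ℕ) (g : Series) : Set where
  constructor truncated
  field below : ∀ n → n ℕ.< N → f n ≡ g n

open _≡[_]_ public

≋⇒≡[] : ∀ {N f g} → f ≋ g → f ≡[ N ] g
≋⇒≡[] p = truncated λ n _ → at p n

≡[]⇒≋ : ∀ {f g} → (∀ N → f ≡[ N ] g) → f ≋ g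
≡[]⇒≋ p = pointwise λ n → below (p (suc n)) n ℕ.≤-refl

≡[]-trans : ∀ {N f g h} → f ≡[ N ] g → g ≡[ N ] h → f ≡[ N ] h
≡[]-trans p r = truncated λ n n<N → trans (below p n n<N) (below r n n<N)

≡[]-sym : ∀ {N f g} → f ≡[ N ] g → g ≡[ N ] f
≡[]-sym p = truncated λ n n<N → sym (below p n n<N)

≡[]-* : ∀ {N f f′ g g′} → f ≡[ N ] f′ → g ≡[ N ] g′ → f * g ≡[ N ] f′ * g′
≡[]-* p r = truncated λ n n<N → *-cong-at n
  (λ i i≤n → below p i (ℕ.≤-<-trans i≤n n<N)) (λ i i≤n → below r i (ℕ.≤-<-trans i≤n n<N))

q^-small : ∀ {N} k f → N ℕ.≤ k → q^ k * f ≡[ N ] 0#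
q^-small k f N≤k = truncated λ n n<N → trans (vanish k f n (ℕ.<-≤-trans n<N N≤k)) (sym (C0-at n))
  where
  vanish : ∀ k f n → n ℕ.< k → (q^ k * f) n ≡ 0ℤ
  vanish (suc k) f zero    _           = q^-*-zero k f
  vanish (suc k) f (suc n) (ℕ.s≤s n<k) = trans (q^-*-suc k f n) (vanish k f n n<k)

reciprocal-* : ∀ f → f 0 ≡ 1ℤ → f * reciprocal f ≋ 1#
reciprocal-* f f₀ = pointwise λ n → trans (cong (λ h → h n) (*≡⊛ f (reciprocal f))) (reciprocal-inverse f f₀ n)

*-at-0≡1 : ∀ f g → f 0 ≡ 1ℤ → g 0 ≡ 1ℤ → (f * g) 0 ≡ 1ℤ
*-at-0≡1 f g f₀ g₀ = trans (*-at-0 f g) (cong₂ ℤ._*_ f₀ g₀)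

^-at-0≡1 : ∀ f k → f 0 ≡ 1ℤ → (f ^ k) 0 ≡ 1ℤ
^-at-0≡1 f zero    f₀ = refl
^-at-0≡1 f (suc k) f₀ = *-at-0≡1 f (f ^ k) f₀ (^-at-0≡1 f k f₀)

unit-cancel : ∀ u u⁻¹ {f g} → u * u⁻¹ ≋ 1# → u * f ≋ u * g → f ≋ g
unit-cancel u u⁻¹ {f} {g} inv p = begin
  f ≈⟨ ≋-sym (*-identityˡ f) ⟩
  1# * f ≈⟨ *-cong (≋-sym inv) ≋-refl ⟩
  u * u⁻¹ * f ≈⟨ solve 3 (λ a b c → a :* b :* c := b :* (a :* c)) ≋-refl u u⁻¹ f ⟩
  u⁻¹ * (u * f) ≈⟨ *-congˡ p ⟩
  u⁻¹ * (u * g) ≈⟨ solve 3 (λ a b c → b :* (a :* c) := a :* b :* c) ≋-refl u u⁻¹ g ⟩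
  u * u⁻¹ * g ≈⟨ *-cong inv ≋-refl ⟩
  1# * g ≈⟨ *-identityˡ g ⟩
  g ∎
  where
  open ≋-Reasoning
  open Solver

^-cong : ∀ {f g} k → f ≋ g → f ^ k ≋ g ^ k
^-cong zero    p = ≋-refl
^-cong (suc k) p = *-cong p (^-cong k p)

-- Substitution and dissection

-- spread m j f = q^j f(q^(m+1)).
spread : ℕ → ℕ → Series → Series
spread m zero    f zero    = f 0
spread m zero    f (suc n) = spread m m (tl f) n
spread m (suc j) f zero    = 0ℤ
spread m (suc j) f (suc n) = spread m j f n

spread-cong-at : ∀ m j {f g} → (∀ n → f n ≡ g n) → ∀ n → spread m j f n ≡ spread m j g n
spread-cong-at m zero    p zero    = p 0
spread-cong-at m zero    p (suc n) = spread-cong-at m m (λ i → p (suc i)) n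
spread-cong-at m (suc j) p zero    = refl
spread-cong-at m (suc j) p (suc n) = spread-cong-at m j p n

opaque
  unfolding _+_

  spread-+-at : ∀ m j f g n → spread m j (f + g) n ≡ spread m j f n ℤ.+ spread m j g n
  spread-+-at m zero    f g zero    = refl
  spread-+-at m zero    f g (suc n) = spread-+-at m m (tl f) (tl g) n
  spread-+-at m (suc j) f g zero    = refl
  spread-+-at m (suc j) f g (suc n) = spread-+-at m j f g n

  ≡[]-+ : ∀ {N f f′ g g′} → f ≡[ N ] f′ → g ≡[ N ] g′ → f + g ≡[ N ] f′ + g′
  ≡[]-+ p r = truncated λ n n<N → cong₂ ℤ._+_ (below p n n<N) (below r n n<N)

  *-at-suc′ : ∀ f g n → tl (f * g) n ≡ (f 0 · tl g + tl f * g) n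
  *-at-suc′ = *-at-suc

spread-·-at : ∀ m j c f n → spread m j (c · f) n ≡ c ℤ.* spread m j f n
spread-·-at m zero    c f zero    = refl
spread-·-at m zero    c f (suc n) = spread-·-at m m c (tl f) n
spread-·-at m (suc j) c f zero    = sym (ℤ.*-zeroʳ c)
spread-·-at m (suc j) c f (suc n) = spread-·-at m j c f n

spread-0-at : ∀ m j n → spread m j (λ _ → 0ℤ) n ≡ 0ℤ
spread-0-at m zero    zero    = refl
spread-0-at m zero    (suc n) = spread-0-at m m n
spread-0-at m (suc j) zero    = refl
spread-0-at m (suc j) (suc n) = spread-0-at m j n

spread-*-at : ∀ m j f g n → spread m j (f * g) n ≡ (spread m j f * spread m 0 g) n
spread-*-at m zero f g zero = trans (*-at-0 f g) (sym (*-at-0 (spread m 0 f) (spread m 0 g)))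
spread-*-at m zero f g (suc n) = begin
  spread m m (tl (f * g)) n ≡⟨ spread-cong-at m m (*-at-suc′ f g) n ⟩
  spread m m (f 0 · tl g + tl f * g) n ≡⟨ spread-+-at m m (f 0 · tl g) (tl f * g) n ⟩
  spread m m (f 0 · tl g) n ℤ.+ spread m m (tl f * g) n ≡⟨ cong₂ ℤ._+_ (spread-·-at m m (f 0) (tl g) n) (spread-*-at m m (tl f) g n) ⟩
  f 0 ℤ.* spread m m (tl g) n ℤ.+ (spread m m (tl f) * spread m 0 g) n ≡⟨ sym (*-at-suc (spread m 0 f) (spread m 0 g) n) ⟩
  (spread m 0 f * spread m 0 g) (suc n) ∎
  where open ≡-Reasoning
spread-*-at m (suc j) f g zero = sym (*-at-0 (spread m (suc j) f) (spread m 0 g))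
spread-*-at m (suc j) f g (suc n) = trans (spread-*-at m j f g n)
  (sym (trans (*-at-suc (spread m (suc j) f) (spread m 0 g) n) (ℤ.+-identityˡ _)))

spread-skip : ∀ m j f n → spread m j f (j ℕ.+ n) ≡ spread m 0 f n
spread-skip m zero    f n = refl
spread-skip m (suc j) f n = spread-skip m j f n

spread-gap : ∀ m j f {n} → n ℕ.< j → spread m j f n ≡ 0ℤ
spread-gap m (suc j) f {zero}  _           = refl
spread-gap m (suc j) f {suc n} (ℕ.s≤s n<j) = spread-gap m j f n<j

-- The substitution f(q) ↦ f(q^m).
S : (m : ℕ) .{{_ : NonZero m}} → Series → Series
S (suc m) = spread m 0

S-cong : ∀ m .{{_ : NonZero m}} {f g} → f ≋ g → S m f ≋ S m g
S-cong (suc m) p = pointwise (spread-cong-at m 0 (at p))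

S-+ : ∀ m .{{_ : NonZero m}} f g → S m (f + g) ≋ S m f + S m g
S-+ (suc m) f g = pointwise λ n → trans (spread-+-at m 0 f g n) (sym (+-at (S (suc m) f) (S (suc m) g) n))

S-* : ∀ m .{{_ : NonZero m}} f g → S m (f * g) ≋ S m f * S m g
S-* (suc m) f g = pointwise (spread-*-at m 0 f g)

S-multiple : ∀ m .{{_ : NonZero m}} f k → S m f (m ℕ.* k) ≡ f k
S-multiple (suc m) f zero    = cong (spread m 0 f) (ℕ.*-zeroʳ m)
S-multiple (suc m) f (suc k) = begin
  spread m 0 f (suc m ℕ.* suc k) ≡⟨ cong (spread m 0 f) (ℕ.*-suc (suc m) k) ⟩
  spread m m (tl f) (m ℕ.+ suc m ℕ.* k) ≡⟨ spread-skip m m (tl f) _ ⟩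
  spread m 0 (tl f) (suc m ℕ.* k) ≡⟨ S-multiple (suc m) (tl f) k ⟩
  f (suc k) ∎
  where open ≡-Reasoning

S-nonmultiple : ∀ m .{{_ : NonZero m}} f {i} k → suc i ℕ.< m → S m f (suc i ℕ.+ m ℕ.* k) ≡ 0ℤ
S-nonmultiple (suc m) f {i} zero (ℕ.s≤s i<m)
  rewrite ℕ.*-zeroʳ m | ℕ.+-identityʳ i = spread-gap m m (tl f) i<m
S-nonmultiple (suc m) f {i} (suc k) i<m = begin
  spread m 0 f (suc i ℕ.+ suc m ℕ.* suc k) ≡⟨ cong (spread m 0 f) (cong (suc i ℕ.+_) (ℕ.*-suc (suc m) k)) ⟩
  spread m 0 f (suc i ℕ.+ (suc m ℕ.+ suc m ℕ.* k)) ≡⟨ cong (spread m 0 f) (swap i m (suc m ℕ.* k)) ⟩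
  spread m m (tl f) (m ℕ.+ (suc i ℕ.+ suc m ℕ.* k)) ≡⟨ spread-skip m m (tl f) _ ⟩
  spread m 0 (tl f) (suc i ℕ.+ suc m ℕ.* k) ≡⟨ S-nonmultiple (suc m) (tl f) k i<m ⟩
  0ℤ ∎
  where
  open ≡-Reasoning
  swap : ∀ a b c → suc a ℕ.+ (suc b ℕ.+ c) ≡ suc (b ℕ.+ (suc a ℕ.+ c))
  swap a b c = cong suc (trans (sym (ℕ.+-assoc a (suc b) c)) (trans (cong (ℕ._+ c) (trans (ℕ.+-suc a b)
    (trans (ℕ.+-comm (suc a) b) refl))) (ℕ.+-assoc b (suc a) c)))

S-ext : ∀ m .{{_ : NonZero m}} f g → (∀ k → g (m ℕ.* k) ≡ f k) →
        (∀ i k → suc i ℕ.< m → g (suc i ℕ.+ m ℕ.* k) ≡ 0ℤ) → S m f ≋ g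
S-ext m f g onMultiples off = pointwise λ n → subst (λ x → S m f x ≡ g x)
  (sym (trans (m≡m%n+[m/n]*n n m) (cong (n % m ℕ.+_) (ℕ.*-comm (n div m) m)))) (split (n % m) (n div m) (m%n<n n m))
  where
  split : ∀ i k → i ℕ.< m → S m f (i ℕ.+ m ℕ.* k) ≡ g (i ℕ.+ m ℕ.* k)
  split zero    k _   = trans (S-multiple m f k) (sym (onMultiples k))
  split (suc i) k i<m = trans (S-nonmultiple m f k i<m) (sym (off i k i<m))

S-q^ : ∀ m .{{_ : NonZero m}} k → S m (q^ k) ≋ q^ (m ℕ.* k)
S-q^ (suc m) zero = ≋-trans (pointwise atZero) (pointwise λ n → cong (λ z → (q^ z) n) (sym (ℕ.*-zeroʳ m)))
  where
  atZero : ∀ n → spread m 0 (q^ 0) n ≡ (q^ 0) n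
  atZero zero    = refl
  atZero (suc n) = spread-0-at m m n
S-q^ (suc m) (suc k) = ≋-trans (pointwise λ { zero → refl ; (suc n) → next m n })
  (pointwise λ n → cong (λ z → (q^ z) n) (sym (ℕ.*-suc (suc m) k)))
  where
  next : ∀ j n → spread m j (q^ k) n ≡ (q^ (j ℕ.+ suc m ℕ.* k)) n
  next zero    n       = at (S-q^ (suc m) k) n
  next (suc j) zero    = refl
  next (suc j) (suc n) = next j n

S-C : ∀ m .{{_ : NonZero m}} c → S m (C c) ≋ C c
S-C (suc m) c = pointwise λ { zero → refl ; (suc n) → spread-0-at m m n }

S-1# : ∀ m .{{_ : NonZero m}} → S m 1# ≋ 1#
S-1# m = ≋-trans (S-cong m (≋-sym C1)) (≋-trans (S-C m 1ℤ) C1)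

S-neg : ∀ m .{{_ : NonZero m}} f → S m (- f) ≋ - S m f
S-neg m f = begin
  S m (- f) ≈⟨ S-cong m (solve 1 (λ x → :- x := con (ℤ.- 1ℤ) :* x) ≋-refl f) ⟩
  S m (C (ℤ.- 1ℤ) * f) ≈⟨ S-* m _ f ⟩
  S m (C (ℤ.- 1ℤ)) * S m f ≈⟨ *-cong (S-C m _) ≋-refl ⟩
  C (ℤ.- 1ℤ) * S m f ≈⟨ solve 1 (λ x → con (ℤ.- 1ℤ) :* x := :- x) ≋-refl (S m f) ⟩
  - S m f ∎
  where
  open ≋-Reasoning
  open Solver

S-injective : ∀ m .{{_ : NonZero m}} {f g} → S m f ≋ S m g → f ≋ g
S-injective m {f} {g} p = pointwise λ k →
  trans (sym (S-multiple m f k)) (trans (at p (m ℕ.* k)) (S-multiple m g k))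

S-∘ : ∀ m n .{{_ : NonZero m}} .{{_ : NonZero n}} .{{_ : NonZero (m ℕ.* n)}} f →
      S (m ℕ.* n) f ≋ S m (S n f)
S-∘ m n f = S-ext (m ℕ.* n) f (S m (S n f)) onMultiples off
  where
  onMultiples : ∀ k → S m (S n f) (m ℕ.* n ℕ.* k) ≡ f k
  onMultiples k = trans (cong (S m (S n f)) (ℕ.*-assoc m n k))
    (trans (S-multiple m (S n f) (n ℕ.* k)) (S-multiple n f k))

  -- An exponent that is no multiple of mn fails either at m, when r > 0, or at n, when r = 0 and 0
  -- < t < n.
  split : ∀ r t k → r ℕ.< m → 0 ℕ.< r ℕ.+ m ℕ.* t → r ℕ.+ m ℕ.* t ℕ.< m ℕ.* n →
          S m (S n f) (r ℕ.+ m ℕ.* t ℕ.+ m ℕ.* n ℕ.* k) ≡ 0ℤ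
  split zero zero k _ 0<m*0 _ rewrite ℕ.*-zeroʳ m with () ← 0<m*0
  split zero (suc t) k _ _ <mn = trans (cong (S m (S n f)) (regroup (suc t)))
    (trans (S-multiple m (S n f) (suc t ℕ.+ n ℕ.* k)) (S-nonmultiple n f k (ℕ.*-cancelˡ-< m (suc t) n <mn)))
    where
    regroup : ∀ t → m ℕ.* t ℕ.+ m ℕ.* n ℕ.* k ≡ m ℕ.* (t ℕ.+ n ℕ.* k)
    regroup t = trans (cong (m ℕ.* t ℕ.+_) (ℕ.*-assoc m n k)) (sym (ℕ.*-distribˡ-+ m t (n ℕ.* k)))
  split (suc r) t k r<m _ _ = trans (cong (S m (S n f)) regroup)
    (S-nonmultiple m (S n f) (t ℕ.+ n ℕ.* k) r<m)
    where
    regroup : suc r ℕ.+ m ℕ.* t ℕ.+ m ℕ.* n ℕ.* k ≡ suc r ℕ.+ m ℕ.* (t ℕ.+ n ℕ.* k)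
    regroup = trans (ℕ.+-assoc (suc r) (m ℕ.* t) _) (cong (suc r ℕ.+_)
      (trans (cong (m ℕ.* t ℕ.+_) (ℕ.*-assoc m n k)) (sym (ℕ.*-distribˡ-+ m t (n ℕ.* k)))))

  off : ∀ i k → suc i ℕ.< m ℕ.* n → S m (S n f) (suc i ℕ.+ m ℕ.* n ℕ.* k) ≡ 0ℤ
  off i k i<mn = subst (λ x → S m (S n f) (x ℕ.+ m ℕ.* n ℕ.* k) ≡ 0ℤ) (sym eq)
    (split (suc i % m) (suc i div m) k (m%n<n (suc i) m)
      (subst (0 ℕ.<_) eq (ℕ.s≤s ℕ.z≤n)) (subst (ℕ._< m ℕ.* n) eq i<mn))
    where
    eq : suc i ≡ suc i % m ℕ.+ m ℕ.* (suc i div m)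
    eq = trans (m≡m%n+[m/n]*n (suc i) m) (cong (suc i % m ℕ.+_) (ℕ.*-comm (suc i div m) m))

S₂S₅ : ∀ f → S 2 (S 5 f) ≋ S 5 (S 2 f)
S₂S₅ f = ≋-trans (≋-sym (S-∘ 2 5 f)) (S-∘ 5 2 f)

record Quint {a} (A : Set a) : Set a where
  constructor ⟨_,_,_,_,_⟩
  field c₀ c₁ c₂ c₃ c₄ : A

open Quint public

-- Multiplication in A[x]/(x⁵ - Q).
multiply : ∀ {a} {A : Set a} → (A → A → A) → (A → A → A) → A → Quint A → Quint A → Quint A
multiply _+′_ _*′_ Q ⟨ a₀ , a₁ , a₂ , a₃ , a₄ ⟩ ⟨ b₀ , b₁ , b₂ , b₃ , b₄ ⟩ =
  ⟨ (a₀ *′ b₀) +′ (Q *′ (((a₁ *′ b₄) +′ (a₂ *′ b₃)) +′ ((a₃ *′ b₂) +′ (a₄ *′ b₁))))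
  , ((a₀ *′ b₁) +′ (a₁ *′ b₀)) +′ (Q *′ (((a₂ *′ b₄) +′ (a₃ *′ b₃)) +′ (a₄ *′ b₂)))
  , (((a₀ *′ b₂) +′ (a₁ *′ b₁)) +′ (a₂ *′ b₀)) +′ (Q *′ ((a₃ *′ b₄) +′ (a₄ *′ b₃)))
  , (((a₀ *′ b₃) +′ (a₁ *′ b₂)) +′ ((a₂ *′ b₁) +′ (a₃ *′ b₀))) +′ (Q *′ (a₄ *′ b₄))
  , (((a₀ *′ b₄) +′ (a₁ *′ b₃)) +′ ((a₂ *′ b₂) +′ (a₃ *′ b₁))) +′ (a₄ *′ b₀) ⟩

infixl 7 _⊠_

_⊠_ : Quint Series → Quint Series → Quint Series
_⊠_ = multiply _+_ _*_ q

D : Quint Series → Series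
D ⟨ t₀ , t₁ , t₂ , t₃ , t₄ ⟩ = S 5 t₀ + q * (S 5 t₁ + q * (S 5 t₂ + q * (S 5 t₃ + q * S 5 t₄)))

S₅q : S 5 q ≋ q ^ 5
S₅q = ≋-trans (S-q^ 5 1) (q^≋q^ 5)

-- With q⁵ renamed to q, ℤ[[q]] becomes ℤ[[q]][x]/(x⁵ - q), and `D` is this isomorphism of rings.
-- Every statement about exponents modulo 5 thereby turns into polynomial algebra in the components.
D-⊠ : ∀ s t → D (s ⊠ t) ≋ D s * D t
D-⊠ ⟨ a₀ , a₁ , a₂ , a₃ , a₄ ⟩ ⟨ b₀ , b₁ , b₂ , b₃ , b₄ ⟩ = ≋-trans
  (+-cong (hom+ (hom* a₀ b₀) (homq (hom+ (hom+ (hom* a₁ b₄) (hom* a₂ b₃)) (hom+ (hom* a₃ b₂) (hom* a₄ b₁)))))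
  (*-congˡ (+-cong (hom+ (hom+ (hom* a₀ b₁) (hom* a₁ b₀)) (homq (hom+ (hom+ (hom* a₂ b₄) (hom* a₃ b₃)) (hom* a₄ b₂))))
  (*-congˡ (+-cong (hom+ (hom+ (hom+ (hom* a₀ b₂) (hom* a₁ b₁)) (hom* a₂ b₀)) (homq (hom+ (hom* a₃ b₄) (hom* a₄ b₃))))
  (*-congˡ (+-cong (hom+ (hom+ (hom+ (hom* a₀ b₃) (hom* a₁ b₂)) (hom+ (hom* a₂ b₁) (hom* a₃ b₀))) (homq (hom* a₄ b₄)))
  (*-congˡ (hom+ (hom+ (hom+ (hom* a₀ b₄) (hom* a₁ b₃)) (hom+ (hom* a₂ b₂) (hom* a₃ b₁))) (hom* a₄ b₀))))))))))
  (solve 11 (λ q a₀ a₁ a₂ a₃ a₄ b₀ b₁ b₂ b₃ b₄ →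
      let open Quint (multiply _:+_ _:*_ (q :^ 5) ⟨ a₀ , a₁ , a₂ , a₃ , a₄ ⟩ ⟨ b₀ , b₁ , b₂ , b₃ , b₄ ⟩)
            renaming (c₀ to d₀; c₁ to d₁; c₂ to d₂; c₃ to d₃; c₄ to d₄) in
      d₀ :+ q :* (d₁ :+ q :* (d₂ :+ q :* (d₃ :+ q :* d₄)))
      := (a₀ :+ q :* (a₁ :+ q :* (a₂ :+ q :* (a₃ :+ q :* a₄)))) :* (b₀ :+ q :* (b₁ :+ q :* (b₂ :+ q :* (b₃ :+ q :* b₄)))))
    ≋-refl q (S 5 a₀) (S 5 a₁) (S 5 a₂) (S 5 a₃) (S 5 a₄) (S 5 b₀) (S 5 b₁) (S 5 b₂) (S 5 b₃) (S 5 b₄))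
  where
  open Solver
  hom* : ∀ f g → S 5 (f * g) ≋ S 5 f * S 5 g
  hom* = S-* 5
  hom+ : ∀ {f g f′ g′} → S 5 f ≋ f′ → S 5 g ≋ g′ → S 5 (f + g) ≋ f′ + g′
  hom+ {f} {g} p r = ≋-trans (S-+ 5 f g) (+-cong p r)
  homq : ∀ {f f′} → S 5 f ≋ f′ → S 5 (q * f) ≋ q ^ 5 * f′
  homq {f} p = ≋-trans (S-* 5 q f) (*-cong S₅q p)

V : ℕ → Series → Series
V i f n = f (i ℕ.+ 5 ℕ.* n)

dissection : Series → Quint Series
dissection f = ⟨ V 0 f , V 1 f , V 2 f , V 3 f , V 4 f ⟩

infix 4 _≋₅_

record _≋₅_ (s t : Quint Series) : Set where
  constructor ≋⟨_,_,_,_,_⟩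
  field
    e₀ : c₀ s ≋ c₀ t
    e₁ : c₁ s ≋ c₁ t
    e₂ : c₂ s ≋ c₂ t
    e₃ : c₃ s ≋ c₃ t
    e₄ : c₄ s ≋ c₄ t

open _≋₅_ public

private
  q*-suc : ∀ f g n → (f + q * g) (suc n) ≡ f (suc n) ℤ.+ g n
  q*-suc f g n = trans (+-at f (q * g) (suc n)) (cong (λ z → f (suc n) ℤ.+ z) (trans (q^-*-suc 0 g n) (at (*-identityˡ g) n)))

  q*-skip : ∀ f g i k → suc i ℕ.< 5 → (S 5 f + q * g) (suc i ℕ.+ 5 ℕ.* k) ≡ g (i ℕ.+ 5 ℕ.* k)
  q*-skip f g i k i<5 = trans (q*-suc (S 5 f) g (i ℕ.+ 5 ℕ.* k))
    (trans (cong (ℤ._+ g (i ℕ.+ 5 ℕ.* k)) (S-nonmultiple 5 f k i<5)) (ℤ.+-identityˡ _))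

  -- At multiples of 5 the inner Horner series is sampled at exponents 4 modulo 5. Each further
  -- level of nesting lowers this residue by one, until a series in q⁵ is sampled off the multiples
  -- of 5.
  q*-stop : ∀ f g → (∀ k → g (4 ℕ.+ 5 ℕ.* k) ≡ 0ℤ) → ∀ k → (S 5 f + q * g) (5 ℕ.* k) ≡ f k
  q*-stop f g g₄ zero = trans (+-at (S 5 f) (q * g) 0) (trans (cong (λ z → f 0 ℤ.+ z) (q^-*-zero 0 g)) (ℤ.+-identityʳ (f 0)))
  q*-stop f g g₄ (suc k) = begin
    (S 5 f + q * g) (5 ℕ.* suc k) ≡⟨ cong (S 5 f + q * g) (ℕ.*-suc 5 k) ⟩
    (S 5 f + q * g) (5 ℕ.+ 5 ℕ.* k) ≡⟨ q*-suc (S 5 f) g (4 ℕ.+ 5 ℕ.* k) ⟩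
    S 5 f (5 ℕ.+ 5 ℕ.* k) ℤ.+ g (4 ℕ.+ 5 ℕ.* k) ≡⟨ cong₂ ℤ._+_ (cong (S 5 f) (sym (ℕ.*-suc 5 k))) (g₄ k) ⟩
    S 5 f (5 ℕ.* suc k) ℤ.+ 0ℤ ≡⟨ ℤ.+-identityʳ _ ⟩
    S 5 f (5 ℕ.* suc k) ≡⟨ S-multiple 5 f (suc k) ⟩
    f (suc k) ∎
    where open ≡-Reasoning

D-coefficients : ∀ t → dissection (D t) ≋₅ t
D-coefficients ⟨ t₀ , t₁ , t₂ , t₃ , t₄ ⟩ =
  ≋⟨ pointwise (q*-stop t₀ X₁ λ k → trans (skip₁ 3 4<5 k) (trans (skip₂ 2 3<5 k) (trans (skip₃ 1 2<5 k) (S-nonmultiple 5 t₄ k 1<5))))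
  ,  pointwise (λ k → trans (skip₀ 0 1<5 k) (q*-stop t₁ X₂ (λ k → trans (skip₂ 3 4<5 k) (trans (skip₃ 2 3<5 k) (S-nonmultiple 5 t₄ k 2<5))) k))
  ,  pointwise (λ k → trans (skip₀ 1 2<5 k) (trans (skip₁ 0 1<5 k) (q*-stop t₂ X₃ (λ k → trans (skip₃ 3 4<5 k) (S-nonmultiple 5 t₄ k 3<5)) k)))
  ,  pointwise (λ k → trans (skip₀ 2 3<5 k) (trans (skip₁ 1 2<5 k) (trans (skip₂ 0 1<5 k) (q*-stop t₃ (S 5 t₄) (λ k → S-nonmultiple 5 t₄ k 4<5) k))))
  ,  pointwise (λ k → trans (skip₀ 3 4<5 k) (trans (skip₁ 2 3<5 k) (trans (skip₂ 1 2<5 k) (trans (skip₃ 0 1<5 k) (S-multiple 5 t₄ k))))) ⟩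
  where
  X₃ X₂ X₁ : Series
  X₃ = S 5 t₃ + q * S 5 t₄
  X₂ = S 5 t₂ + q * X₃
  X₁ = S 5 t₁ + q * X₂
  1<5 : 1 ℕ.< 5
  1<5 = ℕ.m≤m+n 2 3
  2<5 : 2 ℕ.< 5
  2<5 = ℕ.m≤m+n 3 2
  3<5 : 3 ℕ.< 5
  3<5 = ℕ.m≤m+n 4 1
  4<5 : 4 ℕ.< 5
  4<5 = ℕ.≤-refl
  skip₀ : ∀ i → suc i ℕ.< 5 → ∀ k → D ⟨ t₀ , t₁ , t₂ , t₃ , t₄ ⟩ (suc i ℕ.+ 5 ℕ.* k) ≡ X₁ (i ℕ.+ 5 ℕ.* k)
  skip₀ i i<5 k = q*-skip t₀ X₁ i k i<5
  skip₁ : ∀ i → suc i ℕ.< 5 → ∀ k → X₁ (suc i ℕ.+ 5 ℕ.* k) ≡ X₂ (i ℕ.+ 5 ℕ.* k)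
  skip₁ i i<5 k = q*-skip t₁ X₂ i k i<5
  skip₂ : ∀ i → suc i ℕ.< 5 → ∀ k → X₂ (suc i ℕ.+ 5 ℕ.* k) ≡ X₃ (i ℕ.+ 5 ℕ.* k)
  skip₂ i i<5 k = q*-skip t₂ X₃ i k i<5
  skip₃ : ∀ i → suc i ℕ.< 5 → ∀ k → X₃ (suc i ℕ.+ 5 ℕ.* k) ≡ S 5 t₄ (i ℕ.+ 5 ℕ.* k)
  skip₃ i i<5 k = q*-skip t₃ (S 5 t₄) i k i<5

V-cong : ∀ i {f g} → f ≋ g → V i f ≋ V i g
V-cong i p = pointwise λ n → at p (i ℕ.+ 5 ℕ.* n)

dissection-cong : ∀ {f g} → f ≋ g → dissection f ≋₅ dissection g
dissection-cong p = ≋⟨ V-cong 0 p , V-cong 1 p , V-cong 2 p , V-cong 3 p , V-cong 4 p ⟩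

≋₅-sym : ∀ {s t} → s ≋₅ t → t ≋₅ s
≋₅-sym p = ≋⟨ ≋-sym (e₀ p) , ≋-sym (e₁ p) , ≋-sym (e₂ p) , ≋-sym (e₃ p) , ≋-sym (e₄ p) ⟩

≋₅-trans : ∀ {s t u} → s ≋₅ t → t ≋₅ u → s ≋₅ u
≋₅-trans p r = ≋⟨ ≋-trans (e₀ p) (e₀ r) , ≋-trans (e₁ p) (e₁ r) , ≋-trans (e₂ p) (e₂ r)
                , ≋-trans (e₃ p) (e₃ r) , ≋-trans (e₄ p) (e₄ r) ⟩

D-cong : ∀ {s t} → s ≋₅ t → D s ≋ D t
D-cong p = +-cong (S-cong 5 (e₀ p)) (*-congˡ (+-cong (S-cong 5 (e₁ p)) (*-congˡ
  (+-cong (S-cong 5 (e₂ p)) (*-congˡ (+-cong (S-cong 5 (e₃ p)) (*-congˡ (S-cong 5 (e₄ p)))))))))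

-- Splits one identity of series into five, one for each residue of the exponent.
D-injective : ∀ {s t} → D s ≋ D t → s ≋₅ t
D-injective {s} {t} p = ≋₅-trans (≋₅-sym (D-coefficients s)) (≋₅-trans (dissection-cong p) (D-coefficients t))

D-dissection : ∀ f → f ≋ D (dissection f)
D-dissection f = pointwise λ n → subst (λ x → f x ≡ D (dissection f) x)
  (sym (trans (m≡m%n+[m/n]*n n 5) (cong (n % 5 ℕ.+_) (ℕ.*-comm (n div 5) 5))))
  (residue (n % 5) (n div 5) (m%n<n n 5))
  where
  coefficients : dissection (D (dissection f)) ≋₅ dissection f
  coefficients = D-coefficients (dissection f)
  residue : ∀ i k → i ℕ.< 5 → f (i ℕ.+ 5 ℕ.* k) ≡ D (dissection f) (i ℕ.+ 5 ℕ.* k)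
  residue 0 k _ = sym (at (e₀ coefficients) k)
  residue 1 k _ = sym (at (e₁ coefficients) k)
  residue 2 k _ = sym (at (e₂ coefficients) k)
  residue 3 k _ = sym (at (e₃ coefficients) k)
  residue 4 k _ = sym (at (e₄ coefficients) k)
  residue (suc (suc (suc (suc (suc i))))) k (ℕ.s≤s (ℕ.s≤s (ℕ.s≤s (ℕ.s≤s (ℕ.s≤s ())))))

-- Identities of Euler and Gauss

q^-cong : ∀ {a b} → a ≡ b → q^ a ≋ q^ b
q^-cong refl = ≋-refl

-- Denotes 1#, whereas con 1ℤ denotes C 1ℤ.
:1 : ∀ {n} → Solver.Polynomial (suc n)
:1 = Solver.var zero Solver.:^ 0

1-q^-at-0 : ∀ k → (1# - q^ suc k) 0 ≡ 1ℤ
1-q^-at-0 k = trans (+-at 1# (- q^ suc k) 0) (cong (λ z → 1ℤ ℤ.+ z) (neg-at (q^ suc k) 0))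

eulerProduct : ℕ → ℕ → Series
eulerProduct m N = ∏[j< N ] λ j → 1# ⊖ q^ (m ℕ.+ m ℕ.* j)

eulerProduct-suc : ∀ m N → eulerProduct m (suc N) ≋ eulerProduct m N * (1# - q^ (m ℕ.+ m ℕ.* N))
eulerProduct-suc m N = pointwise λ n → cong (λ h → h n) (sym (trans
  (*≡⊛ (eulerProduct m N) (1# - q^ (m ℕ.+ m ℕ.* N)))
  (cong (eulerProduct m N ⊛_) (sym (⊖≡- 1# (q^ (m ℕ.+ m ℕ.* N)))))))

eulerProduct-stable : ∀ m .{{_ : NonZero m}} N → eulerProduct m (suc N) ≡[ suc N ] eulerProduct m N
eulerProduct-stable m@(suc m′) N = ≡[]-trans
  (≋⇒≡[] (≋-trans (eulerProduct-suc m N)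
    (solve 2 (λ p x → p :* (:1 :- x) := p :+ x :* (:- p)) ≋-refl (eulerProduct m N) (q^ (m ℕ.+ m ℕ.* N)))))
  (≡[]-trans (≡[]-+ (≋⇒≡[] ≋-refl) (q^-small (m ℕ.+ m ℕ.* N) _ (ℕ.s≤s (ℕ.≤-trans (ℕ.m≤n*m N m) (ℕ.m≤n+m _ m′)))))
    (≋⇒≡[] (+-identityʳ _)))
  where open Solver

-- By definition `E m` uses a different number of factors for each coefficient. Here one finite
-- product serves all coefficients up to qᴺ, because the later factors change only higher ones.
E-truncated : ∀ m .{{_ : NonZero m}} N → E m ≡[ suc N ] eulerProduct m N
E-truncated m N = truncated λ { n (ℕ.s≤s n≤N) →
  subst (λ k → eulerProduct m n n ≡ eulerProduct m k n) (ℕ.m+[n∸m]≡n n≤N) (sym (extend n (N ℕ.∸ n))) }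
  where
  extend : ∀ n d → eulerProduct m (n ℕ.+ d) n ≡ eulerProduct m n n
  extend n zero    = cong (λ k → eulerProduct m k n) (ℕ.+-identityʳ n)
  extend n (suc d) = trans (cong (λ k → eulerProduct m k n) (ℕ.+-suc n d))
    (trans (below (eulerProduct-stable m (n ℕ.+ d)) n (ℕ.s≤s (ℕ.m≤m+n n d))) (extend n d))

≡[]-weaken : ∀ {N N′ f g} → N ℕ.≤ N′ → f ≡[ N′ ] g → f ≡[ N ] g
≡[]-weaken N≤N′ p = truncated λ n n<N → below p n (ℕ.<-≤-trans n<N N≤N′)

S-truncated : ∀ m .{{_ : NonZero m}} {N f g} → f ≡[ N ] g → S m f ≡[ N ] S m g
S-truncated (suc m) {N} p = truncated λ n n<N → go 0 n (λ i i≤n → below p i (ℕ.≤-<-trans i≤n n<N))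
  where
  go : ∀ {f g} j n → (∀ i → i ℕ.≤ n → f i ≡ g i) → spread m j f n ≡ spread m j g n
  go zero    zero    eq = eq 0 ℕ.z≤n
  go zero    (suc n) eq = go m n (λ i i≤n → eq (suc i) (ℕ.s≤s i≤n))
  go (suc j) zero    eq = refl
  go (suc j) (suc n) eq = go j n (λ i i≤n → eq i (ℕ.m≤n⇒m≤1+n i≤n))

S-eulerProduct : ∀ m .{{_ : NonZero m}} N → S m (eulerProduct 1 N) ≋ eulerProduct m N
S-eulerProduct m zero    = S-1# m
S-eulerProduct m (suc N) = begin
  S m (eulerProduct 1 (suc N)) ≈⟨ S-cong m (eulerProduct-suc 1 N) ⟩
  S m (eulerProduct 1 N * (1# - q^ (1 ℕ.+ 1 ℕ.* N))) ≈⟨ S-* m _ _ ⟩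
  S m (eulerProduct 1 N) * S m (1# + - q^ (1 ℕ.+ 1 ℕ.* N)) ≈⟨ *-cong (S-eulerProduct m N)
    (≋-trans (S-+ m 1# (- q^ (1 ℕ.+ 1 ℕ.* N))) (+-cong (S-1# m) (≋-trans (S-neg m (q^ (1 ℕ.+ 1 ℕ.* N))) (-‿cong
      (≋-trans (S-q^ m (1 ℕ.+ 1 ℕ.* N)) (q^-cong (ℕ-Solver.solve 2 (λ m N → m :* (con 1 :+ con 1 :* N) := m :+ m :* N) refl m N))))))) ⟩
  eulerProduct m N * (1# + - q^ (m ℕ.+ m ℕ.* N)) ≈⟨ ≋-sym (eulerProduct-suc m N) ⟩
  eulerProduct m (suc N) ∎
  where
  open ≋-Reasoning
  open ℕ-Solver using (_:*_; _:+_; con; _:=_)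

E≋S : ∀ m .{{_ : NonZero m}} → E m ≋ S m (E 1)
E≋S m = ≡[]⇒≋ λ N → ≡[]-weaken (ℕ.n≤1+n N) (≡[]-trans (E-truncated m N)
  (≡[]-trans (≋⇒≡[] (≋-sym (S-eulerProduct m N))) (S-truncated m (≡[]-sym (E-truncated 1 N)))))

∑ℤ : ∀ {I : Set} → List I → (I → ℤ) → ℤ
∑ℤ []       f = 0ℤ
∑ℤ (x ∷ xs) f = f x ℤ.+ ∑ℤ xs f

∑ : ∀ {I : Set} → List I → (I → Series) → Series
∑ xs f n = ∑ℤ xs (λ x → f x n)

∑-∷ : ∀ {I : Set} (x : I) xs f → ∑ (x ∷ xs) f ≋ f x + ∑ xs f
∑-∷ x xs f = pointwise λ n → sym (+-at (f x) (∑ xs f) n)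

-- The integers a with -N ≤ a < N.
range : ℕ → List ℤ
range zero    = []
range (suc N) = + N ∷ -[1+ N ] ∷ range N

triangular : ℕ → ℕ
triangular zero    = 0
triangular (suc n) = suc n ℕ.+ triangular n

-- a(3a+1)/2
pentagonal : ℤ → ℕ
pentagonal (+ n)    = n ℕ.* n ℕ.+ triangular n
pentagonal -[1+ n ] = suc n ℕ.* n ℕ.+ triangular (suc n)

sgnℕ : ℕ → ℤ
sgnℕ zero    = 1ℤ
sgnℕ (suc n) = ℤ.- sgnℕ n

sgn : ℤ → ℤ
sgn (+ n)    = sgnℕ n
sgn -[1+ n ] = sgnℕ (suc n)

C-neg-* : ∀ c f → C (ℤ.- c) * f ≋ - (C c * f)
C-neg-* c f = ≋-trans (*-cong (C-neg c) ≋-refl) (solve 2 (λ x y → :- x :* y := :- (x :* y)) ≋-refl (C c) f)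
  where open Solver

-- Telescoping after D. Shanks, A short proof of an identity of Euler,
-- Proc. Amer. Math. Soc. 2 (1951).
module Euler where
  open Solver

  P I : ℕ → Series
  P = eulerProduct 1
  I n = reciprocal (P n)

  P-suc : ∀ n → P (suc n) ≋ P n * (1# - q^ suc n)
  P-suc n = ≋-trans (eulerProduct-suc 1 n) (*-congˡ (+-congˡ (-‿cong (q^-cong (cong suc (ℕ.+-identityʳ n))))))

  P-at-0 : ∀ n → P n 0 ≡ 1ℤ
  P-at-0 zero    = refl
  P-at-0 (suc n) = trans (at (P-suc n) 0) (*-at-0≡1 (P n) (1# - q^ suc n) (P-at-0 n) (1-q^-at-0 n))

  PI : ∀ n → P n * I n ≋ 1#
  PI n = reciprocal-* (P n) (P-at-0 n)

  I-suc : ∀ n → I (suc n) * (1# - q^ suc n) ≋ I n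
  I-suc n = unit-cancel (P n) (I n) (PI n) (begin
    P n * (I (suc n) * (1# - q^ suc n)) ≈⟨ solve 3 (λ p i x → p :* (i :* x) := p :* x :* i) ≋-refl (P n) (I (suc n)) (1# - q^ suc n) ⟩
    P n * (1# - q^ suc n) * I (suc n) ≈⟨ *-cong (≋-sym (P-suc n)) ≋-refl ⟩
    P (suc n) * I (suc n) ≈⟨ PI (suc n) ⟩
    1# ≈⟨ ≋-sym (PI n) ⟩
    P n * I n ∎)
    where open ≋-Reasoning

  -- The summand (-1)ˢ (q)ₙ/(q)ₛ q^(sn + s(s+1)/2) of Shanks's finite form of the pentagonal number
  -- theorem, where (q)ₙ = (1-q)(1-q²)...(1-qⁿ).
  term : ℕ → ℕ → Series
  term n s = C (sgnℕ s) * (P n * I s * q^ (s ℕ.* n ℕ.+ triangular s))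

  A : ℕ → ℕ → Series
  A n zero    = 0#
  A n (suc i) = A n i + term n i

  -- Raising `n` alters the partial sum by a boundary term only: the factor 1 - q^(n+1) of (q)ₙ₊₁
  -- splits each new summand into two parts, and these cancel between neighbouring summands.
  A-suc : ∀ n i → A (suc n) i ≋ A n i + C (sgnℕ i) * (P n * (I i * (1# - q^ i)) * q^ (i ℕ.* n ℕ.+ triangular i))
  A-suc n zero = solve 4 (λ z c p i → z := z :+ c :* (p :* (i :* (:1 :- :1)) :* :1)) ≋-refl 0# (C 1ℤ) (P n) (I 0)
  A-suc n (suc i) = begin
    A (suc n) i + term (suc n) i
      ≈⟨ +-cong (A-suc n i) (*-congˡ (*-cong (*-cong (P-suc n) ≋-refl) q-xz)) ⟩
    (A n i + c * (P n * (I i * (1# - z)) * x)) + c * (P n * (1# - y) * I i * (x * z))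
      ≈⟨ solve 7 (λ a c p i x y z → (a :+ c :* (p :* (i :* (:1 :- z)) :* x)) :+ c :* (p :* (:1 :- y) :* i :* (x :* z))
           := (a :+ c :* (p :* i :* x)) :+ :- (c :* (p :* i :* (x :* z :* y)))) ≋-refl (A n i) c (P n) (I i) x y z ⟩
    A n (suc i) + - (c * (P n * I i * (x * z * y)))
      ≈⟨ +-congˡ (≋-trans (≋-sym (C-neg-* (sgnℕ i) _))
           (*-congˡ (*-cong (*-congˡ (≋-sym (I-suc i))) (≋-sym q-xzy)))) ⟩
    A n (suc i) + C (sgnℕ (suc i)) * (P n * (I (suc i) * (1# - q^ suc i)) * q^ (suc i ℕ.* n ℕ.+ triangular (suc i))) ∎
    where
    open ≋-Reasoning
    module N = ℕ-Solver
    c x y z : Series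
    c = C (sgnℕ i)
    x = q^ (i ℕ.* n ℕ.+ triangular i)
    y = q^ suc n
    z = q^ i
    q-xz : q^ (i ℕ.* suc n ℕ.+ triangular i) ≋ x * z
    q-xz = ≋-trans (q^-cong (N.solve 3 (λ i n t → i N.:* (N.con 1 N.:+ n) N.:+ t N.:= (i N.:* n N.:+ t) N.:+ i) refl i n (triangular i)))
      (q^-+ (i ℕ.* n ℕ.+ triangular i) i)
    q-xzy : q^ (suc i ℕ.* n ℕ.+ triangular (suc i)) ≋ x * z * y
    q-xzy = ≋-trans (q^-cong (N.solve 3 (λ i n t → (N.con 1 N.:+ i) N.:* n N.:+ (N.con 1 N.:+ i N.:+ t)
                N.:= ((i N.:* n N.:+ t) N.:+ i) N.:+ (N.con 1 N.:+ n)) refl i n (triangular i)))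
      (≋-trans (q^-+ (i ℕ.* n ℕ.+ triangular i ℕ.+ i) (suc n)) (*-cong (q^-+ (i ℕ.* n ℕ.+ triangular i) i) ≋-refl))

  -- The step from N to N+1 contributes two exponents: the summand s = N gives the one of a = N, and
  -- the boundary term the one of a = -N-1.
  diagonal : ∀ N → A N N ≋ ∑ (range N) (λ a → C (sgn a) * q^ pentagonal a)
  diagonal zero    = pointwise C0-at
  diagonal (suc N) = begin
    A (suc N) (suc N)
      ≈⟨ A-suc N (suc N) ⟩
    (A N N + term N N) + C (sgnℕ (suc N)) * (P N * (I (suc N) * (1# - q^ suc N)) * q^ pentagonal -[1+ N ])
      ≈⟨ +-cong (+-cong (diagonal N) (*-congˡ (unit (pentagonal (+ N)) ≋-refl))) (*-congˡ (unit (pentagonal -[1+ N ]) (I-suc N))) ⟩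
    (∑ (range N) f + f (+ N)) + f -[1+ N ]
      ≈⟨ solve 3 (λ a b c → (a :+ b) :+ c := b :+ (c :+ a)) ≋-refl (∑ (range N) f) (f (+ N)) (f -[1+ N ]) ⟩
    f (+ N) + (f -[1+ N ] + ∑ (range N) f)
      ≈⟨ +-congˡ (≋-sym (∑-∷ -[1+ N ] (range N) f)) ⟩
    f (+ N) + ∑ (-[1+ N ] ∷ range N) f
      ≈⟨ ≋-sym (∑-∷ (+ N) (-[1+ N ] ∷ range N) f) ⟩
    ∑ (range (suc N)) f ∎
    where
    open ≋-Reasoning
    f : ℤ → Series
    f a = C (sgn a) * q^ pentagonal a
    unit : ∀ {i} k → i ≋ I N → P N * i * q^ k ≋ q^ k
    unit k p = ≋-trans (*-cong (≋-trans (*-congˡ p) (PI N)) ≋-refl) (*-identityˡ _)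

  -- Modulo qᴺ only the summand s = 0 survives, since the others contain q^(sN).
  A-truncated : ∀ N i → A N (suc i) ≡[ N ] P N
  A-truncated N zero = ≋⇒≡[] (begin
    0# + C 1ℤ * (P N * I 0 * 1#) ≈⟨ solve 2 (λ p i → con 0ℤ :+ con 1ℤ :* (p :* i :* :1) := p :* (:1 :* i)) ≋-refl (P N) (I 0) ⟩
    P N * (1# * I 0) ≈⟨ *-congˡ (PI 0) ⟩
    P N * 1# ≈⟨ *-identityʳ (P N) ⟩
    P N ∎)
    where open ≋-Reasoning
  A-truncated N (suc i) = ≡[]-trans (≡[]-+ (A-truncated N i)
    (≡[]-trans (≋⇒≡[] (solve 3 (λ c p x → c :* (p :* x) := x :* (c :* p)) ≋-refl (C (sgnℕ (suc i))) (P N * I (suc i)) (q^ k)))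
      (q^-small k _ (ℕ.≤-trans (ℕ.m≤m+n N _) (ℕ.m≤m+n _ (triangular (suc i)))))))
    (≋⇒≡[] (+-identityʳ (P N)))
    where
    k = suc i ℕ.* N ℕ.+ triangular (suc i)

  pentagonal-theorem : ∀ N → E 1 ≡[ N ] ∑ (range N) (λ a → C (sgn a) * q^ pentagonal a)
  pentagonal-theorem zero    = truncated λ _ ()
  pentagonal-theorem (suc N) = ≡[]-trans
    (≡[]-trans (E-truncated 1 N) (≡[]-sym (eulerProduct-stable 1 N)))
    (≡[]-trans (≡[]-sym (A-truncated (suc N) N)) (≋⇒≡[] (diagonal (suc N))))

open Euler public using (pentagonal-theorem)

ψ : Series
ψ = E 2 ^ 2 * reciprocal (E 1)

ψ-E : E 2 ^ 2 ≋ E 1 * ψ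
ψ-E = begin
  E 2 ^ 2 ≈⟨ ≋-sym (*-identityˡ _) ⟩
  1# * E 2 ^ 2 ≈⟨ *-cong (≋-sym (reciprocal-* (E 1) refl)) ≋-refl ⟩
  E 1 * reciprocal (E 1) * E 2 ^ 2 ≈⟨ solve 3 (λ a b c → a :* b :* c := a :* (c :* b)) ≋-refl (E 1) (reciprocal (E 1)) (E 2 ^ 2) ⟩
  E 1 * ψ ∎
  where
  open ≋-Reasoning
  open Solver

-- a(2a+1)
ε : ℤ → ℕ
ε (+ n)    = n ℕ.* suc (2 ℕ.* n)
ε -[1+ n ] = suc n ℕ.* suc (2 ℕ.* n)

-- Telescoping after D. Shanks, Two theorems of Gauss,
-- Pacific J. Math. 8 (1958).
module Gauss where
  open Solver
  private module N = ℕ-Solver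

  -- `P n` is the product of (1 - q^(2k))/(1 - q^(2k-1)) over k ≤ n, the finite form of ψ, written
  -- through (q;q)₂ₙ and (q²;q²)ₙ. `I n` is its inverse, and `W n` lies halfway between `P n` and
  -- `P (suc n)`: the denominator of the next factor is already in place, its numerator still
  -- missing.
  X Y X⁻¹ Y⁻¹ P I W : ℕ → Series
  X n = eulerProduct 1 (2 ℕ.* n)
  Y n = eulerProduct 2 n
  X⁻¹ n = reciprocal (X n)
  Y⁻¹ n = reciprocal (Y n)
  P n = Y n ^ 2 * X⁻¹ n
  I n = X n * Y⁻¹ n ^ 2
  W n = P n * reciprocal (1# - q^ suc (2 ℕ.* n))

  eulerProduct-at-0 : ∀ m N → eulerProduct (suc m) N 0 ≡ 1ℤ
  eulerProduct-at-0 m zero    = refl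
  eulerProduct-at-0 m (suc N) = trans (at (eulerProduct-suc (suc m) N) 0)
    (*-at-0≡1 (eulerProduct (suc m) N) (1# - q^ suc _) (eulerProduct-at-0 m N) (1-q^-at-0 _))

  odd even : ℕ → Series
  odd n = 1# - q^ suc (2 ℕ.* n)
  even n = 1# - q^ suc (suc (2 ℕ.* n))

  X-suc : ∀ n → X (suc n) ≋ X n * odd n * even n
  X-suc n = begin
    eulerProduct 1 (2 ℕ.* suc n) ≈⟨ pointwise (λ k → cong (λ j → eulerProduct 1 j k) (ℕ.*-suc 2 n)) ⟩
    eulerProduct 1 (suc (suc (2 ℕ.* n))) ≈⟨ eulerProduct-suc 1 (suc (2 ℕ.* n)) ⟩
    _ ≈⟨ *-cong (eulerProduct-suc 1 (2 ℕ.* n)) ≋-refl ⟩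
    _ ≈⟨ *-cong (*-congˡ (factor (2 ℕ.* n))) (factor (suc (2 ℕ.* n))) ⟩
    X n * odd n * even n ∎
    where
    open ≋-Reasoning
    factor : ∀ k → 1# - q^ (1 ℕ.+ 1 ℕ.* k) ≋ 1# - q^ suc k
    factor k = +-congˡ (-‿cong (q^-cong (cong suc (ℕ.*-identityˡ k))))

  Y-suc : ∀ n → Y (suc n) ≋ Y n * even n
  Y-suc n = eulerProduct-suc 2 n

  X-unit : ∀ n → X n * X⁻¹ n ≋ 1#
  X-unit n = reciprocal-* (X n) (eulerProduct-at-0 0 (2 ℕ.* n))

  Y-unit : ∀ n → Y n * Y⁻¹ n ≋ 1#
  Y-unit n = reciprocal-* (Y n) (eulerProduct-at-0 1 n)

  XP : ∀ n → X n * P n ≋ Y n ^ 2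
  XP n = begin
    X n * (Y n ^ 2 * X⁻¹ n) ≈⟨ solve 3 (λ x x′ y → x :* (y :* x′) := x :* x′ :* y) ≋-refl (X n) (X⁻¹ n) (Y n ^ 2) ⟩
    X n * X⁻¹ n * Y n ^ 2 ≈⟨ *-cong (X-unit n) ≋-refl ⟩
    1# * Y n ^ 2 ≈⟨ *-identityˡ _ ⟩
    Y n ^ 2 ∎
    where open ≋-Reasoning

  PI : ∀ n → P n * I n ≋ 1#
  PI n = begin
    P n * I n ≈⟨ solve 4 (λ x x′ y y′ → (y :^ 2 :* x′) :* (x :* y′ :^ 2) := (x :* x′) :* (y :* y′) :^ 2) ≋-refl (X n) (X⁻¹ n) (Y n) (Y⁻¹ n) ⟩
    (X n * X⁻¹ n) * (Y n * Y⁻¹ n) ^ 2 ≈⟨ *-cong (X-unit n) (^-cong 2 (Y-unit n)) ⟩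
    1# * 1# ^ 2 ≈⟨ solve 1 (λ x → :1 :* :1 :^ 2 := :1) ≋-refl q ⟩
    1# ∎
    where open ≋-Reasoning

  P-suc : ∀ n → P (suc n) * odd n ≋ P n * even n
  P-suc n = unit-cancel (X (suc n)) (X⁻¹ (suc n)) (X-unit (suc n)) (begin
    X (suc n) * (P (suc n) * odd n) ≈⟨ solve 3 (λ x p o → x :* (p :* o) := (x :* p) :* o) ≋-refl (X (suc n)) (P (suc n)) (odd n) ⟩
    X (suc n) * P (suc n) * odd n ≈⟨ *-cong (≋-trans (XP (suc n)) (^-cong 2 (Y-suc n))) ≋-refl ⟩
    (Y n * even n) ^ 2 * odd n ≈⟨ solve 3 (λ y e o → (y :* e) :^ 2 :* o := y :^ 2 :* (e :^ 2 :* o)) ≋-refl (Y n) (even n) (odd n) ⟩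
    Y n ^ 2 * (even n ^ 2 * odd n) ≈⟨ *-cong (≋-sym (XP n)) ≋-refl ⟩
    X n * P n * (even n ^ 2 * odd n) ≈⟨ solve 4 (λ x p e o → x :* p :* (e :^ 2 :* o) := x :* o :* e :* (p :* e)) ≋-refl (X n) (P n) (even n) (odd n) ⟩
    X n * odd n * even n * (P n * even n) ≈⟨ *-cong (≋-sym (X-suc n)) ≋-refl ⟩
    X (suc n) * (P n * even n) ∎)
    where open ≋-Reasoning

  I-suc : ∀ n → I (suc n) * even n ≋ I n * odd n
  I-suc n = begin
    I (suc n) * even n ≈⟨ ≋-sym (*-identityˡ _) ⟩
    1# * (I (suc n) * even n) ≈⟨ *-cong (≋-sym (PI n)) ≋-refl ⟩
    P n * I n * (I (suc n) * even n) ≈⟨ solve 4 (λ p i i′ e → p :* i :* (i′ :* e) := p :* e :* (i :* i′)) ≋-refl (P n) (I n) (I (suc n)) (even n) ⟩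
    P n * even n * (I n * I (suc n)) ≈⟨ *-cong (≋-sym (P-suc n)) ≋-refl ⟩
    P (suc n) * odd n * (I n * I (suc n)) ≈⟨ solve 4 (λ p i i′ o → p :* o :* (i :* i′) := p :* i′ :* (i :* o)) ≋-refl (P (suc n)) (I n) (I (suc n)) (odd n) ⟩
    P (suc n) * I (suc n) * (I n * odd n) ≈⟨ *-cong (PI (suc n)) ≋-refl ⟩
    1# * (I n * odd n) ≈⟨ *-identityˡ _ ⟩
    I n * odd n ∎
    where open ≋-Reasoning

  odd-unit : ∀ n → odd n * reciprocal (odd n) ≋ 1#
  odd-unit n = reciprocal-* (odd n) (1-q^-at-0 (2 ℕ.* n))

  W-odd : ∀ n → W n * odd n ≋ P n
  W-odd n = begin
    P n * reciprocal (odd n) * odd n ≈⟨ solve 3 (λ p r o → p :* r :* o := p :* (o :* r)) ≋-refl (P n) (reciprocal (odd n)) (odd n) ⟩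
    P n * (odd n * reciprocal (odd n)) ≈⟨ *-congˡ (odd-unit n) ⟩
    P n * 1# ≈⟨ *-identityʳ _ ⟩
    P n ∎
    where open ≋-Reasoning

  W-even : ∀ n → W n * even n ≋ P (suc n)
  W-even n = unit-cancel (odd n) (reciprocal (odd n)) (odd-unit n) (begin
    odd n * (W n * even n) ≈⟨ solve 3 (λ w e o → o :* (w :* e) := w :* o :* e) ≋-refl (W n) (even n) (odd n) ⟩
    W n * odd n * even n ≈⟨ *-cong (W-odd n) ≋-refl ⟩
    P n * even n ≈⟨ ≋-sym (P-suc n) ⟩
    P (suc n) * odd n ≈⟨ *-comm _ _ ⟩
    odd n * P (suc n) ∎)
    where open ≋-Reasoning

  term : ℕ → ℕ → Series
  term n s = P n * I s * q^ (s ℕ.* suc (2 ℕ.* n))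

  A : ℕ → ℕ → Series
  A n zero    = 0#
  A n (suc i) = A n i + term n i

  -- `W n` is the common factor of `P n` and `P (suc n)`; once it is taken out, the change from n to
  -- n+1 telescopes to a boundary term. On the diagonal that term becomes the exponent of a = -N-1,
  -- and the summand s = N that of a = N.
  A-suc : ∀ n i → A (suc n) i ≋ A n i + W n * (I i * (1# - q^ (2 ℕ.* i))) * q^ (i ℕ.* suc (2 ℕ.* n))
  A-suc n zero = solve 3 (λ z w i → z := z :+ w :* (i :* (:1 :- :1)) :* :1) ≋-refl 0# (W n) (I 0)
  A-suc n (suc i) = begin
    A (suc n) i + P (suc n) * I i * q^ (i ℕ.* suc (2 ℕ.* suc n))
      ≈⟨ +-cong (A-suc n i) (*-cong (*-cong (≋-sym (W-even n)) ≋-refl) q-xz) ⟩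
    (A n i + W n * (I i * (1# - z)) * x) + W n * (1# - q^ suc (suc (2 ℕ.* n))) * I i * (x * z)
      ≈⟨ +-congˡ (*-cong (*-cong (*-congˡ (+-congˡ (-‿cong (q^-+ 1 (suc (2 ℕ.* n)))))) ≋-refl) ≋-refl) ⟩
    (A n i + W n * (I i * (1# - z)) * x) + W n * (1# - q * v) * I i * (x * z)
      ≈⟨ solve 7 (λ a w i x z v q → (a :+ w :* (i :* (:1 :- z)) :* x) :+ w :* (:1 :- q :* v) :* i :* (x :* z)
           := (a :+ w :* (:1 :- v) :* i :* x) :+ w :* (i :* (:1 :- q :* z)) :* (x :* v)) ≋-refl (A n i) (W n) (I i) x z v q ⟩
    (A n i + W n * (1# - v) * I i * x) + W n * (I i * (1# - q * z)) * (x * v)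
      ≈⟨ +-cong (+-congˡ (*-cong (*-cong (W-odd n) ≋-refl) ≋-refl))
           (*-cong (*-congˡ (≋-trans (*-congˡ (+-congˡ (-‿cong (≋-sym (q^-+ 1 (2 ℕ.* i)))))) (≋-sym (I-suc i)))) ≋-refl) ⟩
    A n (suc i) + W n * (I (suc i) * even i) * (x * v)
      ≈⟨ +-congˡ (*-cong (*-congˡ (*-congˡ (+-congˡ (-‿cong (q^-cong (sym (ℕ.*-suc 2 i))))))) (≋-sym q-xv)) ⟩
    A n (suc i) + W n * (I (suc i) * (1# - q^ (2 ℕ.* suc i))) * q^ (suc i ℕ.* suc (2 ℕ.* n)) ∎
    where
    open ≋-Reasoning
    x z v : Series
    x = q^ (i ℕ.* suc (2 ℕ.* n))
    z = q^ (2 ℕ.* i)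
    v = q^ suc (2 ℕ.* n)
    q-xz : q^ (i ℕ.* suc (2 ℕ.* suc n)) ≋ x * z
    q-xz = ≋-trans (q^-cong (N.solve 2 (λ i n → i N.:* (N.con 1 N.:+ N.con 2 N.:* (N.con 1 N.:+ n))
        N.:= i N.:* (N.con 1 N.:+ N.con 2 N.:* n) N.:+ N.con 2 N.:* i) refl i n))
      (q^-+ (i ℕ.* suc (2 ℕ.* n)) (2 ℕ.* i))
    q-xv : q^ (suc i ℕ.* suc (2 ℕ.* n)) ≋ x * v
    q-xv = ≋-trans (q^-+ (suc (2 ℕ.* n)) (i ℕ.* suc (2 ℕ.* n))) (*-comm _ _)

  diagonal : ∀ N → A N N ≋ ∑ (range N) (λ a → q^ ε a)
  diagonal zero    = pointwise C0-at
  diagonal (suc N) = begin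
    A (suc N) (suc N)
      ≈⟨ A-suc N (suc N) ⟩
    (A N N + P N * I N * q^ ε (+ N)) + W N * (I (suc N) * (1# - q^ (2 ℕ.* suc N))) * q^ ε -[1+ N ]
      ≈⟨ +-cong (+-cong (diagonal N) (*-cong (PI N) ≋-refl)) (*-cong unit ≋-refl) ⟩
    (∑ (range N) f + 1# * f (+ N)) + 1# * f -[1+ N ]
      ≈⟨ solve 3 (λ a b c → (a :+ :1 :* b) :+ :1 :* c := b :+ (c :+ a)) ≋-refl (∑ (range N) f) (f (+ N)) (f -[1+ N ]) ⟩
    f (+ N) + (f -[1+ N ] + ∑ (range N) f)
      ≈⟨ +-congˡ (≋-sym (∑-∷ -[1+ N ] (range N) f)) ⟩
    f (+ N) + ∑ (-[1+ N ] ∷ range N) f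
      ≈⟨ ≋-sym (∑-∷ (+ N) (-[1+ N ] ∷ range N) f) ⟩
    ∑ (range (suc N)) f ∎
    where
    open ≋-Reasoning
    f : ℤ → Series
    f a = q^ ε a
    unit : W N * (I (suc N) * (1# - q^ (2 ℕ.* suc N))) ≋ 1#
    unit = begin
      W N * (I (suc N) * (1# - q^ (2 ℕ.* suc N))) ≈⟨ *-congˡ (*-congˡ (+-congˡ (-‿cong (q^-cong (ℕ.*-suc 2 N))))) ⟩
      W N * (I (suc N) * even N) ≈⟨ *-congˡ (I-suc N) ⟩
      W N * (I N * odd N) ≈⟨ solve 3 (λ w i o → w :* (i :* o) := w :* o :* i) ≋-refl (W N) (I N) (odd N) ⟩
      W N * odd N * I N ≈⟨ *-cong (W-odd N) ≋-refl ⟩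
      P N * I N ≈⟨ PI N ⟩
      1# ∎

  A-truncated : ∀ N i → A N (suc i) ≡[ N ] P N
  A-truncated N zero = ≋⇒≡[] (begin
    0# + P N * I 0 * 1# ≈⟨ solve 2 (λ p i → con 0ℤ :+ p :* i :* :1 := p :* ((:1 :^ 2 :* :1) :* i)) ≋-refl (P N) (I 0) ⟩
    P N * ((1# ^ 2 * 1#) * I 0) ≈⟨ *-congˡ (*-cong (*-congˡ (≋-sym 1⁻¹)) ≋-refl) ⟩
    P N * (P 0 * I 0) ≈⟨ *-congˡ (PI 0) ⟩
    P N * 1# ≈⟨ *-identityʳ (P N) ⟩
    P N ∎)
    where
    open ≋-Reasoning
    1⁻¹ : X⁻¹ 0 ≋ 1#
    1⁻¹ = ≋-trans (≋-sym (*-identityˡ _)) (X-unit 0)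
  A-truncated N (suc i) = ≡[]-trans (≡[]-+ (A-truncated N i)
    (≡[]-trans (≋⇒≡[] (*-comm (P N * I (suc i)) (q^ k)))
      (q^-small k _ (ℕ.≤-trans (ℕ.m≤n⇒m≤1+n (ℕ.m≤m+n N (1 ℕ.* N))) (ℕ.m≤m+n _ (i ℕ.* suc (2 ℕ.* N)))))))
    (≋⇒≡[] (+-identityʳ (P N)))
    where
    k = suc i ℕ.* suc (2 ℕ.* N)

  ψ-truncated : ∀ N → ψ ≡[ N ] P N
  ψ-truncated N = ≡[]-trans (≡[]-trans
    (≡[]-* (≡[]-trans (≡[]-* E₂ (≡[]-* E₂ (≋⇒≡[] ≋-refl))) (≋⇒≡[] (≋-sym (XP N)))) (≋⇒≡[] ≋-refl))
    (≡[]-* (≡[]-* (≡[]-sym E₁) (≋⇒≡[] ≋-refl)) (≋⇒≡[] ≋-refl)))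
    (≋⇒≡[] (begin
      E 1 * P N * reciprocal (E 1) ≈⟨ solve 3 (λ e p r → e :* p :* r := (e :* r) :* p) ≋-refl (E 1) (P N) (reciprocal (E 1)) ⟩
      E 1 * reciprocal (E 1) * P N ≈⟨ *-cong (reciprocal-* (E 1) refl) ≋-refl ⟩
      1# * P N ≈⟨ *-identityˡ _ ⟩
      P N ∎))
    where
    open ≋-Reasoning
    E₁ : E 1 ≡[ N ] X N
    E₁ = ≡[]-weaken (ℕ.m≤n⇒m≤1+n (ℕ.m≤m+n N (1 ℕ.* N))) (E-truncated 1 (2 ℕ.* N))
    E₂ : E 2 ≡[ N ] Y N
    E₂ = ≡[]-weaken (ℕ.n≤1+n N) (E-truncated 2 N)

  triangular-theorem : ∀ N → ψ ≡[ N ] ∑ (range N) (λ a → q^ ε a)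
  triangular-theorem zero    = truncated λ _ ()
  triangular-theorem (suc N) = ≡[]-trans (ψ-truncated (suc N))
    (≡[]-trans (≡[]-sym (A-truncated (suc N) N)) (≋⇒≡[] (diagonal (suc N))))

open Gauss public using (triangular-theorem)

-- Finite sums and their reindexing

module _ {I : Set} where

  ∑ℤ-cong : ∀ (xs : List I) {f g : I → ℤ} → (∀ x → f x ≡ g x) → ∑ℤ xs f ≡ ∑ℤ xs g
  ∑ℤ-cong []       p = refl
  ∑ℤ-cong (x ∷ xs) p = cong₂ ℤ._+_ (p x) (∑ℤ-cong xs p)

  ∑ℤ-zero : ∀ (xs : List I) {f : I → ℤ} → (∀ x → f x ≡ 0ℤ) → ∑ℤ xs f ≡ 0ℤ
  ∑ℤ-zero []       p = refl
  ∑ℤ-zero (x ∷ xs) p = cong₂ ℤ._+_ (p x) (∑ℤ-zero xs p)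

  ∑ℤ-+ : ∀ (xs : List I) (f g : I → ℤ) → ∑ℤ xs (λ x → f x ℤ.+ g x) ≡ ∑ℤ xs f ℤ.+ ∑ℤ xs g
  ∑ℤ-+ []       f g = refl
  ∑ℤ-+ (x ∷ xs) f g = trans (cong (λ z → f x ℤ.+ g x ℤ.+ z) (∑ℤ-+ xs f g))
    (solve 4 (λ a b c d → (a :+ b) :+ (c :+ d) := (a :+ c) :+ (b :+ d)) refl (f x) (g x) (∑ℤ xs f) (∑ℤ xs g))
    where open ℤ-Solver

  ∑ℤ-++ : ∀ (xs ys : List I) (f : I → ℤ) → ∑ℤ (xs ++ ys) f ≡ ∑ℤ xs f ℤ.+ ∑ℤ ys f
  ∑ℤ-++ []       ys f = sym (ℤ.+-identityˡ _)
  ∑ℤ-++ (x ∷ xs) ys f = trans (cong (λ z → f x ℤ.+ z) (∑ℤ-++ xs ys f)) (sym (ℤ.+-assoc (f x) (∑ℤ xs f) (∑ℤ ys f)))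

  ∑ℤ-filter : ∀ (xs : List I) (f : I → ℤ) → ∑ℤ (filter (λ x → ¬? (f x ℤ.≟ 0ℤ)) xs) f ≡ ∑ℤ xs f
  ∑ℤ-filter []       f = refl
  ∑ℤ-filter (x ∷ xs) f with f x ℤ.≟ 0ℤ
  ... | yes p = trans (∑ℤ-filter xs f) (sym (trans (cong (ℤ._+ ∑ℤ xs f) p) (ℤ.+-identityˡ _)))
  ... | no _  = cong (λ z → f x ℤ.+ z) (∑ℤ-filter xs f)

  ∑ℤ-↭ : ∀ {xs ys : List I} (f : I → ℤ) → xs ↭ ys → ∑ℤ xs f ≡ ∑ℤ ys f
  ∑ℤ-↭ f Perm.refl = refl
  ∑ℤ-↭ f (Perm.prep x p) = cong (λ z → f x ℤ.+ z) (∑ℤ-↭ f p)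
  ∑ℤ-↭ f (Perm.swap {xs} {ys} x y p) = trans (cong (λ z → f x ℤ.+ (f y ℤ.+ z)) (∑ℤ-↭ f p))
    (solve 3 (λ a b c → a :+ (b :+ c) := b :+ (a :+ c)) refl (f x) (f y) (∑ℤ ys f))
    where open ℤ-Solver
  ∑ℤ-↭ f (Perm.trans p r) = trans (∑ℤ-↭ f p) (∑ℤ-↭ f r)

∑ℤ-map : ∀ {I J : Set} (φ : I → J) xs (f : J → ℤ) → ∑ℤ (map φ xs) f ≡ ∑ℤ xs (f ∘ φ)
∑ℤ-map φ []       f = refl
∑ℤ-map φ (x ∷ xs) f = cong (λ z → f (φ x) ℤ.+ z) (∑ℤ-map φ xs f)

-- Only the supports have to correspond, so both sums may run over generous boxes instead of exact
-- fibres. After filtering, two duplicate-free lists with the same members are permutations of each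
-- other.
∑ℤ-reindex : ∀ {I J : Set} {xs : List I} {ys : List J} (φ : I → J) (f : J → ℤ) →
  Unique xs → Unique ys → (∀ {x x′} → φ x ≡ φ x′ → x ≡ x′) →
  (∀ {x} → f (φ x) ≢ 0ℤ → φ x ∈ ys) →
  (∀ {y} → f y ≢ 0ℤ → ∃[ x ] (x ∈ xs × φ x ≡ y)) →
  ∑ℤ xs (f ∘ φ) ≡ ∑ℤ ys f
∑ℤ-reindex {xs = xs} {ys} φ f uxs uys inj into onto = begin
  ∑ℤ xs (f ∘ φ) ≡⟨ sym (∑ℤ-filter xs (f ∘ φ)) ⟩
  ∑ℤ (filter support∘φ xs) (f ∘ φ) ≡⟨ sym (∑ℤ-map φ (filter support∘φ xs) f) ⟩
  ∑ℤ (map φ (filter support∘φ xs)) f ≡⟨ ∑ℤ-↭ f perm ⟩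
  ∑ℤ (filter support ys) f ≡⟨ ∑ℤ-filter ys f ⟩
  ∑ℤ ys f ∎
  where
  open ≡-Reasoning
  support = λ y → ¬? (f y ℤ.≟ 0ℤ)
  support∘φ = λ x → ¬? (f (φ x) ℤ.≟ 0ℤ)
  perm : map φ (filter support∘φ xs) ↭ filter support ys
  perm = ∼bag⇒↭ (unique∧set⇒bag (map⁺ inj (filter⁺ support∘φ uxs)) (filter⁺ support uys)
    (mk⇔ to from))
    where
    to : ∀ {y} → y ∈ map φ (filter support∘φ xs) → y ∈ filter support ys
    to y∈ with x , x∈ , refl ← ∈-map⁻ φ y∈ with _ , nz ← ∈-filter⁻ support∘φ {xs = xs} x∈ = ∈-filter⁺ support (into nz) nz
    from : ∀ {y} → y ∈ filter support ys → y ∈ map φ (filter support∘φ xs)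
    from y∈ with _ , nz ← ∈-filter⁻ support {xs = ys} y∈ with x , x∈ , refl ← onto nz = ∈-map⁺ φ (∈-filter⁺ support∘φ x∈ nz)

module _ {I : Set} where

  ∑-[] : ∀ (f : I → Series) → ∑ [] f ≋ 0#
  ∑-[] f = pointwise λ n → sym (C0-at n)

  ∑-++ : ∀ (xs ys : List I) f → ∑ (xs ++ ys) f ≋ ∑ xs f + ∑ ys f
  ∑-++ xs ys f = pointwise λ n → trans (∑ℤ-++ xs ys (λ x → f x n)) (sym (+-at (∑ xs f) (∑ ys f) n))

  ∑-cong : ∀ (xs : List I) {f g} → (∀ x → f x ≋ g x) → ∑ xs f ≋ ∑ xs g
  ∑-cong xs p = pointwise λ n → ∑ℤ-cong xs (λ x → at (p x) n)

  ∑-*ˡ : ∀ (xs : List I) g f → ∑ xs (λ x → g * f x) ≋ g * ∑ xs f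
  ∑-*ˡ [] g f = ≋-trans (∑-[] (λ x → g * f x)) (≋-trans (≋-sym (zeroʳ g)) (*-congˡ (≋-sym (∑-[] f))))
  ∑-*ˡ (x ∷ xs) g f = begin
    ∑ (x ∷ xs) (λ x → g * f x) ≈⟨ ∑-∷ x xs _ ⟩
    g * f x + ∑ xs (λ x → g * f x) ≈⟨ +-congˡ (∑-*ˡ xs g f) ⟩
    g * f x + g * ∑ xs f ≈⟨ ≋-sym (distribˡ g (f x) (∑ xs f)) ⟩
    g * (f x + ∑ xs f) ≈⟨ *-congˡ (≋-sym (∑-∷ x xs f)) ⟩
    g * ∑ (x ∷ xs) f ∎
    where open ≋-Reasoning

  ∑-S : ∀ m .{{_ : NonZero m}} (xs : List I) f → S m (∑ xs f) ≋ ∑ xs (λ x → S m (f x))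
  ∑-S m []       f = ≋-trans (S-cong m (∑-[] f)) (≋-trans (S-C m 0ℤ) (≋-sym (∑-[] (λ x → S m (f x)))))
  ∑-S m (x ∷ xs) f = ≋-trans (S-cong m (∑-∷ x xs f)) (≋-trans (S-+ m (f x) (∑ xs f))
    (≋-trans (+-congˡ (∑-S m xs f)) (≋-sym (∑-∷ x xs _))))

∑-product : ∀ {I J : Set} (xs : List I) (ys : List J) f g →
  ∑ xs f * ∑ ys g ≋ ∑ (cartesianProduct xs ys) (λ p → f (proj₁ p) * g (proj₂ p))
∑-product []       ys f g = ≋-trans (*-cong (∑-[] f) ≋-refl) (≋-trans (zeroˡ _) (≋-sym (∑-[] (λ p → f (proj₁ p) * g (proj₂ p)))))
∑-product (x ∷ xs) ys f g = begin
  ∑ (x ∷ xs) f * ∑ ys g ≈⟨ *-cong (∑-∷ x xs f) ≋-refl ⟩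
  (f x + ∑ xs f) * ∑ ys g ≈⟨ *-distribʳ (∑ ys g) (f x) (∑ xs f) ⟩
  f x * ∑ ys g + ∑ xs f * ∑ ys g ≈⟨ +-cong (≋-sym (∑-*ˡ ys (f x) g)) (∑-product xs ys f g) ⟩
  ∑ ys (λ y → f x * g y) + _ ≈⟨ +-cong (pointwise (λ n → sym (∑ℤ-map (x ,_) ys (λ p → (f (proj₁ p) * g (proj₂ p)) n)))) ≋-refl ⟩
  _ ≈⟨ ≋-sym (∑-++ (map (x ,_) ys) (cartesianProduct xs ys) (λ p → f (proj₁ p) * g (proj₂ p))) ⟩
  ∑ (map (x ,_) ys ++ cartesianProduct xs ys) (λ p → f (proj₁ p) * g (proj₂ p)) ∎
  where open ≋-Reasoning

-- The absolute value, lowered by one on the negative integers, so that `range N` consists exactly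
-- of the integers of size below N.
size : ℤ → ℕ
size (+ n)    = n
size -[1+ n ] = n

∈-range : ∀ {N} a → size a ℕ.< N → a ∈ range N
∈-range {suc N} a (ℕ.s≤s a≤N) with ℕ.m≤n⇒m<n∨m≡n a≤N
∈-range {suc N} a        _ | inj₁ a<N  = there (there (∈-range a a<N))
∈-range {suc N} (+ n)    _ | inj₂ refl = here refl
∈-range {suc N} -[1+ n ] _ | inj₂ refl = there (here refl)

range-unique : ∀ N → Unique (range N)
range-unique zero    = []
range-unique (suc N) = ((λ ()) ∷ fresh (+ N) ℕ.≤-refl) ∷ (fresh -[1+ N ] ℕ.≤-refl) ∷ range-unique N
  where
  fresh : ∀ a {M} → M ℕ.≤ size a → All (a ≢_) (range M)
  fresh a {zero}  _   = []
  fresh a {suc M} M<a = (λ { refl → ℕ.1+n≰n M<a }) ∷ (λ { refl → ℕ.1+n≰n M<a }) ∷ fresh a (ℕ.≤-trans (ℕ.n≤1+n M) M<a)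

q^-at-≢ : ∀ {k n} → k ≢ n → (q^ k) n ≡ 0ℤ
q^-at-≢ {k} {n} k≢n = cong (λ b → if b then 1ℤ else 0ℤ) (dec-false (k ℕ.≟ n) k≢n)

q^-at-≢0 : ∀ {k n} → (q^ k) n ≢ 0ℤ → k ≡ n
q^-at-≢0 {k} {n} nz with k ℕ.≟ n
... | yes k≡n = k≡n
... | no  k≢n = ⊥-elim (nz (q^-at-≢ k≢n))

q^-at-⇔ : ∀ {k n k′ n′} → (k ≡ n → k′ ≡ n′) → (k′ ≡ n′ → k ≡ n) → (q^ k) n ≡ (q^ k′) n′
q^-at-⇔ {k} {n} {k′} {n′} to from with k ℕ.≟ n
... | no  k≢n = trans (q^-at-≢ k≢n) (sym (q^-at-≢ (λ e → k≢n (from e))))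
... | yes k≡n = cong (λ b → if b then 1ℤ else 0ℤ) (trans (dec-true (k ℕ.≟ n) k≡n) (sym (dec-true (k′ ℕ.≟ n′) (to k≡n))))

triangular-closed : ∀ n → 2 ℕ.* triangular n ≡ n ℕ.* suc n
triangular-closed zero    = refl
triangular-closed (suc n) = begin
  2 ℕ.* (suc n ℕ.+ triangular n) ≡⟨ ℕ.*-distribˡ-+ 2 (suc n) (triangular n) ⟩
  2 ℕ.* suc n ℕ.+ 2 ℕ.* triangular n ≡⟨ cong (2 ℕ.* suc n ℕ.+_) (triangular-closed n) ⟩
  2 ℕ.* suc n ℕ.+ n ℕ.* suc n ≡⟨ solve 1 (λ n → con 2 :* (con 1 :+ n) :+ n :* (con 1 :+ n) := (con 1 :+ n) :* (con 1 :+ (con 1 :+ n))) refl n ⟩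
  suc n ℕ.* suc (suc n) ∎
  where
  open ≡-Reasoning
  open ℕ-Solver

pentagonal-closed : ∀ a → + 2 ℤ.* + pentagonal a ≡ a ℤ.* (+ 3 ℤ.* a ℤ.+ 1ℤ)
pentagonal-closed (+ n) = begin
  + 2 ℤ.* + (n ℕ.* n ℕ.+ triangular n) ≡⟨ sym (ℤ.pos-* 2 (n ℕ.* n ℕ.+ triangular n)) ⟩
  + (2 ℕ.* (n ℕ.* n ℕ.+ triangular n)) ≡⟨ cong +_ (trans (ℕ.*-distribˡ-+ 2 (n ℕ.* n) _) (trans (cong (2 ℕ.* (n ℕ.* n) ℕ.+_) (triangular-closed n))
                                                      (N.solve 1 (λ n → N.con 2 N.:* (n N.:* n) N.:+ n N.:* (N.con 1 N.:+ n) N.:= n N.:* (N.con 3 N.:* n N.:+ N.con 1)) refl n))) ⟩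
  + (n ℕ.* (3 ℕ.* n ℕ.+ 1)) ≡⟨ ℤ.pos-* n _ ⟩
  + n ℤ.* + (3 ℕ.* n ℕ.+ 1) ≡⟨ cong (+ n ℤ.*_) (trans (ℤ.pos-+ (3 ℕ.* n) 1) (cong (ℤ._+ 1ℤ) (ℤ.pos-* 3 n))) ⟩
  + n ℤ.* (+ 3 ℤ.* + n ℤ.+ 1ℤ) ∎
  where
  open ≡-Reasoning
  module N = ℕ-Solver
pentagonal-closed -[1+ n ] = begin
  + 2 ℤ.* + (suc n ℕ.* n ℕ.+ triangular (suc n)) ≡⟨ sym (ℤ.pos-* 2 (suc n ℕ.* n ℕ.+ triangular (suc n))) ⟩
  + (2 ℕ.* (suc n ℕ.* n ℕ.+ triangular (suc n))) ≡⟨ cong +_ (trans (ℕ.*-distribˡ-+ 2 (suc n ℕ.* n) _) (trans (cong (2 ℕ.* (suc n ℕ.* n) ℕ.+_) (triangular-closed (suc n)))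
                                                      (N.solve 1 (λ n → N.con 2 N.:* ((N.con 1 N.:+ n) N.:* n) N.:+ (N.con 1 N.:+ n) N.:* (N.con 2 N.:+ n) N.:= (N.con 1 N.:+ n) N.:* (N.con 3 N.:* n N.:+ N.con 2)) refl n))) ⟩
  + (suc n ℕ.* (3 ℕ.* n ℕ.+ 2)) ≡⟨ ℤ.pos-* (suc n) _ ⟩
  + suc n ℤ.* + (3 ℕ.* n ℕ.+ 2) ≡⟨ cong (+ suc n ℤ.*_) (trans (ℤ.pos-+ (3 ℕ.* n) 2) (cong (ℤ._+ + 2) (ℤ.pos-* 3 n))) ⟩
  + suc n ℤ.* (+ 3 ℤ.* + n ℤ.+ + 2) ≡⟨ Z.solve 1 (λ x → (Z.con 1ℤ Z.:+ x) Z.:* (Z.con (+ 3) Z.:* x Z.:+ Z.con (+ 2))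
                                                      Z.:= (Z.:- (Z.con 1ℤ Z.:+ x)) Z.:* (Z.con (+ 3) Z.:* (Z.:- (Z.con 1ℤ Z.:+ x)) Z.:+ Z.con 1ℤ)) refl (+ n) ⟩
  -[1+ n ] ℤ.* (+ 3 ℤ.* -[1+ n ] ℤ.+ 1ℤ) ∎
  where
  open ≡-Reasoning
  module N = ℕ-Solver
  module Z = ℤ-Solver

ε-closed : ∀ a → + ε a ≡ a ℤ.* (+ 2 ℤ.* a ℤ.+ 1ℤ)
ε-closed (+ n) = trans (ℤ.pos-* n _) (cong (+ n ℤ.*_) (trans (ℤ.pos-+ 1 (2 ℕ.* n)) (trans (ℤ.+-comm 1ℤ (+ (2 ℕ.* n))) (cong (ℤ._+ 1ℤ) (ℤ.pos-* 2 n)))))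
ε-closed -[1+ n ] = begin
  + (suc n ℕ.* suc (2 ℕ.* n)) ≡⟨ ℤ.pos-* (suc n) _ ⟩
  + suc n ℤ.* (1ℤ ℤ.+ + (2 ℕ.* n)) ≡⟨ cong (λ z → + suc n ℤ.* (1ℤ ℤ.+ z)) (ℤ.pos-* 2 n) ⟩
  + suc n ℤ.* (1ℤ ℤ.+ + 2 ℤ.* + n) ≡⟨ solve 1 (λ x → (con 1ℤ :+ x) :* (con 1ℤ :+ con (+ 2) :* x)
                                                  := (:- (con 1ℤ :+ x)) :* (con (+ 2) :* (:- (con 1ℤ :+ x)) :+ con 1ℤ)) refl (+ n) ⟩
  -[1+ n ] ℤ.* (+ 2 ℤ.* -[1+ n ] ℤ.+ 1ℤ) ∎
  where
  open ≡-Reasoning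
  open ℤ-Solver

size≤pentagonal : ∀ a → size a ℕ.≤ pentagonal a
size≤pentagonal (+ zero)  = ℕ.z≤n
size≤pentagonal (+ suc n) = ℕ.≤-trans (ℕ.m≤m+n (suc n) _) (ℕ.m≤m+n _ (triangular (suc n)))
size≤pentagonal -[1+ n ]  = ℕ.≤-trans (ℕ.m≤m+n n _) (ℕ.m≤m+n _ (triangular (suc n)))

size≤ε : ∀ a → size a ℕ.≤ ε a
size≤ε (+ n)    = ℕ.m≤m*n n (suc (2 ℕ.* n))
size≤ε -[1+ n ] = ℕ.≤-trans (ℕ.n≤1+n n) (ℕ.m≤m*n (suc n) (suc (2 ℕ.* n)))

residue : ∀ a → Σ[ i ∈ Fin 5 ] ∃[ b ] a ≡ + toℕ i ℤ.+ + 5 ℤ.* b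
residue a = fromℕ< (n%ℕd<d a 5) , a /ℕ 5 , trans (a≡a%ℕn+[a/ℕn]*n a 5)
  (cong₂ ℤ._+_ (cong +_ (sym (Fin.toℕ-fromℕ< (n%ℕd<d a 5)))) (ℤ.*-comm (a /ℕ 5) (+ 5)))

pos-r+5k : ∀ r k → + (r ℕ.+ 5 ℕ.* k) ≡ + r ℤ.+ + 5 ℤ.* + k
pos-r+5k r k = trans (ℤ.pos-+ r (5 ℕ.* k)) (cong (λ z → + r ℤ.+ z) (ℤ.pos-* 5 k))

-- Doubled to clear the denominator of a(3a+1)/2, which is harmless as 2 is a unit modulo 5.
pentagonal-class : ℕ → Fin 5 → ℤ
pentagonal-class r i = + 2 ℤ.* + r ℤ.- + toℕ i ℤ.* (+ 3 ℤ.* + toℕ i ℤ.+ 1ℤ)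

ε-class : ℕ → Fin 5 → ℤ
ε-class r i = + r ℤ.- + toℕ i ℤ.* (+ 2 ℤ.* + toℕ i ℤ.+ 1ℤ)

pentagonal-residue : ∀ {a} r k (i : Fin 5) b → a ≡ + toℕ i ℤ.+ + 5 ℤ.* b → pentagonal a ≡ r ℕ.+ 5 ℕ.* k →
  + 5 ∣ₛ pentagonal-class r i
pentagonal-residue {a} r k i b refl p = divides z (begin
  + 2 ℤ.* + r ℤ.- x ℤ.* (+ 3 ℤ.* x ℤ.+ 1ℤ)
    ≡⟨ solve 4 (λ r k x b → con (+ 2) :* r :- x :* (con (+ 3) :* x :+ con 1ℤ)
         := con (+ 2) :* (r :+ con (+ 5) :* k) :- (x :+ con (+ 5) :* b) :* (con (+ 3) :* (x :+ con (+ 5) :* b) :+ con 1ℤ)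
            :+ (con (+ 6) :* x :* b :+ b :+ con (+ 15) :* b :* b :- con (+ 2) :* k) :* con (+ 5)) refl (+ r) (+ k) x b ⟩
  + 2 ℤ.* (+ r ℤ.+ + 5 ℤ.* + k) ℤ.- a ℤ.* (+ 3 ℤ.* a ℤ.+ 1ℤ) ℤ.+ z ℤ.* + 5
    ≡⟨ cong (λ w → w ℤ.- a ℤ.* (+ 3 ℤ.* a ℤ.+ 1ℤ) ℤ.+ z ℤ.* + 5) (trans (cong (+ 2 ℤ.*_) (sym (pos-r+5k r k)))
         (trans (cong (λ w → + 2 ℤ.* + w) (sym p)) (pentagonal-closed a))) ⟩
  a ℤ.* (+ 3 ℤ.* a ℤ.+ 1ℤ) ℤ.- a ℤ.* (+ 3 ℤ.* a ℤ.+ 1ℤ) ℤ.+ z ℤ.* + 5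
    ≡⟨ solve 2 (λ a z → a :- a :+ z := z) refl (a ℤ.* (+ 3 ℤ.* a ℤ.+ 1ℤ)) (z ℤ.* + 5) ⟩
  z ℤ.* + 5 ∎)
  where
  open ≡-Reasoning
  open ℤ-Solver
  x = + toℕ i
  z = + 6 ℤ.* x ℤ.* b ℤ.+ b ℤ.+ + 15 ℤ.* b ℤ.* b ℤ.- + 2 ℤ.* + k

ε-mod : ∀ (i b : ℤ) → + ε (i ℤ.+ + 5 ℤ.* b) ≡
  i ℤ.* (+ 2 ℤ.* i ℤ.+ 1ℤ) ℤ.+ (+ 4 ℤ.* i ℤ.* b ℤ.+ b ℤ.+ + 10 ℤ.* b ℤ.* b) ℤ.* + 5
ε-mod i b = trans (ε-closed (i ℤ.+ + 5 ℤ.* b))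
  (solve 2 (λ i b → (i :+ con (+ 5) :* b) :* (con (+ 2) :* (i :+ con (+ 5) :* b) :+ con 1ℤ)
    := i :* (con (+ 2) :* i :+ con 1ℤ) :+ (con (+ 4) :* i :* b :+ b :+ con (+ 10) :* b :* b) :* con (+ 5)) refl i b)
  where open ℤ-Solver

-- Dissections of the theta series

-- An abstract theta series, the sum of w(a) q^(e(a)) over all integers a, given by its truncations.
-- The bound `size≤e` puts every a with exponent at most n into `range (suc n)`.
module Theta (w : ℤ → ℤ) (e : ℤ → ℕ) (f : Series) (size≤e : ∀ a → size a ℕ.≤ e a)
  (expansion : ∀ N → f ≡[ N ] ∑ (range N) (λ a → C (w a) * q^ e a)) where

  coefficient : ∀ N n → n ℕ.< N → f n ≡ ∑ℤ (range N) (λ a → w a ℤ.* (q^ e a) n)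
  coefficient N n n<N = trans (below (expansion N) n n<N)
    (∑ℤ-cong (range N) (λ a → C-*-at (w a) (q^ e a) n))

  V-vanishes : ∀ r → (∀ a k → e a ≢ r ℕ.+ 5 ℕ.* k) → V r f ≋ 0#
  V-vanishes r e≢ = pointwise λ k → trans (coefficient (suc (r ℕ.+ 5 ℕ.* k)) _ ℕ.≤-refl)
    (trans (∑ℤ-zero (range _) (λ a → trans (cong (w a ℤ.*_) (q^-at-≢ (e≢ a k))) (ℤ.*-zeroʳ (w a)))) (sym (C0-at k)))

  -- The exponents in the class of r are r + 25e(b), a copy of the whole series at 25 times the
  -- scale. Removing qʳ and passing from q⁵ to q leaves scale 5.
  V-self-similar : ∀ r c (φ : ℤ → ℤ) → (∀ {b b′} → φ b ≡ φ b′ → b ≡ b′) →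
    (∀ b → w (φ b) ≡ c ℤ.* w b) → (∀ b → e (φ b) ≡ r ℕ.+ 5 ℕ.* (5 ℕ.* e b)) →
    (∀ a k → e a ≡ r ℕ.+ 5 ℕ.* k → ∃[ b ] φ b ≡ a) → V r f ≋ C c * S 5 f
  V-self-similar r c φ inj wφ eφ onto = pointwise λ k → let n = r ℕ.+ 5 ℕ.* k ; N = suc n in begin
    f n
      ≡⟨ coefficient N n ℕ.≤-refl ⟩
    ∑ℤ (range N) (λ a → w a ℤ.* (q^ e a) n)
      ≡⟨ sym (∑ℤ-reindex φ (λ a → w a ℤ.* (q^ e a) n) (range-unique N) (range-unique N) inj (into k) (surj k)) ⟩
    ∑ℤ (range N) (λ b → w (φ b) ℤ.* (q^ e (φ b)) n)
      ≡⟨ ∑ℤ-cong (range N) (term k) ⟩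
    ∑ℤ (range N) (λ b → (C c * (C (w b) * q^ (5 ℕ.* e b))) k)
      ≡⟨ at (∑-*ˡ (range N) (C c) (λ b → C (w b) * q^ (5 ℕ.* e b))) k ⟩
    (C c * ∑ (range N) (λ b → C (w b) * q^ (5 ℕ.* e b))) k
      ≡⟨ below (≡[]-* (≋⇒≡[] (≋-refl {C c})) (≡[]-sym (scaled N))) k (ℕ.s≤s (ℕ.≤-trans (ℕ.m≤n*m k 5) (ℕ.m≤n+m (5 ℕ.* k) r))) ⟩
    (C c * S 5 f) k ∎
    where
    open ≡-Reasoning
    scaled : ∀ N → S 5 f ≡[ N ] ∑ (range N) (λ b → C (w b) * q^ (5 ℕ.* e b))
    scaled N = ≡[]-trans (S-truncated 5 (expansion N)) (≋⇒≡[] (≋-trans (∑-S 5 (range N) _)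
      (∑-cong (range N) (λ b → ≋-trans (S-* 5 (C (w b)) (q^ e b)) (*-cong (S-C 5 (w b)) (S-q^ 5 (e b)))))))
    support : ∀ {n} a → w a ℤ.* (q^ e a) n ≢ 0ℤ → e a ≡ n
    support a nz = q^-at-≢0 (λ z → nz (trans (cong (w a ℤ.*_) z) (ℤ.*-zeroʳ (w a))))
    into : ∀ k {b} → w (φ b) ℤ.* (q^ e (φ b)) (r ℕ.+ 5 ℕ.* k) ≢ 0ℤ → φ b ∈ range (suc (r ℕ.+ 5 ℕ.* k))
    into k {b} nz = ∈-range (φ b) (ℕ.s≤s (ℕ.≤-trans (size≤e (φ b)) (ℕ.≤-reflexive (support (φ b) nz))))
    surj : ∀ k {a} → w a ℤ.* (q^ e a) (r ℕ.+ 5 ℕ.* k) ≢ 0ℤ → ∃[ b ] (b ∈ range (suc (r ℕ.+ 5 ℕ.* k)) × φ b ≡ a)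
    surj k {a} nz with b , refl ← onto a k (support a nz) = b , ∈-range b (ℕ.s≤s (ℕ.≤-trans (size≤e b)
      (ℕ.≤-trans (ℕ.≤-trans (ℕ.m≤n*m (e b) 25) (ℕ.≤-reflexive (ℕ.*-assoc 5 5 (e b)))) (ℕ.≤-trans (ℕ.m≤n+m _ r)
        (ℕ.≤-reflexive (trans (sym (eφ b)) (support (φ b) nz))))))) , refl
    term : ∀ k b → w (φ b) ℤ.* (q^ e (φ b)) (r ℕ.+ 5 ℕ.* k) ≡ (C c * (C (w b) * q^ (5 ℕ.* e b))) k
    term k b = begin
      w (φ b) ℤ.* (q^ e (φ b)) (r ℕ.+ 5 ℕ.* k)
        ≡⟨ cong₂ ℤ._*_ (wφ b) (q^-at-⇔ {e (φ b)} {r ℕ.+ 5 ℕ.* k} {5 ℕ.* e b} {k}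
             (λ p → ℕ.*-cancelˡ-≡ _ _ 5 (ℕ.+-cancelˡ-≡ r _ _ (trans (sym (eφ b)) p)))
             (λ p → trans (eφ b) (cong (λ z → r ℕ.+ 5 ℕ.* z) p))) ⟩
      c ℤ.* w b ℤ.* (q^ (5 ℕ.* e b)) k ≡⟨ ℤ.*-assoc c (w b) _ ⟩
      c ℤ.* (w b ℤ.* (q^ (5 ℕ.* e b)) k) ≡⟨ cong (c ℤ.*_) (sym (C-*-at (w b) (q^ (5 ℕ.* e b)) k)) ⟩
      c ℤ.* (C (w b) * q^ (5 ℕ.* e b)) k ≡⟨ sym (C-*-at c (C (w b) * q^ (5 ℕ.* e b)) k) ⟩
      (C c * (C (w b) * q^ (5 ℕ.* e b))) k ∎

sgn-suc : ∀ a → sgn (1ℤ ℤ.+ a) ≡ ℤ.- sgn a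
sgn-suc (+ n)          = refl
sgn-suc -[1+ zero ]    = refl
sgn-suc -[1+ suc n ]   = sym (ℤ.neg-involutive (sgnℕ (suc n)))

sgn-even : ∀ a z → sgn (a ℤ.+ + 2 ℤ.* z) ≡ sgn a
sgn-even a (+ n) = steps a n
  where
  steps : ∀ a n → sgn (a ℤ.+ + 2 ℤ.* + n) ≡ sgn a
  steps a zero    = cong sgn (ℤ.+-identityʳ a)
  steps a (suc n) = begin
    sgn (a ℤ.+ + 2 ℤ.* (1ℤ ℤ.+ + n)) ≡⟨ cong sgn (solve 2 (λ a n → a :+ con (+ 2) :* (con 1ℤ :+ n) := con 1ℤ :+ (con 1ℤ :+ (a :+ con (+ 2) :* n))) refl a (+ n)) ⟩
    sgn (1ℤ ℤ.+ (1ℤ ℤ.+ (a ℤ.+ + 2 ℤ.* + n))) ≡⟨ trans (sgn-suc (1ℤ ℤ.+ (a ℤ.+ + 2 ℤ.* + n))) (cong ℤ.-_ (sgn-suc (a ℤ.+ + 2 ℤ.* + n))) ⟩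
    ℤ.- ℤ.- sgn (a ℤ.+ + 2 ℤ.* + n) ≡⟨ ℤ.neg-involutive (sgn (a ℤ.+ + 2 ℤ.* + n)) ⟩
    sgn (a ℤ.+ + 2 ℤ.* + n) ≡⟨ steps a n ⟩
    sgn a ∎
    where
    open ≡-Reasoning
    open ℤ-Solver
sgn-even a z@(-[1+ n ]) = sym (trans
  (cong sgn (solve 2 (λ a x → a := (a :+ con (+ 2) :* (:- x)) :+ con (+ 2) :* x) refl a (+ suc n)))
  (sgn-even (a ℤ.+ + 2 ℤ.* z) (+ suc n)))
  where open ℤ-Solver

module Θ-E = Theta sgn pentagonal (E 1) size≤pentagonal pentagonal-theorem

V₁E : V 1 (E 1) ≋ - S 5 (E 1)
V₁E = ≋-trans (Θ-E.V-self-similar 1 (ℤ.- 1ℤ) φ φ-injective sgn-φ pentagonal-φ onto)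
  (R.solve 1 (λ x → R.con (ℤ.- 1ℤ) R.:* x R.:= R.:- x) ≋-refl (S 5 (E 1)))
  where
  module R = Solver
  open ℤ-Solver
  φ : ℤ → ℤ
  -- As 24 times the exponent of a, plus 1, is (6a+1)², and 6 φ(b) + 1 = -5(6b+1), the map φ is
  -- multiplication by -5 on the square root. The form 4 + 5(...) matches `residue`.
  φ b = + 4 ℤ.+ + 5 ℤ.* (ℤ.- b ℤ.- 1ℤ)
  φ-injective : ∀ {b b′} → φ b ≡ φ b′ → b ≡ b′
  φ-injective {b} {b′} p = ℤ.*-cancelˡ-≡ (ℤ.- + 5) b b′ (trans
    (solve 1 (λ b → con (ℤ.- + 5) :* b := con (+ 4) :+ con (+ 5) :* (:- b :- con 1ℤ) :+ con 1ℤ) refl b)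
    (trans (cong (ℤ._+ 1ℤ) p) (solve 1 (λ b → con (+ 4) :+ con (+ 5) :* (:- b :- con 1ℤ) :+ con 1ℤ := con (ℤ.- + 5) :* b) refl b′)))
  sgn-φ : ∀ b → sgn (φ b) ≡ ℤ.- 1ℤ ℤ.* sgn b
  sgn-φ b = trans (cong sgn (solve 1 (λ b → con (+ 4) :+ con (+ 5) :* (:- b :- con 1ℤ) := (con 1ℤ :+ b) :+ con (+ 2) :* (con (ℤ.- + 3) :* b :- con 1ℤ)) refl b))
    (trans (sgn-even (1ℤ ℤ.+ b) (ℤ.- + 3 ℤ.* b ℤ.- 1ℤ)) (trans (sgn-suc b) (sym (ℤ.-1*i≡-i (sgn b)))))
  pentagonal-φ : ∀ b → pentagonal (φ b) ≡ 1 ℕ.+ 5 ℕ.* (5 ℕ.* pentagonal b)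
  pentagonal-φ b = ℤ.+-injective (ℤ.*-cancelˡ-≡ (+ 2) _ _ (begin
    + 2 ℤ.* + pentagonal (φ b) ≡⟨ pentagonal-closed (φ b) ⟩
    φ b ℤ.* (+ 3 ℤ.* φ b ℤ.+ 1ℤ) ≡⟨ solve 1 (λ b → let x = con (+ 4) :+ con (+ 5) :* (:- b :- con 1ℤ) in
                                                            x :* (con (+ 3) :* x :+ con 1ℤ) := con (+ 2) :+ con (+ 25) :* (b :* (con (+ 3) :* b :+ con 1ℤ))) refl b ⟩
    + 2 ℤ.+ + 25 ℤ.* (b ℤ.* (+ 3 ℤ.* b ℤ.+ 1ℤ)) ≡⟨ cong (λ z → + 2 ℤ.+ + 25 ℤ.* z) (sym (pentagonal-closed b)) ⟩
    + 2 ℤ.+ + 25 ℤ.* (+ 2 ℤ.* + pentagonal b) ≡⟨ solve 1 (λ p → con (+ 2) :+ con (+ 25) :* (con (+ 2) :* p) := con (+ 2) :* (con 1ℤ :+ con (+ 5) :* (con (+ 5) :* p))) refl (+ pentagonal b) ⟩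
    + 2 ℤ.* (1ℤ ℤ.+ + 5 ℤ.* (+ 5 ℤ.* + pentagonal b)) ≡⟨ cong (+ 2 ℤ.*_) (trans (cong (λ z → 1ℤ ℤ.+ + 5 ℤ.* z) (sym (ℤ.pos-* 5 (pentagonal b)))) (sym (pos-r+5k 1 (5 ℕ.* pentagonal b)))) ⟩
    + 2 ℤ.* + (1 ℕ.+ 5 ℕ.* (5 ℕ.* pentagonal b)) ∎))
    where open ≡-Reasoning
  onto : ∀ a k → pentagonal a ≡ 1 ℕ.+ 5 ℕ.* k → ∃[ b ] φ b ≡ a
  onto a k p with i , b′ , refl ← residue a = ℤ.- b′ ℤ.- 1ℤ , trans
    (solve 1 (λ b → con (+ 4) :+ con (+ 5) :* (:- (:- b :- con 1ℤ) :- con 1ℤ) := con (+ 4) :+ con (+ 5) :* b) refl b′)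
    (cong (λ z → + z ℤ.+ + 5 ℤ.* b′) (sym (only4 i (pentagonal-residue 1 k i b′ refl p))))
    where
    only4 : (i : Fin 5) → + 5 ∣ₛ pentagonal-class 1 i → toℕ i ≡ 4
    only4 = from-yes (Fin.all? {n = 5} λ i → (+ 5 ∣? pentagonal-class 1 i) →-dec (toℕ i ℕ.≟ 4))

V₃E : V 3 (E 1) ≋ 0#
V₃E = Θ-E.V-vanishes 3 λ a k p → let i , b , a≡ = residue a in never i (pentagonal-residue 3 k i b a≡ p)
  where
  never : (i : Fin 5) → ¬ + 5 ∣ₛ pentagonal-class 3 i
  never = from-yes (Fin.all? {n = 5} λ i → ¬? (+ 5 ∣? pentagonal-class 3 i))

V₄E : V 4 (E 1) ≋ 0#
V₄E = Θ-E.V-vanishes 4 λ a k p → let i , b , a≡ = residue a in never i (pentagonal-residue 4 k i b a≡ p)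
  where
  never : (i : Fin 5) → ¬ + 5 ∣ₛ pentagonal-class 4 i
  never = from-yes (Fin.all? {n = 5} λ i → ¬? (+ 5 ∣? pentagonal-class 4 i))

ε-residue : ∀ {a} r k (i : Fin 5) b → a ≡ + toℕ i ℤ.+ + 5 ℤ.* b → ε a ≡ r ℕ.+ 5 ℕ.* k →
  + 5 ∣ₛ ε-class r i
ε-residue {a} r k i b refl p = divides (z ℤ.- + k) (begin
  + r ℤ.- y ≡⟨ solve 3 (λ r k y → r :- y := (r :+ con (+ 5) :* k) :- y :- k :* con (+ 5)) refl (+ r) (+ k) y ⟩
  + r ℤ.+ + 5 ℤ.* + k ℤ.- y ℤ.- + k ℤ.* + 5 ≡⟨ cong (λ w → w ℤ.- y ℤ.- + k ℤ.* + 5) (trans (sym (pos-r+5k r k)) (trans (cong +_ (sym p)) (ε-mod (+ toℕ i) b))) ⟩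
  y ℤ.+ z ℤ.* + 5 ℤ.- y ℤ.- + k ℤ.* + 5 ≡⟨ solve 3 (λ y z k → y :+ z :* con (+ 5) :- y :- k :* con (+ 5) := (z :- k) :* con (+ 5)) refl y z (+ k) ⟩
  (z ℤ.- + k) ℤ.* + 5 ∎)
  where
  open ≡-Reasoning
  open ℤ-Solver
  y = + toℕ i ℤ.* (+ 2 ℤ.* + toℕ i ℤ.+ 1ℤ)
  z = + 4 ℤ.* + toℕ i ℤ.* b ℤ.+ b ℤ.+ + 10 ℤ.* b ℤ.* b

module Θ-ψ = Theta (λ _ → 1ℤ) ε ψ size≤ε (λ N → ≡[]-trans (triangular-theorem N)
  (≋⇒≡[] (∑-cong (range N) (λ a → ≋-sym (≋-trans (*-cong C1 ≋-refl) (*-identityˡ (q^ ε a)))))))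

V₂ψ : V 2 ψ ≋ 0#
V₂ψ = Θ-ψ.V-vanishes 2 λ a k p → let i , b , a≡ = residue a in never i (ε-residue 2 k i b a≡ p)
  where
  never : (i : Fin 5) → ¬ + 5 ∣ₛ ε-class 2 i
  never = from-yes (Fin.all? {n = 5} λ i → ¬? (+ 5 ∣? ε-class 2 i))

V₄ψ : V 4 ψ ≋ 0#
V₄ψ = Θ-ψ.V-vanishes 4 λ a k p → let i , b , a≡ = residue a in never i (ε-residue 4 k i b a≡ p)
  where
  never : (i : Fin 5) → ¬ + 5 ∣ₛ ε-class 4 i
  never = from-yes (Fin.all? {n = 5} λ i → ¬? (+ 5 ∣? ε-class 4 i))

1+5*-injective : ∀ {b b′} → 1ℤ ℤ.+ + 5 ℤ.* b ≡ 1ℤ ℤ.+ + 5 ℤ.* b′ → b ≡ b′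
1+5*-injective {b} {b′} p = ℤ.*-cancelˡ-≡ (+ 5) b b′ (∙-cancelˡ 1ℤ (+ 5 ℤ.* b) (+ 5 ℤ.* b′) p)
  where open Algebra.Properties.Group (AbelianGroup.group ℤ.+-0-abelianGroup) using (∙-cancelˡ)

-- 8 ε(a) + 1 = (4a+1)², and a = 1+5b gives 4a+1 = 5(4b+1).
ε-1+5* : ∀ b → ε (1ℤ ℤ.+ + 5 ℤ.* b) ≡ 3 ℕ.+ 5 ℕ.* (5 ℕ.* ε b)
ε-1+5* b = ℤ.+-injective (begin
  + ε (1ℤ ℤ.+ + 5 ℤ.* b) ≡⟨ ε-closed (1ℤ ℤ.+ + 5 ℤ.* b) ⟩
  _ ≡⟨ solve 1 (λ b → let x = con 1ℤ :+ con (+ 5) :* b in x :* (con (+ 2) :* x :+ con 1ℤ)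
                                                  := con (+ 3) :+ con (+ 5) :* (con (+ 5) :* (b :* (con (+ 2) :* b :+ con 1ℤ)))) refl b ⟩
  + 3 ℤ.+ + 5 ℤ.* (+ 5 ℤ.* (b ℤ.* (+ 2 ℤ.* b ℤ.+ 1ℤ))) ≡⟨ cong (λ z → + 3 ℤ.+ + 5 ℤ.* z) (trans (cong (+ 5 ℤ.*_) (sym (ε-closed b))) (sym (ℤ.pos-* 5 (ε b)))) ⟩
  + 3 ℤ.+ + 5 ℤ.* + (5 ℕ.* ε b) ≡⟨ sym (pos-r+5k 3 (5 ℕ.* ε b)) ⟩
  + (3 ℕ.+ 5 ℕ.* (5 ℕ.* ε b)) ∎)
  where
  open ≡-Reasoning
  open ℤ-Solver

V₃ψ : V 3 ψ ≋ S 5 ψ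
V₃ψ = ≋-trans (Θ-ψ.V-self-similar 3 1ℤ (λ b → 1ℤ ℤ.+ + 5 ℤ.* b) 1+5*-injective (λ _ → refl) ε-1+5* onto)
  (≋-trans (*-cong C1 ≋-refl) (*-identityˡ (S 5 ψ)))
  where
  onto : ∀ a k → ε a ≡ 3 ℕ.+ 5 ℕ.* k → ∃[ b ] 1ℤ ℤ.+ + 5 ℤ.* b ≡ a
  onto a k p with i , b , refl ← residue a = b , cong (λ z → + z ℤ.+ + 5 ℤ.* b) (sym (only1 i (ε-residue 3 k i b refl p)))
    where
    only1 : (i : Fin 5) → + 5 ∣ₛ ε-class 3 i → toℕ i ≡ 1
    only1 = from-yes (Fin.all? {n = 5} λ i → (+ 5 ∣? ε-class 3 i) →-dec (toℕ i ℕ.≟ 1))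

χ : ℤ → ℤ
χ z = if does (+ 5 ∣? z) then 1ℤ else 0ℤ

χ-∣ : ∀ {z} → + 5 ∣ₛ z → χ z ≡ 1ℤ
χ-∣ {z} p = cong (λ b → if b then 1ℤ else 0ℤ) (dec-true (+ 5 ∣? z) p)

χ-∤ : ∀ {z} → ¬ + 5 ∣ₛ z → χ z ≡ 0ℤ
χ-∤ {z} p = cong (λ b → if b then 1ℤ else 0ℤ) (dec-false (+ 5 ∣? z) p)

χ-≢0 : ∀ {z} → χ z ≢ 0ℤ → + 5 ∣ₛ z
χ-≢0 {z} nz with + 5 ∣? z
... | yes p = p
... | no ¬p = ⊥-elim (nz (χ-∤ ¬p))

χ-periodic : ∀ {x} c z → x ≡ c ℤ.+ + 5 ℤ.* z → χ x ≡ χ c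
χ-periodic c z refl with + 5 ∣? c
... | yes c∣@(divides d c≡) = trans (χ-∣ {c ℤ.+ + 5 ℤ.* z} (divides (d ℤ.+ z) (trans (cong (ℤ._+ + 5 ℤ.* z) c≡)
        (solve 2 (λ d z → d :* con (+ 5) :+ con (+ 5) :* z := (d :+ z) :* con (+ 5)) refl d z)))) (sym (χ-∣ c∣))
  where open ℤ-Solver
... | no c∤ = trans (χ-∤ {c ℤ.+ + 5 ℤ.* z} (λ { (divides d eq) → c∤ (divides (d ℤ.- z) (trans (solve 2 (λ c z → c := c :+ con (+ 5) :* z :- con (+ 5) :* z) refl c z)
        (trans (cong (ℤ._- + 5 ℤ.* z) eq) (solve 2 (λ d z → d :* con (+ 5) :- con (+ 5) :* z := (d :- z) :* con (+ 5)) refl d z)))) })) (sym (χ-∤ c∤))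
  where open ℤ-Solver

-- As 8 ε a + 1 = (4a+1)², the series ψ² counts Gaussian integers (4x+1) + (4y+1)i
-- by norm.  In these terms rotate is z ↦ (2-i) z̄, whose image has index 5.
module Hecke where

  pairs : ℕ → List (ℤ × ℤ)
  pairs N = cartesianProduct (range N) (range N)

  pairs-unique : ∀ N → Unique (pairs N)
  pairs-unique N = cartesianProduct⁺ (range-unique N) (range-unique N)

  norm : ℤ × ℤ → ℕ
  norm (x , y) = ε x ℕ.+ ε y

  ∈-pairs : ∀ {N} p → norm p ℕ.< N → p ∈ pairs N
  ∈-pairs (x , y) p<N = ∈-cartesianProduct⁺
    (∈-range x (ℕ.≤-<-trans (ℕ.≤-trans (size≤ε x) (ℕ.m≤m+n _ _)) p<N))
    (∈-range y (ℕ.≤-<-trans (ℕ.≤-trans (size≤ε y) (ℕ.m≤n+m _ _)) p<N))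

  ψ² : ∀ N → ψ * ψ ≡[ N ] ∑ (pairs N) (λ p → q^ norm p)
  ψ² N = ≡[]-trans (≡[]-* (triangular-theorem N) (triangular-theorem N))
    (≋⇒≡[] (≋-trans (∑-product (range N) (range N) (λ a → q^ ε a) (λ a → q^ ε a))
      (∑-cong (pairs N) (λ p → ≋-sym (q^-+ (ε (proj₁ p)) (ε (proj₂ p)))))))

  -- `weight` acts as the indicator of the image of φ: the pairs with g p = n are counted through
  -- their images, the pairs of norm m with nonzero weight. The separate function `g` allows for a
  -- map that raises the norm in two stages.
  reindex : ∀ n m N (weight : ℤ × ℤ → ℤ) (φ : ℤ × ℤ → ℤ × ℤ) (g : ℤ × ℤ → ℕ) → m ℕ.< N → n ℕ.< N →
    (∀ {p p′} → φ p ≡ φ p′ → p ≡ p′) → (∀ p → weight (φ p) ≡ 1ℤ) →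
    (∀ p → g p ≡ n → norm (φ p) ≡ m) → (∀ p → norm (φ p) ≡ m → g p ≡ n) → (∀ p → norm p ℕ.≤ g p) →
    (∀ p → weight p ≢ 0ℤ → ∃[ p′ ] φ p′ ≡ p) →
    ∑ℤ (pairs N) (λ p → (q^ g p) n) ≡ ∑ℤ (pairs N) (λ p → weight p ℤ.* (q^ norm p) m)
  reindex n m N weight φ g m<N n<N inj wφ to from norm≤g onto = trans
    (∑ℤ-cong (pairs N) (λ p → trans (q^-at-⇔ {g p} {n} {norm (φ p)} {m} (to p) (from p))
      (sym (trans (cong (ℤ._* (q^ norm (φ p)) m) (wφ p)) (ℤ.*-identityˡ _)))))
    (∑ℤ-reindex φ (λ p → weight p ℤ.* (q^ norm p) m) (pairs-unique N) (pairs-unique N) inj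
      (λ {p} nz → ∈-pairs (φ p) (subst (ℕ._< N) (sym (norm≡m (φ p) nz)) m<N))
      surj)
    where
    norm≡m : ∀ p → weight p ℤ.* (q^ norm p) m ≢ 0ℤ → norm p ≡ m
    norm≡m p nz = q^-at-≢0 (λ z → nz (trans (cong (weight p ℤ.*_) z) (ℤ.*-zeroʳ (weight p))))
    surj : ∀ {p} → weight p ℤ.* (q^ norm p) m ≢ 0ℤ → ∃[ p′ ] (p′ ∈ pairs N × φ p′ ≡ p)
    surj {p} nz with p′ , refl ← onto p (λ z → nz (cong (ℤ._* (q^ norm p) m) z)) =
      p′ , ∈-pairs p′ (ℕ.≤-<-trans (norm≤g p′) (subst (ℕ._< N) (sym (from p′ (norm≡m p nz))) n<N)) , refl

  rotate : ℤ × ℤ → ℤ × ℤ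
  rotate (u , v) = + 2 ℤ.* u ℤ.- v , ℤ.- u ℤ.- + 2 ℤ.* v ℤ.- 1ℤ

  -- The linear form whose divisibility by 5 singles out the image of `rotate`.
  Λ : ℤ × ℤ → ℤ
  Λ (x , y) = + 2 ℤ.* x ℤ.- y ℤ.- 1ℤ

  Λ-rotate : ∀ u v → Λ (rotate (u , v)) ≡ + 5 ℤ.* u
  Λ-rotate = solve 2 (λ u v → con (+ 2) :* (con (+ 2) :* u :- v) :- (:- u :- con (+ 2) :* v :- con 1ℤ) :- con 1ℤ := con (+ 5) :* u) refl
    where open ℤ-Solver

  rotate-injective : ∀ {p p′} → rotate p ≡ rotate p′ → p ≡ p′
  rotate-injective {u , v} {u′ , v′} eq = cong₂ _,_ u≡u′ v≡v′
    where
    open ℤ-Solver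
    u≡u′ : u ≡ u′
    u≡u′ = ℤ.*-cancelˡ-≡ (+ 5) u u′ (trans (sym (Λ-rotate u v)) (trans (cong Λ eq) (Λ-rotate u′ v′)))
    v≡v′ : v ≡ v′
    v≡v′ = begin
      v ≡⟨ solve 2 (λ u v → v := con (+ 2) :* u :- (con (+ 2) :* u :- v)) refl u v ⟩
      + 2 ℤ.* u ℤ.- proj₁ (rotate (u , v)) ≡⟨ cong₂ (λ a p → + 2 ℤ.* a ℤ.- proj₁ p) u≡u′ eq ⟩
      + 2 ℤ.* u′ ℤ.- proj₁ (rotate (u′ , v′)) ≡⟨ solve 2 (λ u v → con (+ 2) :* u :- (con (+ 2) :* u :- v) := v) refl u′ v′ ⟩
      v′ ∎
      where open ≡-Reasoning

  rotate-onto : ∀ p → + 5 ∣ₛ Λ p → ∃[ p′ ] rotate p′ ≡ p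
  rotate-onto (x , y) (divides u eq) = (u , + 2 ℤ.* u ℤ.- x) , cong₂ _,_
    (solve 2 (λ u x → con (+ 2) :* u :- (con (+ 2) :* u :- x) := x) refl u x)
    (trans (solve 2 (λ u x → :- u :- con (+ 2) :* (con (+ 2) :* u :- x) :- con 1ℤ := con (+ 2) :* x :- con 1ℤ :- u :* con (+ 5)) refl u x)
      (trans (cong (λ z → + 2 ℤ.* x ℤ.- 1ℤ ℤ.- z) (sym eq))
        (solve 2 (λ x y → con (+ 2) :* x :- con 1ℤ :- (con (+ 2) :* x :- y :- con 1ℤ) := y) refl x y)))
    where open ℤ-Solver

  +norm : ∀ x y → + norm (x , y) ≡ x ℤ.* (+ 2 ℤ.* x ℤ.+ 1ℤ) ℤ.+ y ℤ.* (+ 2 ℤ.* y ℤ.+ 1ℤ)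
  +norm x y = trans (ℤ.pos-+ (ε x) (ε y)) (cong₂ ℤ._+_ (ε-closed x) (ε-closed y))

  norm-rotate : ∀ p → norm (rotate p) ≡ 1 ℕ.+ 5 ℕ.* norm p
  norm-rotate p@(u , v) = ℤ.+-injective (begin
    + norm (rotate p) ≡⟨ +norm (proj₁ (rotate p)) (proj₂ (rotate p)) ⟩
    _ ≡⟨ solve 2 (λ u v → let x = con (+ 2) :* u :- v ; y = :- u :- con (+ 2) :* v :- con 1ℤ in
                                      x :* (con (+ 2) :* x :+ con 1ℤ) :+ y :* (con (+ 2) :* y :+ con 1ℤ)
                                      := con 1ℤ :+ con (+ 5) :* (u :* (con (+ 2) :* u :+ con 1ℤ) :+ v :* (con (+ 2) :* v :+ con 1ℤ))) refl u v ⟩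
    1ℤ ℤ.+ + 5 ℤ.* (u ℤ.* (+ 2 ℤ.* u ℤ.+ 1ℤ) ℤ.+ v ℤ.* (+ 2 ℤ.* v ℤ.+ 1ℤ)) ≡⟨ cong (λ z → 1ℤ ℤ.+ + 5 ℤ.* z) (sym (+norm u v)) ⟩
    1ℤ ℤ.+ + 5 ℤ.* + norm p ≡⟨ sym (pos-r+5k 1 (norm p)) ⟩
    + (1 ℕ.+ 5 ℕ.* norm p) ∎)
    where
    open ≡-Reasoning
    open ℤ-Solver

  swap : ℤ × ℤ → ℤ × ℤ
  swap (x , y) = y , x

  norm-swap : ∀ p → norm (swap p) ≡ norm p
  norm-swap (x , y) = ℕ.+-comm (ε y) (ε x)

  -- On the Gaussian integer (4u+1) + (4v+1)i this is multiplication by 5; `Ξ` is the indicator of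
  -- its image.
  expand : ℤ × ℤ → ℤ × ℤ
  expand (u , v) = 1ℤ ℤ.+ + 5 ℤ.* u , 1ℤ ℤ.+ + 5 ℤ.* v

  Ξ : ℤ × ℤ → ℤ
  Ξ (x , y) = χ (x ℤ.- 1ℤ) ℤ.* χ (y ℤ.- 1ℤ)

  norm-expand : ∀ p → norm (expand p) ≡ 1 ℕ.+ 5 ℕ.* (1 ℕ.+ 5 ℕ.* norm p)
  norm-expand (u , v) = trans (cong₂ ℕ._+_ (ε-1+5* u) (ε-1+5* v))
    (solve 2 (λ a b → (con 3 :+ con 5 :* (con 5 :* a)) :+ (con 3 :+ con 5 :* (con 5 :* b))
      := con 1 :+ con 5 :* (con 1 :+ con 5 :* (a :+ b))) refl (ε u) (ε v))
    where open ℕ-Solver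

  expand-onto : ∀ p → Ξ p ≢ 0ℤ → ∃[ p′ ] expand p′ ≡ p
  expand-onto (x , y) nz
    with divides u x≡ ← χ-≢0 {x ℤ.- 1ℤ} (λ z → nz (cong (ℤ._* χ (y ℤ.- 1ℤ)) z))
       | divides v y≡ ← χ-≢0 {y ℤ.- 1ℤ} (λ z → nz (trans (cong (χ (x ℤ.- 1ℤ) ℤ.*_) z) (ℤ.*-zeroʳ (χ (x ℤ.- 1ℤ)))))
    = (u , v) , cong₂ _,_ (back x u x≡) (back y v y≡)
    where
    open ℤ-Solver
    back : ∀ x u → x ℤ.- 1ℤ ≡ u ℤ.* + 5 → 1ℤ ℤ.+ + 5 ℤ.* u ≡ x
    back x u eq = trans (solve 1 (λ u → con 1ℤ :+ con (+ 5) :* u := con 1ℤ :+ u :* con (+ 5)) refl u)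
      (trans (cong (λ z → 1ℤ ℤ.+ z) (sym eq)) (solve 1 (λ x → con 1ℤ :+ (x :- con 1ℤ) := x) refl x))

  Ξ-expand : ∀ p → Ξ (expand p) ≡ 1ℤ
  Ξ-expand (u , v) = cong₂ ℤ._*_ (one u) (one v)
    where
    open ℤ-Solver
    one : ∀ u → χ (1ℤ ℤ.+ + 5 ℤ.* u ℤ.- 1ℤ) ≡ 1ℤ
    one u = χ-∣ (divides u (solve 1 (λ u → con 1ℤ :+ con (+ 5) :* u :- con 1ℤ := u :* con (+ 5)) refl u))

  -- A Gaussian integer of norm divisible by 5 is a multiple of 2-i or of 2+i.
  inclusion–exclusion : ∀ p n → norm p ≡ 1 ℕ.+ 5 ℕ.* n → 1ℤ ℤ.+ Ξ p ≡ χ (Λ p) ℤ.+ χ (Λ (swap p))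
  inclusion–exclusion (x , y) n eq with i , b , refl ← residue x | j , c , refl ← residue y = begin
    1ℤ ℤ.+ χ (x ℤ.- 1ℤ) ℤ.* χ (y ℤ.- 1ℤ)
      ≡⟨ cong (λ z → 1ℤ ℤ.+ z) (cong₂ ℤ._*_ (χ-periodic (+ toℕ i ℤ.- 1ℤ) b (shift (+ toℕ i) b)) (χ-periodic (+ toℕ j ℤ.- 1ℤ) c (shift (+ toℕ j) c))) ⟩
    1ℤ ℤ.+ χ (+ toℕ i ℤ.- 1ℤ) ℤ.* χ (+ toℕ j ℤ.- 1ℤ)
      ≡⟨ check i j (divides (+ n ℤ.- rest (+ toℕ i) b ℤ.- rest (+ toℕ j) c) (class-eq (+ toℕ i) b (+ toℕ j) c eq)) ⟩
    χ (Λ (+ toℕ i , + toℕ j)) ℤ.+ χ (Λ (+ toℕ j , + toℕ i))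
      ≡⟨ sym (cong₂ ℤ._+_ (χ-periodic (Λ (+ toℕ i , + toℕ j)) (+ 2 ℤ.* b ℤ.- c) (Λ-shift (+ toℕ i) b (+ toℕ j) c)) (χ-periodic (Λ (+ toℕ j , + toℕ i)) (+ 2 ℤ.* c ℤ.- b) (Λ-shift (+ toℕ j) c (+ toℕ i) b))) ⟩
    χ (Λ (x , y)) ℤ.+ χ (Λ (y , x)) ∎
    where
    open ≡-Reasoning
    open ℤ-Solver
    shift : ∀ i b → i ℤ.+ + 5 ℤ.* b ℤ.- 1ℤ ≡ i ℤ.- 1ℤ ℤ.+ + 5 ℤ.* b
    shift = solve 2 (λ i b → i :+ con (+ 5) :* b :- con 1ℤ := i :- con 1ℤ :+ con (+ 5) :* b) refl
    Λ-shift : ∀ i b j c → Λ (i ℤ.+ + 5 ℤ.* b , j ℤ.+ + 5 ℤ.* c) ≡ Λ (i , j) ℤ.+ + 5 ℤ.* (+ 2 ℤ.* b ℤ.- c)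
    Λ-shift = solve 4 (λ i b j c → con (+ 2) :* (i :+ con (+ 5) :* b) :- (j :+ con (+ 5) :* c) :- con 1ℤ
      := con (+ 2) :* i :- j :- con 1ℤ :+ con (+ 5) :* (con (+ 2) :* b :- c)) refl
    class : ℤ → ℤ → ℤ
    class i j = i ℤ.* (+ 2 ℤ.* i ℤ.+ 1ℤ) ℤ.+ j ℤ.* (+ 2 ℤ.* j ℤ.+ 1ℤ) ℤ.- 1ℤ
    rest : ℤ → ℤ → ℤ
    rest i b = + 4 ℤ.* i ℤ.* b ℤ.+ b ℤ.+ + 10 ℤ.* b ℤ.* b
    class-eq : ∀ i b j c → norm (i ℤ.+ + 5 ℤ.* b , j ℤ.+ + 5 ℤ.* c) ≡ 1 ℕ.+ 5 ℕ.* n →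
      class i j ≡ (+ n ℤ.- rest i b ℤ.- rest j c) ℤ.* + 5
    class-eq i b j c eq = begin
      class i j
        ≡⟨ solve 4 (λ x y r s → x :+ y :- con 1ℤ := (x :+ r :* con (+ 5)) :+ (y :+ s :* con (+ 5)) :- con 1ℤ :- (r :+ s) :* con (+ 5)) refl
             (i ℤ.* (+ 2 ℤ.* i ℤ.+ 1ℤ)) (j ℤ.* (+ 2 ℤ.* j ℤ.+ 1ℤ)) (rest i b) (rest j c) ⟩
      _
        ≡⟨ cong (λ z → z ℤ.- 1ℤ ℤ.- (rest i b ℤ.+ rest j c) ℤ.* + 5) (trans (cong₂ ℤ._+_ (sym (ε-mod i b)) (sym (ε-mod j c)))
             (trans (sym (ℤ.pos-+ (ε (i ℤ.+ + 5 ℤ.* b)) (ε (j ℤ.+ + 5 ℤ.* c)))) (trans (cong +_ eq) (pos-r+5k 1 n)))) ⟩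
      1ℤ ℤ.+ + 5 ℤ.* + n ℤ.- 1ℤ ℤ.- (rest i b ℤ.+ rest j c) ℤ.* + 5
        ≡⟨ solve 3 (λ n r s → con 1ℤ :+ con (+ 5) :* n :- con 1ℤ :- (r :+ s) :* con (+ 5) := (n :- r :- s) :* con (+ 5)) refl (+ n) (rest i b) (rest j c) ⟩
      (+ n ℤ.- rest i b ℤ.- rest j c) ℤ.* + 5 ∎
    -- All terms depend only on the residues of x and y modulo 5, which leaves 25 cases to decide.
    check : (i j : Fin 5) → + 5 ∣ₛ class (+ toℕ i) (+ toℕ j) →
      1ℤ ℤ.+ χ (+ toℕ i ℤ.- 1ℤ) ℤ.* χ (+ toℕ j ℤ.- 1ℤ) ≡ χ (Λ (+ toℕ i , + toℕ j)) ℤ.+ χ (Λ (+ toℕ j , + toℕ i))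
    check = from-yes (Fin.all? {n = 5} λ i → Fin.all? {n = 5} λ j → (+ 5 ∣? class (+ toℕ i) (+ toℕ j)) →-dec
      (1ℤ ℤ.+ χ (+ toℕ i ℤ.- 1ℤ) ℤ.* χ (+ toℕ j ℤ.- 1ℤ) ℤ.≟ χ (Λ (+ toℕ i , + toℕ j)) ℤ.+ χ (Λ (+ toℕ j , + toℕ i))))

  -- The eigenvalue equation of the Hecke operator at 5; the eigenvalue is 2 because 5 = (2-i)(2+i)
  -- splits. The second summand counts the multiples of 5 once more. By inclusion and exclusion the
  -- left side then counts the multiples of 2-i and those of 2+i, and each of these sets corresponds
  -- to all elements of the smaller norm.
  theorem : V 1 (ψ * ψ) + q * S 5 (ψ * ψ) ≋ C (+ 2) * (ψ * ψ)
  theorem = pointwise λ n → let m = 1 ℕ.+ 5 ℕ.* n ; N = suc m ; xs = pairs N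
                                n<N = ℕ.s≤s (ℕ.≤-trans (ℕ.m≤n*m n 5) (ℕ.n≤1+n (5 ℕ.* n))) in begin
    (V 1 (ψ * ψ) + q * S 5 (ψ * ψ)) n
      ≡⟨ +-at (V 1 (ψ * ψ)) (q * S 5 (ψ * ψ)) n ⟩
    (ψ * ψ) m ℤ.+ (q * S 5 (ψ * ψ)) n
      ≡⟨ cong₂ ℤ._+_ (below (ψ² N) m ℕ.≤-refl) (below (expanded N) n n<N) ⟩
    ∑ℤ xs (λ p → (q^ norm p) m) ℤ.+ ∑ℤ xs (λ p → (q^ (1 ℕ.+ 5 ℕ.* norm p)) n)
      ≡⟨ cong (λ z → ∑ℤ xs (λ p → (q^ norm p) m) ℤ.+ z) (reindex n m N Ξ expand (λ p → 1 ℕ.+ 5 ℕ.* norm p) ℕ.≤-refl n<N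
           (λ eq → cong₂ _,_ (1+5*-injective (cong proj₁ eq)) (1+5*-injective (cong proj₂ eq)))
           Ξ-expand
           (λ p eq → trans (norm-expand p) (cong (λ z → 1 ℕ.+ 5 ℕ.* z) eq))
           (λ p eq → ℕ.*-cancelˡ-≡ _ _ 5 (ℕ.suc-injective (trans (sym (norm-expand p)) eq)))
           (λ p → ℕ.≤-trans (ℕ.m≤n*m (norm p) 5) (ℕ.n≤1+n (5 ℕ.* norm p))) expand-onto) ⟩
    ∑ℤ xs (λ p → (q^ norm p) m) ℤ.+ ∑ℤ xs (λ p → Ξ p ℤ.* (q^ norm p) m)
      ≡⟨ sym (∑ℤ-+ xs (λ p → (q^ norm p) m) (λ p → Ξ p ℤ.* (q^ norm p) m)) ⟩
    ∑ℤ xs (λ p → (q^ norm p) m ℤ.+ Ξ p ℤ.* (q^ norm p) m)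
      ≡⟨ ∑ℤ-cong xs (combine n) ⟩
    ∑ℤ xs (λ p → χ (Λ p) ℤ.* (q^ norm p) m ℤ.+ χ (Λ (swap p)) ℤ.* (q^ norm p) m)
      ≡⟨ ∑ℤ-+ xs (λ p → χ (Λ p) ℤ.* (q^ norm p) m) (λ p → χ (Λ (swap p)) ℤ.* (q^ norm p) m) ⟩
    ∑ℤ xs (λ p → χ (Λ p) ℤ.* (q^ norm p) m) ℤ.+ ∑ℤ xs (λ p → χ (Λ (swap p)) ℤ.* (q^ norm p) m)
      ≡⟨ sym (cong₂ ℤ._+_
           (reindex n m N (λ p → χ (Λ p)) rotate norm ℕ.≤-refl n<N rotate-injective χΛ-rotate
             (λ p eq → trans (norm-rotate p) (cong (λ z → 1 ℕ.+ 5 ℕ.* z) eq))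
             (λ p eq → ℕ.*-cancelˡ-≡ _ _ 5 (ℕ.suc-injective (trans (sym (norm-rotate p)) eq)))
             (λ p → ℕ.≤-refl) (λ p nz → rotate-onto p (χ-≢0 nz)))
           (reindex n m N (λ p → χ (Λ (swap p))) (λ p → swap (rotate p)) norm ℕ.≤-refl n<N (λ eq → rotate-injective (cong swap eq)) χΛ-rotate
             (λ p eq → trans (norm-swap (rotate p)) (trans (norm-rotate p) (cong (λ z → 1 ℕ.+ 5 ℕ.* z) eq)))
             (λ p eq → ℕ.*-cancelˡ-≡ _ _ 5 (ℕ.suc-injective (trans (sym (norm-rotate p)) (trans (sym (norm-swap (rotate p))) eq))))
             (λ p → ℕ.≤-refl) (λ p nz → let p′ , eq = rotate-onto (swap p) (χ-≢0 nz) in p′ , cong swap eq))) ⟩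
    ∑ℤ xs (λ p → (q^ norm p) n) ℤ.+ ∑ℤ xs (λ p → (q^ norm p) n)
      ≡⟨ sym (cong₂ ℤ._+_ (below (ψ² N) n n<N) (below (ψ² N) n n<N)) ⟩
    (ψ * ψ) n ℤ.+ (ψ * ψ) n
      ≡⟨ solve 1 (λ x → x :+ x := con (+ 2) :* x) refl ((ψ * ψ) n) ⟩
    + 2 ℤ.* (ψ * ψ) n
      ≡⟨ sym (C-*-at (+ 2) (ψ * ψ) n) ⟩
    (C (+ 2) * (ψ * ψ)) n ∎
    where
    open ≡-Reasoning
    open ℤ-Solver
    expanded : ∀ N → q * S 5 (ψ * ψ) ≡[ N ] ∑ (pairs N) (λ p → q^ (1 ℕ.+ 5 ℕ.* norm p))
    expanded N = ≡[]-trans (≡[]-* (≋⇒≡[] ≋-refl) (≡[]-trans (S-truncated 5 (ψ² N)) (≋⇒≡[] (∑-S 5 (pairs N) (λ p → q^ norm p)))))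
      (≋⇒≡[] (≋-trans (≋-sym (∑-*ˡ (pairs N) q (λ p → S 5 (q^ norm p)))) (∑-cong (pairs N) (λ p →
        ≋-trans (*-congˡ (S-q^ 5 (norm p))) (≋-sym (q^-+ 1 (5 ℕ.* norm p)))))))
    χΛ-rotate : ∀ p → χ (Λ (rotate p)) ≡ 1ℤ
    χΛ-rotate (u , v) = χ-∣ (divides u (trans (Λ-rotate u v) (ℤ.*-comm (+ 5) u)))
    combine : ∀ n p → let t = (q^ norm p) (1 ℕ.+ 5 ℕ.* n) in
      t ℤ.+ Ξ p ℤ.* t ≡ χ (Λ p) ℤ.* t ℤ.+ χ (Λ (swap p)) ℤ.* t
    combine n p with norm p ℕ.≟ 1 ℕ.+ 5 ℕ.* n
    ... | yes eq = trans (solve 2 (λ t x → t :+ x :* t := (con 1ℤ :+ x) :* t) refl t (Ξ p))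
      (trans (cong (ℤ._* t) (inclusion–exclusion p n eq)) (ℤ.*-distribʳ-+ t (χ (Λ p)) (χ (Λ (swap p)))))
      where t = (q^ norm p) (1 ℕ.+ 5 ℕ.* n)
    ... | no ¬eq = trans (cong (λ t → t ℤ.+ Ξ p ℤ.* t) t≡0) (trans
        (solve 3 (λ x y z → con 0ℤ :+ x :* con 0ℤ := y :* con 0ℤ :+ z :* con 0ℤ) refl (Ξ p) (χ (Λ p)) (χ (Λ (swap p))))
        (cong (λ t → χ (Λ p) ℤ.* t ℤ.+ χ (Λ (swap p)) ℤ.* t) (sym t≡0)))
      where
      t≡0 : (q^ norm p) (1 ℕ.+ 5 ℕ.* n) ≡ 0ℤ
      t≡0 = q^-at-≢ ¬eq

-- Functions of level 10

C-cancel : ∀ c .{{_ : ℤ.NonZero c}} {f g} → C c * f ≋ C c * g → f ≋ g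
C-cancel c {f} {g} p = pointwise λ n → ℤ.*-cancelˡ-≡ c (f n) (g n)
  (trans (sym (C-*-at c f n)) (trans (at p n) (C-*-at c g n)))

-- To derive f ≋ g from l ≋ r, exhibit f - g as a multiple of l - r.
modulo : ∀ {f g l r} c → l ≋ r → f ≋ g + c * (l - r) → f ≋ g
modulo {f} {g} {l} {r} c p eq = begin
  f ≈⟨ eq ⟩
  g + c * (l - r) ≈⟨ +-congˡ (*-congˡ (+-cong p ≋-refl)) ⟩
  g + c * (r - r) ≈⟨ solve 3 (λ g c r → g :+ c :* (r :- r) := g) ≋-refl g c r ⟩
  g ∎
  where
  open ≋-Reasoning
  open Solver

modulo₂ : ∀ {f g l r l′ r′} c c′ → l ≋ r → l′ ≋ r′ → f ≋ g + c * (l - r) + c′ * (l′ - r′) → f ≋ g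
modulo₂ c c′ p p′ eq = modulo c p (modulo c′ p′ eq)

modulo₃ : ∀ {f g l r l′ r′ l″ r″} c c′ c″ → l ≋ r → l′ ≋ r′ → l″ ≋ r″ →
  f ≋ g + c * (l - r) + c′ * (l′ - r′) + c″ * (l″ - r″) → f ≋ g
modulo₃ c c′ c″ p p′ p″ eq = modulo₂ c c′ p p′ (modulo c″ p″ eq)

≋₅-refl : ∀ {t} → t ≋₅ t
≋₅-refl = ≋⟨ ≋-refl , ≋-refl , ≋-refl , ≋-refl , ≋-refl ⟩

⊠-cong : ∀ {s s′ t t′} → s ≋₅ s′ → t ≋₅ t′ → s ⊠ t ≋₅ s′ ⊠ t′
⊠-cong {s} {s′} {t} {t′} p r = D-injective (≋-trans (D-⊠ s t) (≋-trans (*-cong (D-cong p) (D-cong r)) (≋-sym (D-⊠ s′ t′))))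

-- With r = R(q) and s = R(q²) for the Rogers–Ramanujan continued fraction R
-- one has A = q^(1/5)/r and B = q^(2/5)/s, and K = AB² = q/(rs²).
module Level10 (A ρ B σ M N : Series)
  (relation : ⟨ B , 0# , - 1# , 0# , - σ ⟩ ⊠ ⟨ B , 0# , - 1# , 0# , - σ ⟩
              ≋₅ ⟨ A , - 1# , - ρ , 0# , 0# ⟩ ⊠ ⟨ M , N , 0# , 1# , 0# ⟩)
  (Aρ-from-Bσ : B * σ ≋ 1# → A * ρ ≋ 1#)
  where

  open Solver

  K k : Series
  K = A * B ^ 2
  k = ρ * σ ^ 2

  private
    component : ∀ {n} → (Quint (Polynomial n) → Polynomial n) →
      (q A ρ B σ M N : Polynomial n) → Polynomial n → Polynomial n × Polynomial n
    component c q A ρ B σ M N one =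
      c (multiply _:+_ _:*_ q β β) := c (multiply _:+_ _:*_ q ⟨ A , :- one , :- ρ , con 0ℤ , con 0ℤ ⟩ ⟨ M , N , con 0ℤ , one , con 0ℤ ⟩)
      where β = ⟨ B , con 0ℤ , :- one , con 0ℤ , :- σ ⟩

  -- The x⁴ component of the relation reads 1 - 2Bσ = -1.
  Bσ : B * σ ≋ 1#
  Bσ = C-cancel (+ 2) (modulo (- 1#) (e₄ relation)
    (solve 7 (λ q A ρ B σ M N → let l , r = component c₄ q A ρ B σ M N :1 in
      con (+ 2) :* (B :* σ) := con (+ 2) :* :1 :+ (:- :1) :* (l :- r)) ≋-refl q A ρ B σ M N))

  -- Supplied by the application rather than by the relation: there B and σ are A and ρ at q², and
  -- this substitution is injective.
  Aρ : A * ρ ≋ 1#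
  Aρ = Aρ-from-Bσ Bσ

  Kk : K * k ≋ 1#
  Kk = begin
    A * B ^ 2 * (ρ * σ ^ 2) ≈⟨ solve 4 (λ A B ρ σ → A :* B :^ 2 :* (ρ :* σ :^ 2) := A :* ρ :* (B :* σ) :^ 2) ≋-refl A B ρ σ ⟩
    A * ρ * (B * σ) ^ 2 ≈⟨ *-cong Aρ (^-cong 2 Bσ) ⟩
    1# * 1# ^ 2 ≈⟨ solve 1 (λ x → :1 :* :1 :^ 2 := :1) ≋-refl q ⟩
    1# ∎
    where open ≋-Reasoning

  M-formula : M ≋ ρ * (B ^ 2 + q * ρ)
  M-formula = modulo₂ (- ρ) (- M) (e₀ relation) Aρ
    (solve 7 (λ q A ρ B σ M N → let l , r = component c₀ q A ρ B σ M N :1 in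
      M := ρ :* (B :^ 2 :+ q :* ρ) :+ :- ρ :* (l :- r) :+ :- M :* (A :* ρ :- :1)) ≋-refl q A ρ B σ M N)

  N-formula : N ≋ A * (A - q * σ ^ 2)
  N-formula = modulo₂ A (- N) (e₃ relation) Aρ
    (solve 7 (λ q A ρ B σ M N → let l , r = component c₃ q A ρ B σ M N :1 in
      N := A :* (A :- q :* σ :^ 2) :+ A :* (l :- r) :+ :- N :* (A :* ρ :- :1)) ≋-refl q A ρ B σ M N)

  -- The x component is AN - M = 2qσ, and A times the x² component is AN + M = 2AB. Their sum is
  -- halved.
  AN-formula : A * N ≋ A * B + q * σ
  AN-formula = ≋-sym (C-cancel (+ 2) (modulo₃ 1# (- A) M (e₁ relation) (e₂ relation) Aρ
    (solve 7 (λ q A ρ B σ M N →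
      let l₁ , r₁ = component c₁ q A ρ B σ M N :1
          l₂ , r₂ = component c₂ q A ρ B σ M N :1 in
      con (+ 2) :* (A :* B :+ q :* σ) := con (+ 2) :* (A :* N) :+ :1 :* (l₁ :- r₁) :+ :- A :* (l₂ :- r₂) :+ M :* (A :* ρ :- :1))
      ≋-refl q A ρ B σ M N)))

  BM : B * M ≋ K - q
  BM = modulo₃ _ _ _ (e₁ relation) AN-formula Bσ
    (solve 7 (λ q A ρ B σ M N → let l , r = component c₁ q A ρ B σ M N :1 in
      B :* M := A :* B :^ 2 :- q :+ B :* (l :- r) :+ B :* (A :* N :- (A :* B :+ q :* σ)) :+ :- q :* (B :* σ :- :1)) ≋-refl q A ρ B σ M N)

  A²M : A ^ 2 * M ≋ K + q
  A²M = modulo₂ _ _ M-formula Aρ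
    (solve 5 (λ q A ρ B M → A :^ 2 :* M := A :* B :^ 2 :+ q :+ A :^ 2 :* (M :- ρ :* (B :^ 2 :+ q :* ρ))
      :+ (A :* B :^ 2 :+ q :* (A :* ρ :+ :1)) :* (A :* ρ :- :1)) ≋-refl q A ρ B M)

  σN : σ * N ≋ 1# + q * k
  σN = modulo₃ _ _ _ AN-formula Aρ Bσ
    (solve 6 (λ q A ρ B σ N → σ :* N := :1 :+ q :* (ρ :* σ :^ 2) :+ ρ :* σ :* (A :* N :- (A :* B :+ q :* σ))
      :+ σ :* (B :- N) :* (A :* ρ :- :1) :+ :1 :* (B :* σ :- :1)) ≋-refl q A ρ B σ N)

  ρ²N : ρ ^ 2 * N ≋ 1# - q * k
  ρ²N = modulo₂ _ _ N-formula Aρ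
    (solve 5 (λ q A ρ σ N → ρ :^ 2 :* N := :1 :- q :* (ρ :* σ :^ 2) :+ ρ :^ 2 :* (N :- A :* (A :- q :* σ :^ 2))
      :+ (A :* ρ :+ :1 :- q :* ρ :* σ :^ 2) :* (A :* ρ :- :1)) ≋-refl q A ρ σ N)

  B⁴N : B ^ 4 * N ≋ K ^ 2 * (1# - q * k)
  B⁴N = modulo₂ _ _ ρ²N Aρ
    (solve 6 (λ q A ρ B σ N → B :^ 4 :* N := (A :* B :^ 2) :^ 2 :* (:1 :- q :* (ρ :* σ :^ 2))
      :+ (A :* B :^ 2) :^ 2 :* (ρ :^ 2 :* N :- (:1 :- q :* (ρ :* σ :^ 2)))
      :+ :- (B :^ 4 :* N :* (A :* ρ :+ :1)) :* (A :* ρ :- :1)) ≋-refl q A ρ B σ N)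

  σ⁴M : σ ^ 4 * M ≋ k ^ 2 * (K + q)
  σ⁴M = modulo₂ _ _ A²M Aρ
    (solve 6 (λ q A ρ B σ M → σ :^ 4 :* M := (ρ :* σ :^ 2) :^ 2 :* (A :* B :^ 2 :+ q)
      :+ (ρ :* σ :^ 2) :^ 2 :* (A :^ 2 :* M :- (A :* B :^ 2 :+ q))
      :+ :- (σ :^ 4 :* M :* (A :* ρ :+ :1)) :* (A :* ρ :- :1)) ≋-refl q A ρ B σ M)

  h : Series
  h = K + q - q ^ 2 * k

  MN : M * N ≋ h - q
  MN = begin
    M * N ≈⟨ modulo _ Bσ (solve 4 (λ B σ M N → M :* N := (B :* M) :* (σ :* N) :+ :- (M :* N) :* (B :* σ :- :1)) ≋-refl B σ M N) ⟩
    (B * M) * (σ * N) ≈⟨ *-cong BM σN ⟩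
    (K - q) * (1# + q * k) ≈⟨ modulo _ Kk (solve 3 (λ q K k → (K :- q) :* (:1 :+ q :* k) := K :+ q :- q :^ 2 :* k :- q :+ q :* (K :* k :- :1)) ≋-refl q K k) ⟩
    h - q ∎
    where open ≋-Reasoning

  -- As A²B⁴ = K², the product K²M⁵ = (BM)⁴(A²M) consists of factors already known in terms of K.
  -- For N⁵ the roles of A and B are played by ρ and σ.
  M⁵ : M ^ 5 ≋ k ^ 2 * ((K - q) ^ 4 * (K + q))
  M⁵ = begin
    M ^ 5 ≈⟨ modulo _ Kk (solve 5 (λ A B ρ σ M → let K = A :* B :^ 2 ; k = ρ :* σ :^ 2 in
                                            M :^ 5 := k :^ 2 :* ((B :* M) :^ 4 :* (A :^ 2 :* M)) :+ :- (M :^ 5 :* (K :* k :+ :1)) :* (K :* k :- :1)) ≋-refl A B ρ σ M) ⟩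
    k ^ 2 * ((B * M) ^ 4 * (A ^ 2 * M)) ≈⟨ *-congˡ (*-cong (^-cong 4 BM) A²M) ⟩
    k ^ 2 * ((K - q) ^ 4 * (K + q)) ∎
    where open ≋-Reasoning

  N⁵ : N ^ 5 ≋ K ^ 2 * ((1# + q * k) ^ 4 * (1# - q * k))
  N⁵ = begin
    N ^ 5 ≈⟨ modulo _ Kk (solve 5 (λ A B ρ σ N → let K = A :* B :^ 2 ; k = ρ :* σ :^ 2 in
                                            N :^ 5 := K :^ 2 :* ((σ :* N) :^ 4 :* (ρ :^ 2 :* N)) :+ :- (N :^ 5 :* (K :* k :+ :1)) :* (K :* k :- :1)) ≋-refl A B ρ σ N) ⟩
    K ^ 2 * ((σ * N) ^ 4 * (ρ ^ 2 * N)) ≈⟨ *-congˡ (*-cong (^-cong 4 σN) ρ²N) ⟩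
    K ^ 2 * ((1# + q * k) ^ 4 * (1# - q * k)) ∎
    where open ≋-Reasoning

  -- The involution K ↦ -q²/K fixes P = K - q²/K and exchanges M⁵ with qN⁵, so their sum is a
  -- polynomial in P.
  M⁵+qN⁵ : let P = h - q in M ^ 5 + q * N ^ 5 ≋ P ^ 3 - C (+ 2) * q * P ^ 2 + C (+ 8) * q ^ 2 * P
  M⁵+qN⁵ = ≋-trans (+-cong M⁵ (*-congˡ N⁵)) (modulo _ Kk
    (solve 3 (λ q K k → let P = K :+ q :- q :^ 2 :* k :- q in
      k :^ 2 :* ((K :- q) :^ 4 :* (K :+ q)) :+ q :* (K :^ 2 :* ((:1 :+ q :* k) :^ 4 :* (:1 :- q :* k)))
      := P :^ 3 :- con (+ 2) :* q :* P :^ 2 :+ con (+ 8) :* q :^ 2 :* P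
      :+ (con (ℤ.- + 1) :* q :^ 6 :* K :* k :^ 4 :+ con (ℤ.- + 1) :* q :^ 6 :* k :^ 3 :+ con (ℤ.- + 3) :* q :^ 5 :* K :* k :^ 3
        :+ con (ℤ.- + 3) :* q :^ 5 :* k :^ 2 :+ con (ℤ.- + 2) :* q :^ 4 :* K :* k :^ 2 :+ con (ℤ.- + 8) :* q :^ 4 :* k
        :+ con (+ 4) :* q :^ 3 :* K :* k :+ con (+ 2) :* q :^ 2 :* K :^ 2 :* k :+ con (+ 8) :* q :^ 2 :* K
        :+ con (ℤ.- + 3) :* q :* K :^ 3 :* k :+ con (ℤ.- + 3) :* q :* K :^ 2 :+ con (+ 1) :* K :^ 4 :* k :+ con (+ 1) :* K :^ 3)
        :* (K :* k :- :1)) ≋-refl q K k))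

  a b Z b⁴ : Quint Series
  a = ⟨ A , - 1# , - ρ , 0# , 0# ⟩
  b = ⟨ B , 0# , - 1# , 0# , - σ ⟩
  Z = ⟨ M , N , 0# , 1# , 0# ⟩
  b⁴ = b ⊠ b ⊠ (b ⊠ b)

  -- The components of a², ab², b⁴, b⁴Z and b⁴Z² singled out from here on are those that U selects
  -- in F uᵏ for k = 1, ..., 5. Up to a power of h(q⁵), F uᵏ equals q^(2k+1) Ẽ²ψ̃^(k-1), so U reads
  -- the component whose residue is -(2k+1) modulo 5. The relation b² = aZ trades equal powers of a
  -- and Z for b.
  a²-c₂ : c₂ (a ⊠ a) ≋ - 1#
  a²-c₂ = modulo _ Aρ (solve 3 (λ q A ρ → let α = ⟨ A , :- :1 , :- ρ , con 0ℤ , con 0ℤ ⟩ in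
    c₂ (multiply _:+_ _:*_ q α α) := :- :1 :+ con (ℤ.- + 2) :* (A :* ρ :- :1)) ≋-refl q A ρ)

  ab²-c₀ : c₀ (a ⊠ (b ⊠ b)) ≋ h
  ab²-c₀ = modulo _ Bσ (solve 5 (λ q A ρ B σ →
    let α = ⟨ A , :- :1 , :- ρ , con 0ℤ , con 0ℤ ⟩ ; β = ⟨ B , con 0ℤ , :- :1 , con 0ℤ , :- σ ⟩ in
    c₀ (multiply _:+_ _:*_ q α (multiply _:+_ _:*_ q β β))
    := A :* B :^ 2 :+ q :- q :^ 2 :* (ρ :* σ :^ 2) :+ con (+ 2) :* q :* (B :* σ :- :1)) ≋-refl q A ρ B σ)

  b²-formula : b ⊠ b ≋₅ ⟨ B ^ 2 , C (+ 2) * q * σ , C (ℤ.- + 2) * B , q * σ ^ 2 , - 1# ⟩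
  b²-formula = ≋⟨ solve 3 (λ q B σ → c₀ (β² q B σ) := B :^ 2) ≋-refl q B σ
    , solve 3 (λ q B σ → c₁ (β² q B σ) := con (+ 2) :* q :* σ) ≋-refl q B σ
    , solve 3 (λ q B σ → c₂ (β² q B σ) := con (ℤ.- + 2) :* B) ≋-refl q B σ
    , solve 3 (λ q B σ → c₃ (β² q B σ) := q :* σ :^ 2) ≋-refl q B σ
    , modulo _ Bσ (solve 3 (λ q B σ → c₄ (β² q B σ) := :- :1 :+ con (ℤ.- + 2) :* (B :* σ :- :1)) ≋-refl q B σ) ⟩
    where
    β² : (q B σ : Polynomial 3) → Quint (Polynomial 3)
    β² q B σ = multiply _:+_ _:*_ q ⟨ B , con 0ℤ , :- :1 , con 0ℤ , :- σ ⟩ ⟨ B , con 0ℤ , :- :1 , con 0ℤ , :- σ ⟩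

  β₀ β₁ β₂ β₃ β₄ : Series
  β₀ = B ^ 4 - C (+ 8) * q ^ 2 * σ
  β₁ = C (+ 8) * q * B + q ^ 3 * σ ^ 4
  β₂ = C (+ 2) * q ^ 2 * σ ^ 2 - C (+ 4) * B ^ 3
  β₃ = C (ℤ.- + 5) * q
  β₄ = C (+ 2) * B ^ 2 + C (+ 4) * q ^ 2 * σ ^ 3

  b⁴-formula : b⁴ ≋₅ ⟨ β₀ , β₁ , β₂ , β₃ , β₄ ⟩
  b⁴-formula = ≋₅-trans (⊠-cong b²-formula b²-formula)
    ≋⟨ modulo _ Bσ (solve 3 (λ q B σ → c₀ (β⁴ q B σ) := B :^ 4 :- con (+ 8) :* q :^ 2 :* σ :+ con (ℤ.- + 4) :* q :^ 2 :* σ :* (B :* σ :- :1)) ≋-refl q B σ)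
    , modulo _ Bσ (solve 3 (λ q B σ → c₁ (β⁴ q B σ) := con (+ 8) :* q :* B :+ q :^ 3 :* σ :^ 4 :+ con (+ 4) :* q :* B :* (B :* σ :- :1)) ≋-refl q B σ)
    , solve 3 (λ q B σ → c₂ (β⁴ q B σ) := con (+ 2) :* q :^ 2 :* σ :^ 2 :- con (+ 4) :* B :^ 3) ≋-refl q B σ
    , modulo _ Bσ (solve 3 (λ q B σ → c₃ (β⁴ q B σ) := con (ℤ.- + 5) :* q :+ q :* (con (+ 2) :* B :* σ :- con (+ 6)) :* (B :* σ :- :1)) ≋-refl q B σ)
    , solve 3 (λ q B σ → c₄ (β⁴ q B σ) := con (+ 2) :* B :^ 2 :+ con (+ 4) :* q :^ 2 :* σ :^ 3) ≋-refl q B σ ⟩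
    where
    β⁴ : (q B σ : Polynomial 3) → Quint (Polynomial 3)
    β⁴ q B σ = multiply _:+_ _:*_ q β² β²
      where β² = ⟨ B :^ 2 , con (+ 2) :* q :* σ , con (ℤ.- + 2) :* B , q :* σ :^ 2 , :- :1 ⟩

  b⁴-c₃ : c₃ b⁴ ≋ C (ℤ.- + 5) * q
  b⁴-c₃ = e₃ b⁴-formula

  private
    -- The part shared by the last two components. Each product is grouped so that it becomes one of
    -- the known expressions in K.
    β₀N+β₁M : β₀ * N + β₁ * M ≋ K ^ 2 * (1# - q * k) - C (+ 8) * q ^ 2 * (1# + q * k) + (C (+ 8) * q * (K - q) + q ^ 3 * (k ^ 2 * (K + q)))
    β₀N+β₁M = begin
      β₀ * N + β₁ * M
        ≈⟨ solve 5 (λ q B σ M N → (B :^ 4 :- con (+ 8) :* q :^ 2 :* σ) :* N :+ (con (+ 8) :* q :* B :+ q :^ 3 :* σ :^ 4) :* M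
             := B :^ 4 :* N :- con (+ 8) :* q :^ 2 :* (σ :* N) :+ (con (+ 8) :* q :* (B :* M) :+ q :^ 3 :* (σ :^ 4 :* M))) ≋-refl q B σ M N ⟩
      B ^ 4 * N - C (+ 8) * q ^ 2 * (σ * N) + (C (+ 8) * q * (B * M) + q ^ 3 * (σ ^ 4 * M))
        ≈⟨ +-cong (+-cong B⁴N (-‿cong (*-congˡ σN))) (+-cong (*-congˡ BM) (*-congˡ σ⁴M)) ⟩
      _ ∎
      where open ≋-Reasoning

  b⁴Z-c₁ : c₁ (b⁴ ⊠ Z) ≋ h ^ 2 + C (+ 5) * q * h - C (+ 25) * q ^ 2
  b⁴Z-c₁ = begin
    c₁ (b⁴ ⊠ Z)
      ≈⟨ e₁ (⊠-cong b⁴-formula ≋₅-refl) ⟩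
    c₁ (⟨ β₀ , β₁ , β₂ , β₃ , β₄ ⟩ ⊠ Z)
      ≈⟨ solve 7 (λ q β₀ β₁ β₂ β₄ M N → c₁ (multiply _:+_ _:*_ q ⟨ β₀ , β₁ , β₂ , con (ℤ.- + 5) :* q , β₄ ⟩ ⟨ M , N , con 0ℤ , :1 , con 0ℤ ⟩)
           := β₀ :* N :+ β₁ :* M :- con (+ 5) :* q :^ 2) ≋-refl q β₀ β₁ β₂ β₄ M N ⟩
    β₀ * N + β₁ * M - C (+ 5) * q ^ 2
      ≈⟨ +-cong β₀N+β₁M ≋-refl ⟩
    _
      ≈⟨ modulo _ Kk (solve 3 (λ q K k → let h = K :+ q :- q :^ 2 :* k in
           K :^ 2 :* (:1 :- q :* k) :- con (+ 8) :* q :^ 2 :* (:1 :+ q :* k) :+ (con (+ 8) :* q :* (K :- q) :+ q :^ 3 :* (k :^ 2 :* (K :+ q))) :- con (+ 5) :* q :^ 2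
           := h :^ 2 :+ con (+ 5) :* q :* h :- con (+ 25) :* q :^ 2
           :+ (q :^ 3 :* k :+ con (+ 2) :* q :^ 2 :- q :* K) :* (K :* k :- :1)) ≋-refl q K k) ⟩
    h ^ 2 + C (+ 5) * q * h - C (+ 25) * q ^ 2 ∎
    where open ≋-Reasoning

  b⁴Z²-c₄ : c₄ (b⁴ ⊠ (Z ⊠ Z)) ≋ C (ℤ.- + 25) * q ^ 2
  b⁴Z²-c₄ = begin
    c₄ (b⁴ ⊠ (Z ⊠ Z))
      ≈⟨ e₄ (⊠-cong b⁴-formula ≋₅-refl) ⟩
    c₄ (⟨ β₀ , β₁ , β₂ , β₃ , β₄ ⟩ ⊠ (Z ⊠ Z))
      ≈⟨ solve 7 (λ q β₀ β₁ β₂ β₄ M N → let Z = ⟨ M , N , con 0ℤ , :1 , con 0ℤ ⟩ in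
           c₄ (multiply _:+_ _:*_ q ⟨ β₀ , β₁ , β₂ , con (ℤ.- + 5) :* q , β₄ ⟩ (multiply _:+_ _:*_ q Z Z))
           := con (+ 2) :* (β₀ :* N :+ β₁ :* M) :+ (β₂ :* N :^ 2 :+ β₄ :* M :^ 2) :- con (+ 5) :* q :* (con (+ 2) :* (M :* N) :+ q)) ≋-refl q β₀ β₁ β₂ β₄ M N ⟩
    C (+ 2) * (β₀ * N + β₁ * M) + (β₂ * N ^ 2 + β₄ * M ^ 2) - C (+ 5) * q * (C (+ 2) * (M * N) + q)
      ≈⟨ +-cong (+-cong (*-congˡ β₀N+β₁M) squares) (-‿cong (*-congˡ (+-cong (*-congˡ MN) ≋-refl))) ⟩
    _
      ≈⟨ modulo _ Kk (solve 3 (λ q K k →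
           con (+ 2) :* (K :^ 2 :* (:1 :- q :* k) :- con (+ 8) :* q :^ 2 :* (:1 :+ q :* k) :+ (con (+ 8) :* q :* (K :- q) :+ q :^ 3 :* (k :^ 2 :* (K :+ q))))
           :+ (con (+ 2) :* q :^ 2 :* (:1 :+ q :* k) :^ 2 :- con (+ 4) :* (K :^ 2 :* (:1 :- q :* k) :* (:1 :+ q :* k))
             :+ (con (+ 2) :* (K :- q) :^ 2 :+ con (+ 4) :* q :^ 2 :* (k :^ 2 :* (K :+ q) :* (K :- q))))
           :- con (+ 5) :* q :* (con (+ 2) :* (K :+ q :- q :^ 2 :* k :- q) :+ q)
           := con (ℤ.- + 25) :* q :^ 2
           :+ (con (+ 2) :* q :^ 3 :* k :+ con (+ 8) :* q :^ 2 :* K :* k :+ con (+ 8) :* q :^ 2 :- con (+ 2) :* q :* K) :* (K :* k :- :1)) ≋-refl q K k) ⟩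
    C (ℤ.- + 25) * q ^ 2 ∎
    where
    open ≋-Reasoning
    squares : β₂ * N ^ 2 + β₄ * M ^ 2 ≋
      C (+ 2) * q ^ 2 * (1# + q * k) ^ 2 - C (+ 4) * (K ^ 2 * (1# - q * k) * (1# + q * k))
        + (C (+ 2) * (K - q) ^ 2 + C (+ 4) * q ^ 2 * (k ^ 2 * (K + q) * (K - q)))
    squares = begin
      β₂ * N ^ 2 + β₄ * M ^ 2
        ≈⟨ modulo _ Bσ (solve 5 (λ q B σ M N →
             (con (+ 2) :* q :^ 2 :* σ :^ 2 :- con (+ 4) :* B :^ 3) :* N :^ 2 :+ (con (+ 2) :* B :^ 2 :+ con (+ 4) :* q :^ 2 :* σ :^ 3) :* M :^ 2
             := con (+ 2) :* q :^ 2 :* (σ :* N) :^ 2 :- con (+ 4) :* (B :^ 4 :* N :* (σ :* N))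
               :+ (con (+ 2) :* (B :* M) :^ 2 :+ con (+ 4) :* q :^ 2 :* (σ :^ 4 :* M :* (B :* M)))
               :+ (con (+ 4) :* B :^ 3 :* N :^ 2 :- con (+ 4) :* q :^ 2 :* σ :^ 3 :* M :^ 2) :* (B :* σ :- :1)) ≋-refl q B σ M N) ⟩
      C (+ 2) * q ^ 2 * (σ * N) ^ 2 - C (+ 4) * (B ^ 4 * N * (σ * N)) + (C (+ 2) * (B * M) ^ 2 + C (+ 4) * q ^ 2 * (σ ^ 4 * M * (B * M)))
        ≈⟨ +-cong (+-cong (*-congˡ (^-cong 2 σN)) (-‿cong (*-congˡ (*-cong B⁴N σN))))
             (+-cong (*-congˡ (^-cong 2 BM)) (*-congˡ (*-cong σ⁴M BM))) ⟩
      _ ∎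

-- The 5-dissections of F and G

D-scale : ∀ c t → D ⟨ c * c₀ t , c * c₁ t , c * c₂ t , c * c₃ t , c * c₄ t ⟩ ≋ S 5 c * D t
D-scale c ⟨ t₀ , t₁ , t₂ , t₃ , t₄ ⟩ = ≋-trans
  (+-cong (S-* 5 c t₀) (*-congˡ (+-cong (S-* 5 c t₁) (*-congˡ (+-cong (S-* 5 c t₂)
    (*-congˡ (+-cong (S-* 5 c t₃) (*-congˡ (S-* 5 c t₄)))))))))
  (solve 7 (λ q c t₀ t₁ t₂ t₃ t₄ → c :* t₀ :+ q :* (c :* t₁ :+ q :* (c :* t₂ :+ q :* (c :* t₃ :+ q :* (c :* t₄))))
    := c :* (t₀ :+ q :* (t₁ :+ q :* (t₂ :+ q :* (t₃ :+ q :* t₄))))) ≋-refl q (S 5 c) (S 5 t₀) (S 5 t₁) (S 5 t₂) (S 5 t₃) (S 5 t₄))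
  where open Solver

D-shift : ∀ t → q * D t ≋ D ⟨ q * c₄ t , c₀ t , c₁ t , c₂ t , c₃ t ⟩
D-shift ⟨ t₀ , t₁ , t₂ , t₃ , t₄ ⟩ = ≋-sym (≋-trans
  (+-cong (≋-trans (S-* 5 q t₄) (*-cong S₅q ≋-refl)) ≋-refl)
  (solve 6 (λ q t₀ t₁ t₂ t₃ t₄ → q :^ 5 :* t₄ :+ q :* (t₀ :+ q :* (t₁ :+ q :* (t₂ :+ q :* t₃)))
    := q :* (t₀ :+ q :* (t₁ :+ q :* (t₂ :+ q :* (t₃ :+ q :* t₄))))) ≋-refl q (S 5 t₀) (S 5 t₁) (S 5 t₂) (S 5 t₃) (S 5 t₄)))
  where open Solver

*-reciprocal : ∀ e f → e 0 ≡ 1ℤ → e * (f * reciprocal e) ≋ f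
*-reciprocal e f e₀ = begin
  e * (f * reciprocal e) ≈⟨ solve 3 (λ e f r → e :* (f :* r) := (e :* r) :* f) ≋-refl e f (reciprocal e) ⟩
  e * reciprocal e * f ≈⟨ *-cong (reciprocal-* e e₀) ≋-refl ⟩
  1# * f ≈⟨ *-identityˡ f ⟩
  f ∎
  where
  open ≋-Reasoning
  open Solver

E₅ ψ₅ : Series
E₅ = S 5 (E 1)
ψ₅ = S 5 ψ

ψ-at-0 : ψ 0 ≡ 1ℤ
ψ-at-0 = *-at-0≡1 (E 2 ^ 2) (reciprocal (E 1)) (^-at-0≡1 (E 2) 2 refl) refl

-- The components of E and ψ are divided by the one which up to sign reproduces the series itself,
-- in residue 1 (`V₁E`) and residue 3 (`V₃ψ`). This turns those two components into -1 and 1.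
A ρ B σ M N : Series
A = V 0 (E 1) * reciprocal E₅
ρ = - (V 2 (E 1) * reciprocal E₅)
B = S 2 A
σ = S 2 ρ
M = V 0 ψ * reciprocal ψ₅
N = V 1 ψ * reciprocal ψ₅

Ẽ Ẽ₂ ψ̃ : Series
Ẽ  = D ⟨ A , - 1# , - ρ , 0# , 0# ⟩
Ẽ₂ = D ⟨ B , 0# , - 1# , 0# , - σ ⟩
ψ̃  = D ⟨ M , N , 0# , 1# , 0# ⟩

E-dissection : E 1 ≋ S 5 E₅ * Ẽ
E-dissection = begin
  E 1 ≈⟨ D-dissection (E 1) ⟩
  D (dissection (E 1)) ≈⟨ D-cong ≋⟨ ≋-sym (*-reciprocal E₅ (V 0 (E 1)) refl)
                                  , ≋-trans V₁E (solve 1 (λ x → :- x := x :* :- :1) ≋-refl E₅)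
                                  , ≋-trans (≋-sym (*-reciprocal E₅ (V 2 (E 1)) refl)) (solve 2 (λ x y → x :* y := x :* :- (:- y)) ≋-refl E₅ (V 2 (E 1) * reciprocal E₅))
                                  , ≋-trans V₃E (≋-sym (zeroʳ E₅))
                                  , ≋-trans V₄E (≋-sym (zeroʳ E₅)) ⟩ ⟩
  _ ≈⟨ D-scale E₅ ⟨ A , - 1# , - ρ , 0# , 0# ⟩ ⟩
  S 5 E₅ * Ẽ ∎
  where
  open ≋-Reasoning
  open Solver

ψ-dissection : ψ ≋ S 5 ψ₅ * ψ̃
ψ-dissection = begin
  ψ ≈⟨ D-dissection ψ ⟩
  D (dissection ψ) ≈⟨ D-cong ≋⟨ ≋-sym (*-reciprocal ψ₅ (V 0 ψ) ψ-at-0)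
                                  , ≋-sym (*-reciprocal ψ₅ (V 1 ψ) ψ-at-0)
                                  , ≋-trans V₂ψ (≋-sym (zeroʳ ψ₅))
                                  , ≋-trans V₃ψ (≋-sym (*-identityʳ ψ₅))
                                  , ≋-trans V₄ψ (≋-sym (zeroʳ ψ₅)) ⟩ ⟩
  _ ≈⟨ D-scale ψ₅ ⟨ M , N , 0# , 1# , 0# ⟩ ⟩
  S 5 ψ₅ * ψ̃ ∎
  where open ≋-Reasoning

S₂-D : ∀ t → S 2 (D t) ≋ S 5 (S 2 (c₀ t)) + q ^ 2 * (S 5 (S 2 (c₁ t)) + q ^ 2 * (S 5 (S 2 (c₂ t)) + q ^ 2 * (S 5 (S 2 (c₃ t)) + q ^ 2 * S 5 (S 2 (c₄ t)))))
S₂-D ⟨ t₀ , t₁ , t₂ , t₃ , t₄ ⟩ = hom t₀ (hom t₁ (hom t₂ (hom t₃ (S₂S₅ t₄))))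
  where
  hom : ∀ t {f g} → S 2 f ≋ g → S 2 (S 5 t + q * f) ≋ S 5 (S 2 t) + q ^ 2 * g
  hom t {f} p = ≋-trans (S-+ 2 (S 5 t) (q * f)) (+-cong (S₂S₅ t)
    (≋-trans (S-* 2 q f) (*-cong (≋-trans (S-q^ 2 1) (q^≋q^ 2)) p)))

E₂-dissection : S 2 (E 1) ≋ S 5 (S 2 E₅) * Ẽ₂
E₂-dissection = begin
  S 2 (E 1) ≈⟨ S-cong 2 E-dissection ⟩
  S 2 (S 5 E₅ * Ẽ) ≈⟨ S-* 2 (S 5 E₅) Ẽ ⟩
  S 2 (S 5 E₅) * S 2 Ẽ ≈⟨ *-cong (S₂S₅ E₅) (S₂-D ⟨ A , - 1# , - ρ , 0# , 0# ⟩) ⟩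
  S 5 (S 2 E₅) * _ ≈⟨ *-congˡ (+-congˡ (*-congˡ (+-cong minus-one (*-congˡ (+-cong (S-cong 5 (S-neg 2 ρ)) (*-congˡ (+-cong nought (*-congˡ nought)))))))) ⟩
  S 5 (S 2 E₅) * (S 5 B + q ^ 2 * (S 5 (- 1#) + q ^ 2 * (S 5 (- σ) + q ^ 2 * (0# + q ^ 2 * 0#))))
    ≈⟨ *-congˡ (solve 4 (λ q b x y → b :+ q :^ 2 :* (x :+ q :^ 2 :* (y :+ q :^ 2 :* (con 0ℤ :+ q :^ 2 :* con 0ℤ)))
         := b :+ q :* (con 0ℤ :+ q :* (x :+ q :* (con 0ℤ :+ q :* y)))) ≋-refl q (S 5 B) (S 5 (- 1#)) (S 5 (- σ))) ⟩
  S 5 (S 2 E₅) * (S 5 B + q * (0# + q * (S 5 (- 1#) + q * (0# + q * S 5 (- σ)))))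
    ≈⟨ *-congˡ (+-congˡ (*-congˡ (+-cong (≋-sym (S-C 5 0ℤ)) (*-congˡ (+-congˡ (*-congˡ (+-cong (≋-sym (S-C 5 0ℤ)) ≋-refl))))))) ⟩
  S 5 (S 2 E₅) * Ẽ₂ ∎
  where
  open ≋-Reasoning
  open Solver
  nought : S 5 (S 2 0#) ≋ 0#
  nought = ≋-trans (S-cong 5 (S-C 2 0ℤ)) (S-C 5 0ℤ)
  minus-one : S 5 (S 2 (- 1#)) ≋ S 5 (- 1#)
  minus-one = S-cong 5 (≋-trans (S-neg 2 1#) (-‿cong (S-1# 2)))

E₂²≋E₁ψ : S 2 (E 1) ^ 2 ≋ E 1 * ψ
E₂²≋E₁ψ = ≋-trans (^-cong 2 (≋-sym (E≋S 2))) ψ-E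

S-^ : ∀ m .{{_ : NonZero m}} f k → S m (f ^ k) ≋ S m f ^ k
S-^ m f zero    = S-1# m
S-^ m f (suc k) = ≋-trans (S-* m f (f ^ k)) (*-congˡ (S-^ m f k))

E₁₀²≋E₅ψ₅ : S 2 E₅ ^ 2 ≋ E₅ * ψ₅
E₁₀²≋E₅ψ₅ = begin
  S 2 E₅ ^ 2 ≈⟨ ^-cong 2 (S₂S₅ (E 1)) ⟩
  S 5 (S 2 (E 1)) ^ 2 ≈⟨ ≋-sym (S-^ 5 (S 2 (E 1)) 2) ⟩
  S 5 (S 2 (E 1) ^ 2) ≈⟨ S-cong 5 E₂²≋E₁ψ ⟩
  S 5 (E 1 * ψ) ≈⟨ S-* 5 (E 1) ψ ⟩
  E₅ * ψ₅ ∎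
  where open ≋-Reasoning

-- The identity E(q²)² = E(q)ψ(q), divided by its own image under q ↦ q²⁵.
Ẽ₂²≋Ẽψ̃ : Ẽ₂ * Ẽ₂ ≋ Ẽ * ψ̃
Ẽ₂²≋Ẽψ̃ = unit-cancel (S 5 (E₅ * ψ₅)) _ (reciprocal-* (S 5 (E₅ * ψ₅)) (*-at-0≡1 E₅ ψ₅ refl ψ-at-0)) (begin
  S 5 (E₅ * ψ₅) * (Ẽ₂ * Ẽ₂) ≈⟨ *-cong (S-cong 5 (≋-sym E₁₀²≋E₅ψ₅)) ≋-refl ⟩
  S 5 (S 2 E₅ ^ 2) * (Ẽ₂ * Ẽ₂) ≈⟨ *-cong (S-^ 5 (S 2 E₅) 2) ≋-refl ⟩
  S 5 (S 2 E₅) ^ 2 * (Ẽ₂ * Ẽ₂) ≈⟨ solve 2 (λ x y → x :^ 2 :* (y :* y) := (x :* y) :^ 2) ≋-refl (S 5 (S 2 E₅)) Ẽ₂ ⟩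
  (S 5 (S 2 E₅) * Ẽ₂) ^ 2 ≈⟨ ^-cong 2 (≋-sym E₂-dissection) ⟩
  S 2 (E 1) ^ 2 ≈⟨ E₂²≋E₁ψ ⟩
  E 1 * ψ ≈⟨ *-cong E-dissection ψ-dissection ⟩
  S 5 E₅ * Ẽ * (S 5 ψ₅ * ψ̃) ≈⟨ solve 4 (λ x y z w → x :* y :* (z :* w) := x :* z :* (y :* w)) ≋-refl (S 5 E₅) Ẽ (S 5 ψ₅) ψ̃ ⟩
  S 5 E₅ * S 5 ψ₅ * (Ẽ * ψ̃) ≈⟨ *-cong (≋-sym (S-* 5 E₅ ψ₅)) ≋-refl ⟩
  S 5 (E₅ * ψ₅) * (Ẽ * ψ̃) ∎)
  where
  open ≋-Reasoning
  open Solver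

open Level10 A ρ B σ M N
  (D-injective (≋-trans (D-⊠ _ _) (≋-trans Ẽ₂²≋Ẽψ̃ (≋-sym (D-⊠ _ _)))))
  (λ Bσ → S-injective 2 (≋-trans (S-* 2 A ρ) (≋-trans Bσ (≋-sym (S-1# 2)))))
  public

V-S : ∀ i c f → i ℕ.< 5 → V i (S 5 c * f) ≋ c * V i f
V-S i c f i<5 = select i i<5 (≋₅-trans (dissection-cong (≋-trans (*-congˡ (D-dissection f)) (≋-sym (D-scale c (dissection f)))))
  (D-coefficients ⟨ c * V 0 f , c * V 1 f , c * V 2 f , c * V 3 f , c * V 4 f ⟩))
  where
  select : ∀ i → i ℕ.< 5 → dissection (S 5 c * f) ≋₅ ⟨ c * V 0 f , c * V 1 f , c * V 2 f , c * V 3 f , c * V 4 f ⟩ →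
           V i (S 5 c * f) ≋ c * V i f
  select 0 _ p = e₀ p
  select 1 _ p = e₁ p
  select 2 _ p = e₂ p
  select 3 _ p = e₃ p
  select 4 _ p = e₄ p
  select (suc (suc (suc (suc (suc i))))) (ℕ.s≤s (ℕ.s≤s (ℕ.s≤s (ℕ.s≤s (ℕ.s≤s ())))))

-- The residue 1 component of ψ² is ψ₅²(2MN + q) with MN = h - q. Adding qψ₅² as in the Hecke
-- relation gives 2hψ₅², to be compared with 2ψ².
hψ₅² : h * ψ₅ ^ 2 ≋ ψ ^ 2
hψ₅² = ≋-sym (C-cancel (+ 2) (begin
  C (+ 2) * ψ ^ 2 ≈⟨ *-congˡ (solve 1 (λ x → x :^ 2 := x :* x) ≋-refl ψ) ⟩
  C (+ 2) * (ψ * ψ) ≈⟨ ≋-sym Hecke.theorem ⟩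
  V 1 (ψ * ψ) + q * S 5 (ψ * ψ) ≈⟨ +-cong V₁ψ² (*-congˡ (S-* 5 ψ ψ)) ⟩
  ψ₅ ^ 2 * (C (+ 2) * (M * N) + q) + q * (ψ₅ * ψ₅)
    ≈⟨ +-cong (*-congˡ (+-cong (*-congˡ MN) ≋-refl)) ≋-refl ⟩
  ψ₅ ^ 2 * (C (+ 2) * (h - q) + q) + q * (ψ₅ * ψ₅)
    ≈⟨ solve 3 (λ q x h → x :^ 2 :* (con (+ 2) :* (h :- q) :+ q) :+ q :* (x :* x) := con (+ 2) :* (h :* x :^ 2)) ≋-refl q ψ₅ h ⟩
  C (+ 2) * (h * ψ₅ ^ 2) ∎))
  where
  open ≋-Reasoning
  open Solver
  V₁ψ² : V 1 (ψ * ψ) ≋ ψ₅ ^ 2 * (C (+ 2) * (M * N) + q)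
  V₁ψ² = begin
    V 1 (ψ * ψ) ≈⟨ V-cong 1 (*-cong ψ-dissection ψ-dissection) ⟩
    V 1 (S 5 ψ₅ * ψ̃ * (S 5 ψ₅ * ψ̃)) ≈⟨ V-cong 1 (solve 2 (λ x y → x :* y :* (x :* y) := x :^ 2 :* (y :* y)) ≋-refl (S 5 ψ₅) ψ̃) ⟩
    V 1 (S 5 ψ₅ ^ 2 * (ψ̃ * ψ̃)) ≈⟨ V-cong 1 (*-cong (≋-sym (S-^ 5 ψ₅ 2)) (≋-sym (D-⊠ Z Z))) ⟩
    V 1 (S 5 (ψ₅ ^ 2) * D (Z ⊠ Z)) ≈⟨ V-S 1 (ψ₅ ^ 2) (D (Z ⊠ Z)) (ℕ.m≤m+n 2 3) ⟩
    ψ₅ ^ 2 * V 1 (D (Z ⊠ Z)) ≈⟨ *-congˡ (e₁ (D-coefficients (Z ⊠ Z))) ⟩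
    ψ₅ ^ 2 * c₁ (Z ⊠ Z) ≈⟨ *-congˡ (solve 3 (λ q M N → let Z = ⟨ M , N , con 0ℤ , :1 , con 0ℤ ⟩ in
                                               c₁ (multiply _:+_ _:*_ q Z Z) := con (+ 2) :* (M :* N) :+ q) ≋-refl q M N) ⟩
    ψ₅ ^ 2 * (C (+ 2) * (M * N) + q) ∎

ψ₅²-at-0 : (ψ₅ ^ 2) 0 ≡ 1ℤ
ψ₅²-at-0 = ^-at-0≡1 ψ₅ 2 ψ-at-0

h-at-0 : h 0 ≡ 1ℤ
h-at-0 = begin
  h 0 ≡⟨ sym (ℤ.*-identityʳ (h 0)) ⟩
  h 0 ℤ.* 1ℤ ≡⟨ cong (h 0 ℤ.*_) (sym ψ₅²-at-0) ⟩
  h 0 ℤ.* (ψ₅ ^ 2) 0 ≡⟨ sym (*-at-0 h (ψ₅ ^ 2)) ⟩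
  (h * ψ₅ ^ 2) 0 ≡⟨ at hψ₅² 0 ⟩
  (ψ ^ 2) 0 ≡⟨ ^-at-0≡1 ψ 2 ψ-at-0 ⟩
  1ℤ ∎
  where open ≡-Reasoning

h⁻¹ : Series
h⁻¹ = reciprocal h

hh⁻¹ : h * h⁻¹ ≋ 1#
hh⁻¹ = reciprocal-* h h-at-0

⊛≋* : ∀ {f g f′ g′} → f ≋ f′ → g ≋ g′ → f ⊛ g ≋ f′ * g′
⊛≋* {f} {g} p r = ≋-trans (pointwise λ n → cong (λ x → x n) (sym (*≡⊛ f g))) (*-cong p r)

⊛^≋^ : ∀ f k → f ⊛^ k ≋ f ^ k
⊛^≋^ f zero    = ≋-refl
⊛^≋^ f (suc k) = ⊛≋* {f} {f ⊛^ k} ≋-refl (⊛^≋^ f k)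

quotient-cleared : ∀ x n d {n′ d′} → d 0 ≡ 1ℤ → n ≋ n′ → d ≋ d′ → (x ⊛ (n ⊘ d)) * d′ ≋ x * n′
quotient-cleared x n d {n′} {d′} d₀ n≋ d≋ = begin
  (x ⊛ (n ⊘ d)) * d′ ≈⟨ *-cong (⊛≋* {x} {n ⊘ d} ≋-refl (⊛≋* {n} {reciprocal d} n≋ ≋-refl)) (≋-sym d≋) ⟩
  x * (n′ * reciprocal d) * d ≈⟨ solve 4 (λ x n r d → x :* (n :* r) :* d := x :* (d :* (n :* r))) ≋-refl x n′ (reciprocal d) d ⟩
  x * (d * (n′ * reciprocal d)) ≈⟨ *-congˡ (*-reciprocal d n′ d₀) ⟩
  x * n′ ∎
  where
  open ≋-Reasoning
  open Solver

E₁₀ : E 10 ≋ S 2 E₅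
E₁₀ = ≋-trans (E≋S 10) (S-∘ 2 5 (E 1))

G-cleared : G * (S 2 (E 1) ^ 4 * E₅ ^ 2) ≋ q * (E 1 ^ 2 * S 2 E₅ ^ 4)
G-cleared = quotient-cleared q (E 1 ⊛^ 2 ⊛ E 10 ⊛^ 4) (E 2 ⊛^ 4 ⊛ E 5 ⊛^ 2) G-denominator
  (⊛≋* {E 1 ⊛^ 2} {E 10 ⊛^ 4} (⊛^≋^ (E 1) 2) (≋-trans (⊛^≋^ (E 10) 4) (^-cong 4 E₁₀)))
  (⊛≋* {E 2 ⊛^ 4} {E 5 ⊛^ 2} (≋-trans (⊛^≋^ (E 2) 4) (^-cong 4 (E≋S 2))) (≋-trans (⊛^≋^ (E 5) 2) (^-cong 2 (E≋S 5))))

Gh : G * h ≋ q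
Gh = unit-cancel d _ (reciprocal-* d (*-at-0≡1 (E 1 ^ 2) (S 2 E₅ ^ 4) (^-at-0≡1 (E 1) 2 refl) (^-at-0≡1 (S 2 E₅) 4 refl))) (begin
  d * (G * h) ≈⟨ solve 4 (λ e f g h → e :^ 2 :* f :^ 4 :* (g :* h) := g :* (e :^ 2 :* h :* (f :^ 2) :^ 2)) ≋-refl (E 1) (S 2 E₅) G h ⟩
  G * (E 1 ^ 2 * h * (S 2 E₅ ^ 2) ^ 2) ≈⟨ *-congˡ (*-congˡ (^-cong 2 E₁₀²≋E₅ψ₅)) ⟩
  G * (E 1 ^ 2 * h * (E₅ * ψ₅) ^ 2) ≈⟨ solve 5 (λ e h f p g → g :* (e :^ 2 :* h :* (f :* p) :^ 2) := g :* (e :^ 2 :* (h :* p :^ 2) :* f :^ 2)) ≋-refl (E 1) h E₅ ψ₅ G ⟩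
  G * (E 1 ^ 2 * (h * ψ₅ ^ 2) * E₅ ^ 2) ≈⟨ *-congˡ (*-cong (*-congˡ hψ₅²) ≋-refl) ⟩
  G * (E 1 ^ 2 * ψ ^ 2 * E₅ ^ 2) ≈⟨ solve 4 (λ e p f g → g :* (e :^ 2 :* p :^ 2 :* f :^ 2) := g :* ((e :* p) :^ 2 :* f :^ 2)) ≋-refl (E 1) ψ E₅ G ⟩
  G * ((E 1 * ψ) ^ 2 * E₅ ^ 2) ≈⟨ *-congˡ (*-cong (^-cong 2 (≋-sym E₂²≋E₁ψ)) ≋-refl) ⟩
  G * ((S 2 (E 1) ^ 2) ^ 2 * E₅ ^ 2) ≈⟨ *-congˡ (*-cong (solve 1 (λ x → (x :^ 2) :^ 2 := x :^ 4) ≋-refl (S 2 (E 1))) ≋-refl) ⟩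
  G * (S 2 (E 1) ^ 4 * E₅ ^ 2) ≈⟨ G-cleared ⟩
  q * d ≈⟨ *-comm q d ⟩
  d * q ∎)
  where
  open ≋-Reasoning
  open Solver
  d : Series
  d = E 1 ^ 2 * S 2 E₅ ^ 4

G≋qh⁻¹ : G ≋ q * h⁻¹
G≋qh⁻¹ = modulo₂ _ _ Gh hh⁻¹
  (solve 4 (λ q G h h⁻¹ → G := q :* h⁻¹ :+ h⁻¹ :* (G :* h :- q) :+ :- G :* (h :* h⁻¹ :- :1)) ≋-refl q G h h⁻¹)
  where open Solver

Ẽ-at-0 : Ẽ 0 ≡ 1ℤ
Ẽ-at-0 = begin
  Ẽ 0 ≡⟨ sym (ℤ.*-identityˡ (Ẽ 0)) ⟩
  1ℤ ℤ.* Ẽ 0 ≡⟨ sym (*-at-0 (S 5 E₅) Ẽ) ⟩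
  (S 5 E₅ * Ẽ) 0 ≡⟨ sym (at E-dissection 0) ⟩
  E 1 0 ≡⟨⟩
  1ℤ ∎
  where open ≡-Reasoning

F-cleared : F * (S 2 (E 1) ^ 2 * S 5 E₅ ^ 3) ≋ q * (E 1 ^ 3 * S 5 (S 2 E₅) ^ 2)
F-cleared = quotient-cleared q (E 1 ⊛^ 3 ⊛ E 50 ⊛^ 2) (E 2 ⊛^ 2 ⊛ E 25 ⊛^ 3) F-denominator
  (⊛≋* {E 1 ⊛^ 3} {E 50 ⊛^ 2} (⊛^≋^ (E 1) 3) (≋-trans (⊛^≋^ (E 50) 2) (^-cong 2 E₅₀)))
  (⊛≋* {E 2 ⊛^ 2} {E 25 ⊛^ 3} (≋-trans (⊛^≋^ (E 2) 2) (^-cong 2 (E≋S 2))) (≋-trans (⊛^≋^ (E 25) 3) (^-cong 3 E₂₅)))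
  where
  E₂₅ : E 25 ≋ S 5 E₅
  E₂₅ = ≋-trans (E≋S 25) (S-∘ 5 5 (E 1))
  E₅₀ : E 50 ≋ S 5 (S 2 E₅)
  E₅₀ = ≋-trans (E≋S 50) (≋-trans (S-∘ 5 10 (E 1)) (S-cong 5 (S-∘ 2 5 (E 1))))

-- E(q)³/E(q²)² = E(q)²/ψ(q), and F is q times this quotient divided by its value at q²⁵.
Fψ̃ : F * ψ̃ ≋ q * Ẽ ^ 2
Fψ̃ = unit-cancel d _ (reciprocal-* d d-at-0) (begin
  d * (F * ψ̃) ≈⟨ solve 5 (λ e x y f z → (x :^ 3 :* y :^ 2 :* e) :* (f :* z) := f :* (y :^ 2 :* (e :* z) :* x :^ 3)) ≋-refl Ẽ (S 5 E₅) (S 5 (S 2 E₅)) F ψ̃ ⟩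
  F * (S 5 (S 2 E₅) ^ 2 * (Ẽ * ψ̃) * S 5 E₅ ^ 3) ≈⟨ *-congˡ (*-cong (*-congˡ (≋-sym Ẽ₂²≋Ẽψ̃)) ≋-refl) ⟩
  F * (S 5 (S 2 E₅) ^ 2 * (Ẽ₂ * Ẽ₂) * S 5 E₅ ^ 3) ≈⟨ *-congˡ (*-cong (solve 2 (λ x y → x :^ 2 :* (y :* y) := (x :* y) :^ 2) ≋-refl (S 5 (S 2 E₅)) Ẽ₂) ≋-refl) ⟩
  F * ((S 5 (S 2 E₅) * Ẽ₂) ^ 2 * S 5 E₅ ^ 3) ≈⟨ *-congˡ (*-cong (^-cong 2 (≋-sym E₂-dissection)) ≋-refl) ⟩
  F * (S 2 (E 1) ^ 2 * S 5 E₅ ^ 3) ≈⟨ F-cleared ⟩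
  q * (E 1 ^ 3 * S 5 (S 2 E₅) ^ 2) ≈⟨ *-congˡ (*-cong (^-cong 3 E-dissection) ≋-refl) ⟩
  q * ((S 5 E₅ * Ẽ) ^ 3 * S 5 (S 2 E₅) ^ 2) ≈⟨ solve 4 (λ q e x y → q :* ((x :* e) :^ 3 :* y :^ 2) := (x :^ 3 :* y :^ 2 :* e) :* (q :* e :^ 2)) ≋-refl q Ẽ (S 5 E₅) (S 5 (S 2 E₅)) ⟩
  d * (q * Ẽ ^ 2) ∎)
  where
  open ≋-Reasoning
  open Solver
  d : Series
  d = S 5 E₅ ^ 3 * S 5 (S 2 E₅) ^ 2 * Ẽ
  d-at-0 : d 0 ≡ 1ℤ
  d-at-0 = *-at-0≡1 (S 5 E₅ ^ 3 * S 5 (S 2 E₅) ^ 2) Ẽ (*-at-0≡1 (S 5 E₅ ^ 3) (S 5 (S 2 E₅) ^ 2)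
    (^-at-0≡1 (S 5 E₅) 3 refl) (^-at-0≡1 (S 5 (S 2 E₅)) 2 refl)) Ẽ-at-0

h₅ h₅⁻¹ Γ : Series
h₅ = S 5 h
h₅⁻¹ = S 5 h⁻¹
Γ = S 5 G

h₅h₅⁻¹ : h₅ * h₅⁻¹ ≋ 1#
h₅h₅⁻¹ = ≋-trans (≋-sym (S-* 5 h h⁻¹)) (≋-trans (S-cong 5 hh⁻¹) (S-1# 5))

Γh₅ : Γ * h₅ ≋ q ^ 5
Γh₅ = ≋-trans (≋-sym (S-* 5 G h)) (≋-trans (S-cong 5 Gh) S₅q)

-- The quotient ψ(q)²/ψ(q²⁵)² is split at ψ(q⁵)²; both factors are instances of `hψ₅²`.
ψ̃² : ψ̃ ^ 2 ≋ h * h₅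
ψ̃² = unit-cancel d _ (reciprocal-* d (^-at-0≡1 (S 5 ψ₅) 2 ψ-at-0)) (begin
  S 5 ψ₅ ^ 2 * ψ̃ ^ 2 ≈⟨ solve 2 (λ x y → x :^ 2 :* y :^ 2 := (x :* y) :^ 2) ≋-refl (S 5 ψ₅) ψ̃ ⟩
  (S 5 ψ₅ * ψ̃) ^ 2 ≈⟨ ^-cong 2 (≋-sym ψ-dissection) ⟩
  ψ ^ 2 ≈⟨ ≋-sym hψ₅² ⟩
  h * ψ₅ ^ 2 ≈⟨ *-congˡ (≋-trans (≋-sym (S-^ 5 ψ 2)) (≋-trans (S-cong 5 (≋-sym hψ₅²)) (S-* 5 h (ψ₅ ^ 2)))) ⟩
  h * (h₅ * S 5 (ψ₅ ^ 2)) ≈⟨ *-congˡ (*-congˡ (S-^ 5 ψ₅ 2)) ⟩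
  h * (h₅ * S 5 ψ₅ ^ 2) ≈⟨ solve 3 (λ x h k → h :* (k :* x) := x :* (h :* k)) ≋-refl (S 5 ψ₅ ^ 2) h h₅ ⟩
  S 5 ψ₅ ^ 2 * (h * h₅) ∎)
  where
  open ≋-Reasoning
  open Solver
  d : Series
  d = S 5 ψ₅ ^ 2

α β : Series
α = M * h⁻¹
β = N * h⁻¹

-- In u = q²ψ̃/h₅ the factor q² moves the components M, N, 1 of ψ̃ from the residues 0, 1, 3 to 2,
-- 3, 0. The last one picks up a factor q on the way, and q/h = G.
υ : Quint Series
υ = ⟨ G , 0# , α , β , 0# ⟩

u : Series
u = D υ

u-h₅ : h₅ * u ≋ q ^ 2 * ψ̃
u-h₅ = begin
  h₅ * D υ ≈⟨ ≋-sym (D-scale h υ) ⟩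
  D ⟨ h * G , h * 0# , h * α , h * β , h * 0# ⟩ ≈⟨ D-cong ≋⟨ ≋-trans (*-comm h G) (≋-trans Gh (≋-sym (*-identityʳ q))) , ≋-trans (zeroʳ h) (≋-sym (zeroʳ q)) , *-reciprocal h M h-at-0 , *-reciprocal h N h-at-0 , zeroʳ h ⟩ ⟩
  D ⟨ q * 1# , q * 0# , M , N , 0# ⟩ ≈⟨ ≋-sym (D-shift ⟨ q * 0# , M , N , 0# , 1# ⟩) ⟩
  q * D ⟨ q * 0# , M , N , 0# , 1# ⟩ ≈⟨ *-congˡ (≋-sym (D-shift Z)) ⟩
  q * (q * ψ̃) ≈⟨ solve 2 (λ q z → q :* (q :* z) := q :^ 2 :* z) ≋-refl q ψ̃ ⟩
  q ^ 2 * ψ̃ ∎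
  where
  open ≋-Reasoning
  open Solver

u≋ : u ≋ h₅⁻¹ * (q ^ 2 * ψ̃)
u≋ = modulo₂ _ _ u-h₅ h₅h₅⁻¹ (solve 4 (λ u h h⁻¹ z → u := h⁻¹ :* z :+ h⁻¹ :* (h :* u :- z) :+ :- u :* (h :* h⁻¹ :- :1)) ≋-refl u h₅ h₅⁻¹ (q ^ 2 * ψ̃))
  where open Solver

Gu² : G * u ^ 2 ≋ Γ
Gu² = unit-cancel (h₅ ^ 2) (h₅⁻¹ ^ 2) (≋-trans (solve 2 (λ x y → x :^ 2 :* y :^ 2 := (x :* y) :^ 2) ≋-refl h₅ h₅⁻¹)
    (≋-trans (^-cong 2 h₅h₅⁻¹) (solve 1 (λ x → :1 :^ 2 := :1) ≋-refl q))) (begin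
  h₅ ^ 2 * (G * u ^ 2) ≈⟨ solve 3 (λ h g u → h :^ 2 :* (g :* u :^ 2) := g :* (h :* u) :^ 2) ≋-refl h₅ G u ⟩
  G * (h₅ * u) ^ 2 ≈⟨ *-congˡ (^-cong 2 u-h₅) ⟩
  G * (q ^ 2 * ψ̃) ^ 2 ≈⟨ solve 3 (λ g q z → g :* (q :^ 2 :* z) :^ 2 := q :^ 4 :* (g :* z :^ 2)) ≋-refl G q ψ̃ ⟩
  q ^ 4 * (G * ψ̃ ^ 2) ≈⟨ *-congˡ (*-congˡ ψ̃²) ⟩
  q ^ 4 * (G * (h * h₅)) ≈⟨ solve 4 (λ q g h k → q :^ 4 :* (g :* (h :* k)) := q :^ 4 :* k :* (g :* h)) ≋-refl q G h h₅ ⟩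
  q ^ 4 * h₅ * (G * h) ≈⟨ *-congˡ Gh ⟩
  q ^ 4 * h₅ * q ≈⟨ solve 2 (λ q h → q :^ 4 :* h :* q := h :* q :^ 5) ≋-refl q h₅ ⟩
  h₅ * q ^ 5 ≈⟨ *-congˡ (≋-sym Γh₅) ⟩
  h₅ * (Γ * h₅) ≈⟨ solve 2 (λ h g → h :* (g :* h) := h :^ 2 :* g) ≋-refl h₅ Γ ⟩
  h₅ ^ 2 * Γ ∎)
  where
  open ≋-Reasoning
  open Solver

-- The quintic equations of `u` and `G`

module _ where
  open Solver

  S-⟦⟧ : ∀ m .{{_ : NonZero m}} {n} (p : Polynomial n) (vs : Vec Series n) → S m (⟦ p ⟧ vs) ≋ ⟦ p ⟧ (mapᵥ (S m) vs)
  S-⟦⟧ m (op [+] p r) vs = ≋-trans (S-+ m (⟦ p ⟧ vs) (⟦ r ⟧ vs)) (+-cong (S-⟦⟧ m p vs) (S-⟦⟧ m r vs))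
  S-⟦⟧ m (op [*] p r) vs = ≋-trans (S-* m (⟦ p ⟧ vs) (⟦ r ⟧ vs)) (*-cong (S-⟦⟧ m p vs) (S-⟦⟧ m r vs))
  S-⟦⟧ m (con c)      vs = S-C m c
  S-⟦⟧ m (var x)      vs = pointwise λ n → cong (λ f → f n) (sym (lookup-map x (S m) vs))
  S-⟦⟧ m (p :^ k)     vs = power k
    where
    power : ∀ k → S m (⟦ p :^ k ⟧ vs) ≋ ⟦ p :^ k ⟧ (mapᵥ (S m) vs)
    power zero    = S-1# m
    power (suc k) = ≋-trans (S-* m (⟦ p ⟧ vs) (⟦ p :^ k ⟧ vs)) (*-cong (S-⟦⟧ m p vs) (power k))
  S-⟦⟧ m (:- p)       vs = ≋-trans (S-neg m (⟦ p ⟧ vs)) (-‿cong (S-⟦⟧ m p vs))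

  x : Polynomial 1
  x = var zero

  -- Polynomials in G are kept as syntax: the same one can then be read at G and at Γ = G(q⁵), and
  -- identities between them can be left to the normaliser.
  ⟪_⟫ ⟪_⟫₅ : Polynomial 1 → Series
  ⟪ p ⟫  = ⟦ p ⟧ (G ∷ [])
  ⟪ p ⟫₅ = ⟦ p ⟧ (Γ ∷ [])

  S-⟪⟫ : ∀ p → S 5 ⟪ p ⟫ ≋ ⟪ p ⟫₅
  S-⟪⟫ p = S-⟦⟧ 5 p (G ∷ [])

  qαβ : q * (α * β) ≋ ⟪ x :- x :^ 2 ⟫
  qαβ = begin
    q * (M * h⁻¹ * (N * h⁻¹)) ≈⟨ solve 4 (λ q M N i → q :* (M :* i :* (N :* i)) := q :* i :^ 2 :* (M :* N)) ≋-refl q M N h⁻¹ ⟩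
    q * h⁻¹ ^ 2 * (M * N) ≈⟨ *-congˡ MN ⟩
    q * h⁻¹ ^ 2 * (h - q) ≈⟨ modulo _ hh⁻¹ (solve 3 (λ q h i → q :* i :^ 2 :* (h :- q) := q :* i :- (q :* i) :^ 2 :+ q :* i :* (h :* i :- :1)) ≋-refl q h h⁻¹) ⟩
    q * h⁻¹ - (q * h⁻¹) ^ 2 ≈⟨ +-cong (≋-sym G≋qh⁻¹) (-‿cong (^-cong 2 (≋-sym G≋qh⁻¹))) ⟩
    ⟪ x :- x :^ 2 ⟫ ∎
    where open ≋-Reasoning

  -- The right side of `M⁵+qN⁵` times q²/h⁵, rewritten by q/h = G and (h-q)/h = 1 - G.
  fifthPowers : ∀ {n} → Polynomial (suc n) → Polynomial (suc n)
  fifthPowers x = x :^ 2 :* ((:1 :- x) :^ 3 :- con (+ 2) :* x :* (:1 :- x) :^ 2 :+ con (+ 8) :* x :^ 2 :* (:1 :- x))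

  q²α⁵+q³β⁵ : q ^ 2 * α ^ 5 + q ^ 3 * β ^ 5 ≋ ⟪ fifthPowers x ⟫
  q²α⁵+q³β⁵ = begin
    q ^ 2 * (M * h⁻¹) ^ 5 + q ^ 3 * (N * h⁻¹) ^ 5
      ≈⟨ solve 4 (λ q M N i → q :^ 2 :* (M :* i) :^ 5 :+ q :^ 3 :* (N :* i) :^ 5 := q :^ 2 :* i :^ 5 :* (M :^ 5 :+ q :* N :^ 5)) ≋-refl q M N h⁻¹ ⟩
    q ^ 2 * h⁻¹ ^ 5 * (M ^ 5 + q * N ^ 5)
      ≈⟨ *-congˡ M⁵+qN⁵ ⟩
    q ^ 2 * h⁻¹ ^ 5 * (P ^ 3 - C (+ 2) * q * P ^ 2 + C (+ 8) * q ^ 2 * P)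
      ≈⟨ solve 3 (λ q P i → q :^ 2 :* i :^ 5 :* (P :^ 3 :- con (+ 2) :* q :* P :^ 2 :+ con (+ 8) :* q :^ 2 :* P)
           := (q :* i) :^ 2 :* ((P :* i) :^ 3 :- con (+ 2) :* (q :* i) :* (P :* i) :^ 2 :+ con (+ 8) :* (q :* i) :^ 2 :* (P :* i))) ≋-refl q P h⁻¹ ⟩
    (q * h⁻¹) ^ 2 * ((P * h⁻¹) ^ 3 - C (+ 2) * (q * h⁻¹) * (P * h⁻¹) ^ 2 + C (+ 8) * (q * h⁻¹) ^ 2 * (P * h⁻¹))
      ≈⟨ *-cong (^-cong 2 g) (+-cong (+-cong (^-cong 3 Ph⁻¹) (-‿cong (*-cong (*-congˡ g) (^-cong 2 Ph⁻¹)))) (*-cong (*-congˡ (^-cong 2 g)) Ph⁻¹)) ⟩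
    ⟪ fifthPowers x ⟫ ∎
    where
    open ≋-Reasoning
    P = h - q
    g : q * h⁻¹ ≋ G
    g = ≋-sym G≋qh⁻¹
    Ph⁻¹ : P * h⁻¹ ≋ 1# - G
    Ph⁻¹ = modulo₂ _ _ hh⁻¹ g (solve 4 (λ q h i G → (h :- q) :* i := :1 :- G :+ :1 :* (h :* i :- :1) :+ :- :1 :* (q :* i :- G)) ≋-refl q h h⁻¹ G)

  π₀ π₁ π₂ π₃ π₄ : ∀ {n} → Polynomial n → Polynomial n
  π₀ x = x :^ 2
  π₁ x = con (+ 25) :* x :^ 3 :- con (+ 5) :* x :^ 2 :- con (+ 25) :* x :^ 4
  π₂ x = con (+ 25) :* x :^ 3 :- con (+ 15) :* x :^ 2
  π₃ x = con (+ 5) :* x :- con (+ 15) :* x :^ 2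
  π₄ x = con (+ 5) :* x

  -- u = Γ + X + Y, where XY and X⁵+Y⁵ are polynomials in Γ. For t = X + Y the identity t⁵ = X⁵ + Y⁵
  -- + 5XY t³ - 5(XY)² t is then a monic quintic over ℤ[Γ]; the shift by Γ turns it into one for u,
  -- with the πᵢ as coefficients.
  u⁵ : u ^ 5 ≋ ⟪ π₀ x ⟫₅ + ⟪ π₁ x ⟫₅ * u + ⟪ π₂ x ⟫₅ * u ^ 2 + ⟪ π₃ x ⟫₅ * u ^ 3 + ⟪ π₄ x ⟫₅ * u ^ 4
  u⁵ = ≋-trans (^-cong 5 u≋Γ+t) (≋-trans (modulo _ t⁵
    (solve 2 (λ g t → let u = g :+ t in u :^ 5
      := π₀ g :+ π₁ g :* u :+ π₂ g :* u :^ 2 :+ π₃ g :* u :^ 3 :+ π₄ g :* u :^ 4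
         :+ :1 :* (t :^ 5 :- (fifthPowers g
              :+ con (+ 5) :* (g :- g :^ 2) :* t :^ 3 :- con (+ 5) :* (g :- g :^ 2) :^ 2 :* t))) ≋-refl Γ t))
    (+-cong (+-cong (+-cong (+-congˡ (*-congˡ u′)) (*-congˡ (^-cong 2 u′))) (*-congˡ (^-cong 3 u′))) (*-congˡ (^-cong 4 u′))))
    where
    open ≋-Reasoning
    X Y t : Series
    X = q ^ 2 * S 5 α
    Y = q ^ 3 * S 5 β
    t = X + Y
    u≋Γ+t : u ≋ Γ + t
    u≋Γ+t = ≋-trans (+-congˡ (*-congˡ (+-cong (S-C 5 0ℤ) (*-congˡ (+-congˡ (*-congˡ (+-congˡ (*-congˡ (S-C 5 0ℤ)))))))))
      (solve 4 (λ q g a b → g :+ q :* (con 0ℤ :+ q :* (a :+ q :* (b :+ q :* con 0ℤ))) := g :+ (q :^ 2 :* a :+ q :^ 3 :* b)) ≋-refl q Γ (S 5 α) (S 5 β))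
    u′ : Γ + t ≋ u
    u′ = ≋-sym u≋Γ+t
    XY : X * Y ≋ ⟪ x :- x :^ 2 ⟫₅
    XY = begin
      q ^ 2 * S 5 α * (q ^ 3 * S 5 β) ≈⟨ solve 3 (λ q a b → q :^ 2 :* a :* (q :^ 3 :* b) := q :^ 5 :* (a :* b)) ≋-refl q (S 5 α) (S 5 β) ⟩
      q ^ 5 * (S 5 α * S 5 β) ≈⟨ *-cong (≋-sym S₅q) (≋-sym (S-* 5 α β)) ⟩
      S 5 q * S 5 (α * β) ≈⟨ ≋-sym (S-* 5 q (α * β)) ⟩
      S 5 (q * (α * β)) ≈⟨ S-cong 5 qαβ ⟩
      S 5 ⟪ x :- x :^ 2 ⟫ ≈⟨ S-⟪⟫ (x :- x :^ 2) ⟩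
      ⟪ x :- x :^ 2 ⟫₅ ∎
    X⁵+Y⁵ : X ^ 5 + Y ^ 5 ≋ ⟪ fifthPowers x ⟫₅
    X⁵+Y⁵ = begin
      (q ^ 2 * S 5 α) ^ 5 + (q ^ 3 * S 5 β) ^ 5 ≈⟨ solve 3 (λ q a b → (q :^ 2 :* a) :^ 5 :+ (q :^ 3 :* b) :^ 5 := (q :^ 5) :^ 2 :* a :^ 5 :+ (q :^ 5) :^ 3 :* b :^ 5) ≋-refl q (S 5 α) (S 5 β) ⟩
      (q ^ 5) ^ 2 * S 5 α ^ 5 + (q ^ 5) ^ 3 * S 5 β ^ 5 ≈⟨ +-cong (*-cong (^-cong 2 (≋-sym S₅q)) ≋-refl) (*-cong (^-cong 3 (≋-sym S₅q)) ≋-refl) ⟩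
      S 5 q ^ 2 * S 5 α ^ 5 + S 5 q ^ 3 * S 5 β ^ 5 ≈⟨ ≋-sym (S-⟦⟧ 5 (var zero :^ 2 :* var (suc zero) :^ 5 :+ var zero :^ 3 :* var (suc (suc zero)) :^ 5) (q ∷ α ∷ β ∷ [])) ⟩
      S 5 (q ^ 2 * α ^ 5 + q ^ 3 * β ^ 5) ≈⟨ S-cong 5 q²α⁵+q³β⁵ ⟩
      S 5 ⟪ fifthPowers x ⟫ ≈⟨ S-⟪⟫ (fifthPowers x) ⟩
      ⟪ fifthPowers x ⟫₅ ∎
    t⁵ : t ^ 5 ≋ ⟪ fifthPowers x ⟫₅ + C (+ 5) * ⟪ x :- x :^ 2 ⟫₅ * t ^ 3 - C (+ 5) * ⟪ x :- x :^ 2 ⟫₅ ^ 2 * t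
    t⁵ = ≋-trans (solve 2 (λ X Y → let t = X :+ Y in t :^ 5 := X :^ 5 :+ Y :^ 5 :+ con (+ 5) :* (X :* Y) :* t :^ 3 :- con (+ 5) :* (X :* Y) :^ 2 :* t) ≋-refl X Y)
      (+-cong (+-cong X⁵+Y⁵ (*-cong (*-congˡ XY) ≋-refl)) (-‿cong (*-cong (*-congˡ (^-cong 2 XY)) ≋-refl)))

  Γ⁴-cancel : ∀ {f g} → Γ ^ 4 * f ≋ Γ ^ 4 * g → f ≋ g
  Γ⁴-cancel {f} {g} p = q^-*-cancel 20 (begin
    q^ 20 * f ≈⟨ *-cong (q^≋q^ 20) ≋-refl ⟩
    q ^ 20 * f ≈⟨ solve 2 (λ q f → q :^ 20 :* f := (q :^ 5) :^ 4 :* f) ≋-refl q f ⟩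
    (q ^ 5) ^ 4 * f ≈⟨ *-cong (^-cong 4 (≋-sym Γh₅)) ≋-refl ⟩
    (Γ * h₅) ^ 4 * f ≈⟨ solve 3 (λ g h f → (g :* h) :^ 4 :* f := h :^ 4 :* (g :^ 4 :* f)) ≋-refl Γ h₅ f ⟩
    h₅ ^ 4 * (Γ ^ 4 * f) ≈⟨ *-congˡ p ⟩
    h₅ ^ 4 * (Γ ^ 4 * g) ≈⟨ solve 3 (λ g h f → h :^ 4 :* (g :^ 4 :* f) := (g :* h) :^ 4 :* f) ≋-refl Γ h₅ g ⟩
    (Γ * h₅) ^ 4 * g ≈⟨ *-cong (^-cong 4 Γh₅) ≋-refl ⟩
    (q ^ 5) ^ 4 * g ≈⟨ solve 2 (λ q f → (q :^ 5) :^ 4 :* f := q :^ 20 :* f) ≋-refl q g ⟩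
    q ^ 20 * g ≈⟨ *-cong (≋-sym (q^≋q^ 20)) ≋-refl ⟩
    q^ 20 * g ∎)
    where open ≋-Reasoning

  -- `:O` and `:E` separate the parities in the quintic of u, which becomes u·O = E. `:L` and `:R`
  -- are what they turn into when u² is replaced by Γ/G, up to the factor Γ²/G².
  :O :E :L :R : ∀ {n} → Polynomial (suc n) → Polynomial (suc n) → Polynomial (suc n)
  :O γ u = u :^ 4 :+ (con (+ 15) :* γ :^ 2 :- con (+ 5) :* γ) :* u :^ 2 :+ (con (+ 5) :* γ :^ 2 :- con (+ 25) :* γ :^ 3 :+ con (+ 25) :* γ :^ 4)
  :E γ u = con (+ 5) :* γ :* u :^ 4 :- (con (+ 15) :* γ :^ 2 :- con (+ 25) :* γ :^ 3) :* u :^ 2 :+ γ :^ 2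
  :L γ g = :1 :+ (con (+ 15) :* γ :- con (+ 5)) :* g :+ (con (+ 5) :- con (+ 25) :* γ :+ con (+ 25) :* γ :^ 2) :* g :^ 2
  :R γ g = con (+ 5) :* γ :- (con (+ 15) :* γ :- con (+ 25) :* γ :^ 2) :* g :+ g :^ 2

  -- Separate the even and the odd powers of u in its equation and square; then
  -- u² = Γ/G eliminates u.
  modular-equation : Γ * (1# + (C (+ 15) * Γ - C (+ 5)) * G + (C (+ 5) - C (+ 25) * Γ + C (+ 25) * Γ ^ 2) * G ^ 2) ^ 2
    ≋ G * (C (+ 5) * Γ - (C (+ 15) * Γ - C (+ 25) * Γ ^ 2) * G + G ^ 2) ^ 2
  modular-equation = Γ⁴-cancel (begin
    Γ ^ 4 * (Γ * Lₘ ^ 2) ≈⟨ solve 2 (λ g l → g :^ 4 :* (g :* l :^ 2) := g :* (g :^ 2 :* l) :^ 2) ≋-refl Γ Lₘ ⟩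
    Γ * (Γ ^ 2 * Lₘ) ^ 2 ≈⟨ *-cong (≋-sym Gu²) (^-cong 2 (≋-sym G²O)) ⟩
    G * u ^ 2 * (G ^ 2 * O) ^ 2 ≈⟨ solve 3 (λ g u o → g :* u :^ 2 :* (g :^ 2 :* o) :^ 2 := g :* (g :^ 2 :* (u :* o)) :^ 2) ≋-refl G u O ⟩
    G * (G ^ 2 * (u * O)) ^ 2 ≈⟨ *-congˡ (^-cong 2 (*-congˡ uO)) ⟩
    G * (G ^ 2 * E′) ^ 2 ≈⟨ *-congˡ (^-cong 2 G²E′) ⟩
    G * (Γ ^ 2 * Rₘ) ^ 2 ≈⟨ solve 3 (λ g γ r → g :* (γ :^ 2 :* r) :^ 2 := γ :^ 4 :* (g :* r :^ 2)) ≋-refl G Γ Rₘ ⟩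
    Γ ^ 4 * (G * Rₘ ^ 2) ∎)
    where
    open ≋-Reasoning
    Lₘ Rₘ O E′ : Series
    Lₘ = 1# + (C (+ 15) * Γ - C (+ 5)) * G + (C (+ 5) - C (+ 25) * Γ + C (+ 25) * Γ ^ 2) * G ^ 2
    Rₘ = C (+ 5) * Γ - (C (+ 15) * Γ - C (+ 25) * Γ ^ 2) * G + G ^ 2
    O = u ^ 4 + (C (+ 15) * Γ ^ 2 - C (+ 5) * Γ) * u ^ 2 + (C (+ 5) * Γ ^ 2 - C (+ 25) * Γ ^ 3 + C (+ 25) * Γ ^ 4)
    E′ = C (+ 5) * Γ * u ^ 4 - (C (+ 15) * Γ ^ 2 - C (+ 25) * Γ ^ 3) * u ^ 2 + Γ ^ 2
    uO : u * O ≋ E′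
    uO = modulo _ u⁵ (solve 2 (λ γ u →
      u :* :O γ u
      := :E γ u
      :+ :1 :* (u :^ 5 :- (π₀ γ :+ π₁ γ :* u :+ π₂ γ :* u :^ 2 :+ π₃ γ :* u :^ 3 :+ π₄ γ :* u :^ 4))) ≋-refl Γ u)
    G²O : G ^ 2 * O ≋ Γ ^ 2 * Lₘ
    G²O = modulo _ Gu² (solve 3 (λ g γ u →
      g :^ 2 :* :O γ u
      := γ :^ 2 :* :L γ g
      :+ (g :* u :^ 2 :+ γ :+ (con (+ 15) :* γ :^ 2 :- con (+ 5) :* γ) :* g) :* (g :* u :^ 2 :- γ)) ≋-refl G Γ u)
    G²E′ : G ^ 2 * E′ ≋ Γ ^ 2 * Rₘ
    G²E′ = modulo _ Gu² (solve 3 (λ g γ u →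
      g :^ 2 :* :E γ u
      := γ :^ 2 :* :R γ g
      :+ (con (+ 5) :* γ :* (g :* u :^ 2 :+ γ) :- (con (+ 15) :* γ :^ 2 :- con (+ 25) :* γ :^ 3) :* g) :* (g :* u :^ 2 :- γ)) ≋-refl G Γ u)

  -- Read off from the expansion of ΓL² = GR²: in G, the right side is monic of degree 5 and the
  -- left side has degree 4.
  κ₀ κ₁ κ₂ κ₃ κ₄ : ∀ {n} → Polynomial n → Polynomial n
  κ₀ x = x
  κ₁ x = con (+ 5) :* x :^ 2 :- con (+ 10) :* x
  κ₂ x = con (+ 25) :* x :^ 3 :- con (+ 50) :* x :^ 2 :+ con (+ 35) :* x
  κ₃ x = con (+ 125) :* x :^ 4 :- con (+ 250) :* x :^ 3 :+ con (+ 175) :* x :^ 2 :- con (+ 60) :* x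
  κ₄ x = con (+ 625) :* x :^ 5 :- con (+ 1250) :* x :^ 4 :+ con (+ 875) :* x :^ 3 :- con (+ 300) :* x :^ 2 :+ con (+ 55) :* x

  G⁵ : G ^ 5 ≋ ⟪ κ₀ x ⟫₅ + ⟪ κ₁ x ⟫₅ * G + ⟪ κ₂ x ⟫₅ * G ^ 2 + ⟪ κ₃ x ⟫₅ * G ^ 3 + ⟪ κ₄ x ⟫₅ * G ^ 4
  G⁵ = modulo _ modular-equation (solve 2 (λ γ g → g :^ 5
    := κ₀ γ :+ κ₁ γ :* g :+ κ₂ γ :* g :^ 2 :+ κ₃ γ :* g :^ 3 :+ κ₄ γ :* g :^ 4
       :+ :- :1 :* (γ :* :L γ g :^ 2
          :- g :* :R γ g :^ 2)) ≋-refl Γ G)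

-- The operator U

-- Opaque for the same reason as the ring operations.
opaque
  unfolding _+_

  U : Series → Series
  U = U₅

  U≡U₅ : ∀ f → U f ≡ U₅ f
  U≡U₅ f = refl

  U-cong : ∀ {f g} → f ≋ g → U f ≋ U g
  U-cong p = V-cong 0 p

  U-+ : ∀ f g → U (f + g) ≋ U f + U g
  U-+ f g = pointwise λ n → refl

  U-S : ∀ c f → U (S 5 c * f) ≋ c * U f
  U-S c f = V-S 0 c f (ℕ.s≤s ℕ.z≤n)

  U-D : ∀ t → U (D t) ≋ c₀ t
  U-D t = e₀ (D-coefficients t)

module _ where
  open Solver

  U-⟪⟫ : ∀ p f → U (⟪ p ⟫₅ * f) ≋ ⟪ p ⟫ * U f
  U-⟪⟫ p f = ≋-trans (U-cong (*-cong (≋-sym (S-⟪⟫ p)) ≋-refl)) (U-S ⟪ p ⟫ f)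

  -- Coefficients in ℤ[Γ] are series in q⁵, so U lets them through as the same polynomials in G.
  recurrence : ∀ {w} p₀ p₁ p₂ p₃ p₄ →
    w ^ 5 ≋ ⟪ p₀ ⟫₅ + ⟪ p₁ ⟫₅ * w + ⟪ p₂ ⟫₅ * w ^ 2 + ⟪ p₃ ⟫₅ * w ^ 3 + ⟪ p₄ ⟫₅ * w ^ 4 → ∀ f →
    U (f * w ^ 5) ≋ ⟪ p₀ ⟫ * U f + ⟪ p₁ ⟫ * U (f * w) + ⟪ p₂ ⟫ * U (f * w ^ 2) + ⟪ p₃ ⟫ * U (f * w ^ 3) + ⟪ p₄ ⟫ * U (f * w ^ 4)
  recurrence {w} p₀ p₁ p₂ p₃ p₄ eq f = begin
    U (f * w ^ 5)
      ≈⟨ U-cong (*-congˡ eq) ⟩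
    U (f * (⟪ p₀ ⟫₅ + ⟪ p₁ ⟫₅ * w + ⟪ p₂ ⟫₅ * w ^ 2 + ⟪ p₃ ⟫₅ * w ^ 3 + ⟪ p₄ ⟫₅ * w ^ 4))
      ≈⟨ U-cong (solve 7 (λ f w a₀ a₁ a₂ a₃ a₄ → f :* (a₀ :+ a₁ :* w :+ a₂ :* w :^ 2 :+ a₃ :* w :^ 3 :+ a₄ :* w :^ 4)
           := a₀ :* f :+ a₁ :* (f :* w) :+ a₂ :* (f :* w :^ 2) :+ a₃ :* (f :* w :^ 3) :+ a₄ :* (f :* w :^ 4)) ≋-refl f w ⟪ p₀ ⟫₅ ⟪ p₁ ⟫₅ ⟪ p₂ ⟫₅ ⟪ p₃ ⟫₅ ⟪ p₄ ⟫₅) ⟩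
    U (⟪ p₀ ⟫₅ * f + ⟪ p₁ ⟫₅ * (f * w) + ⟪ p₂ ⟫₅ * (f * w ^ 2) + ⟪ p₃ ⟫₅ * (f * w ^ 3) + ⟪ p₄ ⟫₅ * (f * w ^ 4))
      ≈⟨ U-sum (U-sum (U-sum (U-sum (U-⟪⟫ p₀ f) (U-⟪⟫ p₁ (f * w))) (U-⟪⟫ p₂ (f * w ^ 2))) (U-⟪⟫ p₃ (f * w ^ 3))) (U-⟪⟫ p₄ (f * w ^ 4)) ⟩
    ⟪ p₀ ⟫ * U f + ⟪ p₁ ⟫ * U (f * w) + ⟪ p₂ ⟫ * U (f * w ^ 2) + ⟪ p₃ ⟫ * U (f * w ^ 3) + ⟪ p₄ ⟫ * U (f * w ^ 4) ∎
    where
    open ≋-Reasoning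
    U-sum : ∀ {f g f′ g′} → U f ≋ f′ → U g ≋ g′ → U (f + g) ≋ f′ + g′
    U-sum {f} {g} p r = ≋-trans (U-+ f g) (+-cong p r)

  *-^-+ : ∀ f w i k → f * w ^ k * w ^ i ≋ f * w ^ (i ℕ.+ k)
  *-^-+ f w zero    k = *-identityʳ _
  *-^-+ f w (suc i) k = ≋-trans (solve 4 (λ f w a b → f :* a :* (w :* b) := w :* (f :* a :* b)) ≋-refl f w (w ^ k) (w ^ i))
    (≋-trans (*-congˡ (*-^-+ f w i k)) (solve 3 (λ f w a → w :* (f :* a) := f :* (w :* a)) ≋-refl f w (w ^ (i ℕ.+ k))))

  recurrence-at : ∀ {w} p₀ p₁ p₂ p₃ p₄ →
    w ^ 5 ≋ ⟪ p₀ ⟫₅ + ⟪ p₁ ⟫₅ * w + ⟪ p₂ ⟫₅ * w ^ 2 + ⟪ p₃ ⟫₅ * w ^ 3 + ⟪ p₄ ⟫₅ * w ^ 4 → ∀ f k →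
    U (f * w ^ (5 ℕ.+ k)) ≋ ⟪ p₀ ⟫ * U (f * w ^ k) + ⟪ p₁ ⟫ * U (f * w ^ (1 ℕ.+ k)) + ⟪ p₂ ⟫ * U (f * w ^ (2 ℕ.+ k))
      + ⟪ p₃ ⟫ * U (f * w ^ (3 ℕ.+ k)) + ⟪ p₄ ⟫ * U (f * w ^ (4 ℕ.+ k))
  recurrence-at {w} p₀ p₁ p₂ p₃ p₄ eq f k = ≋-trans (U-cong (≋-sym (*-^-+ f w 5 k))) (≋-trans (recurrence p₀ p₁ p₂ p₃ p₄ eq (f * w ^ k))
    (+-cong (+-cong (+-cong (+-congˡ (*-congˡ (U-cong (≋-trans (*-congˡ (≋-sym (*-identityʳ w))) (*-^-+ f w 1 k)))))
      (*-congˡ (U-cong (*-^-+ f w 2 k)))) (*-congˡ (U-cong (*-^-+ f w 3 k)))) (*-congˡ (U-cong (*-^-+ f w 4 k)))))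

  evaluate : ∀ p r → ⟦ p ⟧↓ (G ∷ []) ≋ ⟦ r ⟧↓ (G ∷ []) → ⟪ p ⟫ ≋ ⟪ r ⟫
  evaluate = prove (G ∷ [])

  u-step : Polynomial 1 → Polynomial 1 → Polynomial 1 → Polynomial 1 → Polynomial 1 → Polynomial 1
  u-step t₀ t₁ t₂ t₃ t₄ = π₀ x :* t₀ :+ π₁ x :* t₁ :+ π₂ x :* t₂ :+ π₃ x :* t₃ :+ π₄ x :* t₄

  next : ∀ f k t₀ t₁ t₂ t₃ t₄ → U (f * u ^ k) ≋ ⟪ t₀ ⟫ → U (f * u ^ (1 ℕ.+ k)) ≋ ⟪ t₁ ⟫ → U (f * u ^ (2 ℕ.+ k)) ≋ ⟪ t₂ ⟫ →
    U (f * u ^ (3 ℕ.+ k)) ≋ ⟪ t₃ ⟫ → U (f * u ^ (4 ℕ.+ k)) ≋ ⟪ t₄ ⟫ → U (f * u ^ (5 ℕ.+ k)) ≋ ⟪ u-step t₀ t₁ t₂ t₃ t₄ ⟫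
  next f k t₀ t₁ t₂ t₃ t₄ e₀ e₁ e₂ e₃ e₄ = ≋-trans (recurrence-at (π₀ x) (π₁ x) (π₂ x) (π₃ x) (π₄ x) u⁵ f k)
    (+-cong (+-cong (+-cong (+-cong (*-congˡ e₀) (*-congˡ e₁)) (*-congˡ e₂)) (*-congˡ e₃)) (*-congˡ e₄))

  infixl 8 _:·_
  _:·_ : ℕ → ℕ → Polynomial 1
  c :· k = con (+ c) :* x :^ k

  -- τₖ is the value of U(uᵏ).
  τ₀ τ₁ τ₂ τ₃ τ₄ τ₅ τ₆ τ₇ τ₈ : Polynomial 1
  τ₀ = con (+ 1)
  τ₁ = x
  τ₂ = 2 :· 1 :- x :^ 2
  τ₃ = 6 :· 2 :- 5 :· 3
  τ₄ = 6 :· 2 :- 5 :· 4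
  τ₅ = x :^ 2 :+ 25 :· 3 :- 25 :· 4
  τ₆ = 26 :· 3 :- 25 :· 6
  τ₇ = 7 :· 3 :+ 119 :· 4 :- 175 :· 5 :+ 175 :· 6 :- 125 :· 7
  τ₈ = 126 :· 4 :- 125 :· 8

  U-u⁰ : U (1# * u ^ 0) ≋ ⟪ τ₀ ⟫
  U-u⁰ = begin
    U (1# * 1#) ≈⟨ U-cong (*-identityˡ 1#) ⟩
    U 1# ≈⟨ U-cong (≋-trans (≋-sym (S-1# 5)) (solve 2 (λ q s → s := s :+ q :* (con 0ℤ :+ q :* (con 0ℤ :+ q :* (con 0ℤ :+ q :* con 0ℤ)))) ≋-refl q (S 5 1#))) ⟩
    U (S 5 1# + q * (0# + q * (0# + q * (0# + q * 0#)))) ≈⟨ U-cong (+-congˡ (*-congˡ (+-cong O (*-congˡ (+-cong O (*-congˡ (+-cong O (*-congˡ O)))))))) ⟩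
    U (D ⟨ 1# , 0# , 0# , 0# , 0# ⟩) ≈⟨ U-D ⟨ 1# , 0# , 0# , 0# , 0# ⟩ ⟩
    1# ≈⟨ ≋-sym C1 ⟩
    C 1ℤ ∎
    where
    open ≋-Reasoning
    O : 0# ≋ S 5 0#
    O = ≋-sym (S-C 5 0ℤ)

  U-u¹ : U (1# * u ^ 1) ≋ ⟪ τ₁ ⟫
  U-u¹ = ≋-trans (U-cong (solve 1 (λ u → :1 :* u :^ 1 := u) ≋-refl u)) (U-D υ)

  U-u² : U (1# * u ^ 2) ≋ ⟪ τ₂ ⟫
  U-u² = begin
    U (1# * u ^ 2) ≈⟨ U-cong (solve 1 (λ u → :1 :* u :^ 2 := u :* u) ≋-refl u) ⟩
    U (u * u) ≈⟨ U-cong (≋-sym (D-⊠ υ υ)) ⟩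
    U (D (υ ⊠ υ)) ≈⟨ U-D (υ ⊠ υ) ⟩
    c₀ (υ ⊠ υ) ≈⟨ modulo _ qαβ (solve 4 (λ q g a b → let v = ⟨ g , con 0ℤ , a , b , con 0ℤ ⟩ in
                             c₀ (multiply _:+_ _:*_ q v v) := con (+ 2) :* g :^ 1 :- g :^ 2 :+ con (+ 2) :* (q :* (a :* b) :- (g :- g :^ 2))) ≋-refl q G α β) ⟩
    ⟪ τ₂ ⟫ ∎
    where open ≋-Reasoning

  U-u³ : U (1# * u ^ 3) ≋ ⟪ τ₃ ⟫
  U-u³ = begin
    U (1# * u ^ 3) ≈⟨ U-cong (solve 1 (λ u → :1 :* u :^ 3 := u :* (u :* u)) ≋-refl u) ⟩
    U (u * (u * u)) ≈⟨ U-cong (≋-trans (*-congˡ (≋-sym (D-⊠ υ υ))) (≋-sym (D-⊠ υ (υ ⊠ υ)))) ⟩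
    U (D (υ ⊠ (υ ⊠ υ))) ≈⟨ U-D (υ ⊠ (υ ⊠ υ)) ⟩
    c₀ (υ ⊠ (υ ⊠ υ)) ≈⟨ modulo _ qαβ (solve 4 (λ q g a b → let v = ⟨ g , con 0ℤ , a , b , con 0ℤ ⟩ in
                             c₀ (multiply _:+_ _:*_ q v (multiply _:+_ _:*_ q v v)) := con (+ 6) :* g :^ 2 :- con (+ 5) :* g :^ 3
                               :+ con (+ 6) :* g :* (q :* (a :* b) :- (g :- g :^ 2))) ≋-refl q G α β) ⟩
    ⟪ τ₃ ⟫ ∎
    where open ≋-Reasoning

  U-u⁴ : U (1# * u ^ 4) ≋ ⟪ τ₄ ⟫
  U-u⁴ = begin
    U (1# * u ^ 4) ≈⟨ U-cong (solve 1 (λ u → :1 :* u :^ 4 := u :* u :* (u :* u)) ≋-refl u) ⟩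
    U (u * u * (u * u)) ≈⟨ U-cong (≋-trans (*-cong (≋-sym (D-⊠ υ υ)) (≋-sym (D-⊠ υ υ))) (≋-sym (D-⊠ (υ ⊠ υ) (υ ⊠ υ)))) ⟩
    U (D (υ ⊠ υ ⊠ (υ ⊠ υ))) ≈⟨ U-D (υ ⊠ υ ⊠ (υ ⊠ υ)) ⟩
    c₀ (υ ⊠ υ ⊠ (υ ⊠ υ)) ≈⟨ modulo _ qαβ (solve 4 (λ q g a b → let v = ⟨ g , con 0ℤ , a , b , con 0ℤ ⟩ ; v² = multiply _:+_ _:*_ q v v in
                                     c₀ (multiply _:+_ _:*_ q v² v²) := con (+ 6) :* g :^ 2 :- con (+ 5) :* g :^ 4
                                       :+ (con (+ 12) :* g :^ 2 :+ con (+ 6) :* (q :* (a :* b) :+ (g :- g :^ 2))) :* (q :* (a :* b) :- (g :- g :^ 2))) ≋-refl q G α β) ⟩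
    ⟪ τ₄ ⟫ ∎
    where open ≋-Reasoning

  U-u⁵ : U (1# * u ^ 5) ≋ ⟪ τ₅ ⟫
  U-u⁵ = ≋-trans (next 1# 0 τ₀ τ₁ τ₂ τ₃ τ₄ U-u⁰ U-u¹ U-u² U-u³ U-u⁴) (evaluate (u-step τ₀ τ₁ τ₂ τ₃ τ₄) τ₅ ≋-refl)

  U-u⁶ : U (1# * u ^ 6) ≋ ⟪ τ₆ ⟫
  U-u⁶ = ≋-trans (next 1# 1 τ₁ τ₂ τ₃ τ₄ τ₅ U-u¹ U-u² U-u³ U-u⁴ U-u⁵) (evaluate (u-step τ₁ τ₂ τ₃ τ₄ τ₅) τ₆ ≋-refl)

  U-u⁷ : U (1# * u ^ 7) ≋ ⟪ τ₇ ⟫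
  U-u⁷ = ≋-trans (next 1# 2 τ₂ τ₃ τ₄ τ₅ τ₆ U-u² U-u³ U-u⁴ U-u⁵ U-u⁶) (evaluate (u-step τ₂ τ₃ τ₄ τ₅ τ₆) τ₇ ≋-refl)

  U-u⁸ : U (1# * u ^ 8) ≋ ⟪ τ₈ ⟫
  U-u⁸ = ≋-trans (next 1# 3 τ₃ τ₄ τ₅ τ₆ τ₇ U-u³ U-u⁴ U-u⁵ U-u⁶ U-u⁷) (evaluate (u-step τ₃ τ₄ τ₅ τ₆ τ₇) τ₈ ≋-refl)

module _ where
  open Solver
  open ≋-Reasoning

  U-qD : ∀ t → U (q * D t) ≋ q * c₄ t
  U-qD t = ≋-trans (U-cong (D-shift t)) (U-D _)

  U-q²D : ∀ t → U (q ^ 2 * D t) ≋ q * c₃ t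
  U-q²D t = ≋-trans (U-cong (≋-trans (solve 2 (λ q d → q :^ 2 :* d := q :* (q :* d)) ≋-refl q (D t)) (*-congˡ (D-shift t))))
    (U-qD ⟨ q * c₄ t , c₀ t , c₁ t , c₂ t , c₃ t ⟩)

  U-q³D : ∀ t → U (q ^ 3 * D t) ≋ q * c₂ t
  U-q³D t = ≋-trans (U-cong (≋-trans (solve 2 (λ q d → q :^ 3 :* d := q :^ 2 :* (q :* d)) ≋-refl q (D t)) (*-congˡ (D-shift t))))
    (U-q²D ⟨ q * c₄ t , c₀ t , c₁ t , c₂ t , c₃ t ⟩)

  U-q⁴D : ∀ t → U (q ^ 4 * D t) ≋ q * c₁ t
  U-q⁴D t = ≋-trans (U-cong (≋-trans (solve 2 (λ q d → q :^ 4 :* d := q :^ 3 :* (q :* d)) ≋-refl q (D t)) (*-congˡ (D-shift t))))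
    (U-q³D ⟨ q * c₄ t , c₀ t , c₁ t , c₂ t , c₃ t ⟩)

  qh⁻¹≋G : q * h⁻¹ ≋ G
  qh⁻¹≋G = ≋-sym G≋qh⁻¹

  D-b⁴ : (Ẽ₂ * Ẽ₂) ^ 2 ≋ D b⁴
  D-b⁴ = ≋-trans (solve 1 (λ x → x :^ 2 := x :* x) ≋-refl (Ẽ₂ * Ẽ₂))
    (≋-trans (*-cong (≋-sym (D-⊠ b b)) (≋-sym (D-⊠ b b))) (≋-sym (D-⊠ (b ⊠ b) (b ⊠ b))))

  -- φₖ is the value of U(F uᵏ).
  φ₀ φ₁ φ₂ φ₃ φ₄ φ₅ φ₆ φ₇ φ₈ : Polynomial 1
  φ₀ = 5 :· 1
  φ₁ = :- x
  φ₂ = x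
  φ₃ = :- (5 :· 3)
  φ₄ = x :^ 2 :+ 5 :· 3 :- 25 :· 4
  φ₅ = :- (25 :· 5)
  φ₆ = 35 :· 4 :- x :^ 3 :- 150 :· 5 :+ 125 :· 6
  φ₇ = x :^ 3 :- 20 :· 4 :+ 150 :· 5 :- 500 :· 6 :+ 500 :· 7
  φ₈ = 85 :· 5 :- 5 :· 4 :- 300 :· 6 :+ 625 :· 8

  -- F = qẼ²/ψ̃ has ψ̃ in its denominator, and one factor u clears it. Direct computation therefore
  -- covers the exponents 1 to 5; exponent 0 is recovered from them afterwards.
  U-Fu¹ : U (F * u ^ 1) ≋ ⟪ φ₁ ⟫
  U-Fu¹ = begin
    U (F * u ^ 1) ≈⟨ U-cong (*-congˡ (^-cong 1 u≋)) ⟩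
    U (F * (h₅⁻¹ * (q ^ 2 * ψ̃)) ^ 1) ≈⟨ U-cong (solve 4 (λ f i q z → f :* (i :* (q :^ 2 :* z)) :^ 1 := i :* (q :^ 2 :* (f :* z))) ≋-refl F h₅⁻¹ q ψ̃) ⟩
    U (h₅⁻¹ * (q ^ 2 * (F * ψ̃))) ≈⟨ U-cong (*-congˡ (*-congˡ Fψ̃)) ⟩
    U (h₅⁻¹ * (q ^ 2 * (q * Ẽ ^ 2))) ≈⟨ U-cong (*-congˡ (solve 2 (λ q e → q :^ 2 :* (q :* e :^ 2) := q :^ 3 :* (e :* e)) ≋-refl q Ẽ)) ⟩
    U (h₅⁻¹ * (q ^ 3 * (Ẽ * Ẽ))) ≈⟨ U-S h⁻¹ _ ⟩
    h⁻¹ * U (q ^ 3 * (Ẽ * Ẽ)) ≈⟨ *-congˡ (U-cong (*-congˡ (≋-sym (D-⊠ a a)))) ⟩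
    h⁻¹ * U (q ^ 3 * D (a ⊠ a)) ≈⟨ *-congˡ (≋-trans (U-q³D (a ⊠ a)) (*-congˡ a²-c₂)) ⟩
    h⁻¹ * (q * - 1#) ≈⟨ solve 2 (λ q i → i :* (q :* :- :1) := :- (q :* i)) ≋-refl q h⁻¹ ⟩
    - (q * h⁻¹) ≈⟨ -‿cong qh⁻¹≋G ⟩
    - G ∎

  private
    q⁵-out : ∀ k f → U (h₅⁻¹ ^ k * (q ^ 5 * f)) ≋ h⁻¹ ^ k * q * U f
    q⁵-out k f = begin
      U (h₅⁻¹ ^ k * (q ^ 5 * f)) ≈⟨ U-cong (≋-sym (*-assoc (h₅⁻¹ ^ k) (q ^ 5) f)) ⟩
      U (h₅⁻¹ ^ k * q ^ 5 * f) ≈⟨ U-cong (*-cong (*-cong (≋-sym (S-^ 5 h⁻¹ k)) (≋-sym S₅q)) ≋-refl) ⟩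
      U (S 5 (h⁻¹ ^ k) * S 5 q * f) ≈⟨ U-cong (*-cong (≋-sym (S-* 5 (h⁻¹ ^ k) q)) ≋-refl) ⟩
      U (S 5 (h⁻¹ ^ k * q) * f) ≈⟨ U-S (h⁻¹ ^ k * q) f ⟩
      h⁻¹ ^ k * q * U f ∎

  U-Fu² : U (F * u ^ 2) ≋ ⟪ φ₂ ⟫
  U-Fu² = begin
    U (F * u ^ 2) ≈⟨ U-cong (*-congˡ (^-cong 2 u≋)) ⟩
    U (F * (h₅⁻¹ * (q ^ 2 * ψ̃)) ^ 2) ≈⟨ U-cong (solve 4 (λ f i q z → f :* (i :* (q :^ 2 :* z)) :^ 2 := i :^ 2 :* (q :^ 4 :* z :* (f :* z))) ≋-refl F h₅⁻¹ q ψ̃) ⟩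
    U (h₅⁻¹ ^ 2 * (q ^ 4 * ψ̃ * (F * ψ̃))) ≈⟨ U-cong (*-congˡ (*-congˡ Fψ̃)) ⟩
    U (h₅⁻¹ ^ 2 * (q ^ 4 * ψ̃ * (q * Ẽ ^ 2))) ≈⟨ U-cong (*-congˡ (solve 3 (λ q e z → q :^ 4 :* z :* (q :* e :^ 2) := q :^ 5 :* (e :* (e :* z))) ≋-refl q Ẽ ψ̃)) ⟩
    U (h₅⁻¹ ^ 2 * (q ^ 5 * (Ẽ * (Ẽ * ψ̃)))) ≈⟨ q⁵-out 2 _ ⟩
    h⁻¹ ^ 2 * q * U (Ẽ * (Ẽ * ψ̃)) ≈⟨ *-congˡ (U-cong (*-congˡ (≋-trans (≋-sym Ẽ₂²≋Ẽψ̃) (≋-sym (D-⊠ b b))))) ⟩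
    h⁻¹ ^ 2 * q * U (Ẽ * D (b ⊠ b)) ≈⟨ *-congˡ (≋-trans (U-cong (≋-sym (D-⊠ a (b ⊠ b)))) (≋-trans (U-D (a ⊠ (b ⊠ b))) ab²-c₀)) ⟩
    h⁻¹ ^ 2 * q * h ≈⟨ modulo₂ _ _ hh⁻¹ qh⁻¹≋G (solve 4 (λ q h i g → i :^ 2 :* q :* h := g :+ q :* i :* (h :* i :- :1) :+ :1 :* (q :* i :- g)) ≋-refl q h h⁻¹ G) ⟩
    G ∎

  U-Fu³ : U (F * u ^ 3) ≋ ⟪ φ₃ ⟫
  U-Fu³ = begin
    U (F * u ^ 3) ≈⟨ U-cong (*-congˡ (^-cong 3 u≋)) ⟩
    U (F * (h₅⁻¹ * (q ^ 2 * ψ̃)) ^ 3) ≈⟨ U-cong (solve 4 (λ f i q z → f :* (i :* (q :^ 2 :* z)) :^ 3 := i :^ 3 :* (q :^ 6 :* z :^ 2 :* (f :* z))) ≋-refl F h₅⁻¹ q ψ̃) ⟩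
    U (h₅⁻¹ ^ 3 * (q ^ 6 * ψ̃ ^ 2 * (F * ψ̃))) ≈⟨ U-cong (*-congˡ (*-congˡ Fψ̃)) ⟩
    U (h₅⁻¹ ^ 3 * (q ^ 6 * ψ̃ ^ 2 * (q * Ẽ ^ 2))) ≈⟨ U-cong (*-congˡ (solve 3 (λ q e z → q :^ 6 :* z :^ 2 :* (q :* e :^ 2) := q :^ 5 :* (q :^ 2 :* (e :* z) :^ 2)) ≋-refl q Ẽ ψ̃)) ⟩
    U (h₅⁻¹ ^ 3 * (q ^ 5 * (q ^ 2 * (Ẽ * ψ̃) ^ 2))) ≈⟨ q⁵-out 3 _ ⟩
    h⁻¹ ^ 3 * q * U (q ^ 2 * (Ẽ * ψ̃) ^ 2) ≈⟨ *-congˡ (U-cong (*-congˡ (≋-trans (^-cong 2 (≋-sym Ẽ₂²≋Ẽψ̃)) D-b⁴))) ⟩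
    h⁻¹ ^ 3 * q * U (q ^ 2 * D b⁴) ≈⟨ *-congˡ (≋-trans (U-q²D b⁴) (*-congˡ b⁴-c₃)) ⟩
    h⁻¹ ^ 3 * q * (q * (C (ℤ.- + 5) * q)) ≈⟨ solve 2 (λ q i → i :^ 3 :* q :* (q :* (con (ℤ.- + 5) :* q)) := :- (con (+ 5) :* (q :* i) :^ 3)) ≋-refl q h⁻¹ ⟩
    - (C (+ 5) * (q * h⁻¹) ^ 3) ≈⟨ -‿cong (*-congˡ (^-cong 3 qh⁻¹≋G)) ⟩
    ⟪ φ₃ ⟫ ∎

  U-Fu⁴ : U (F * u ^ 4) ≋ ⟪ φ₄ ⟫
  U-Fu⁴ = begin
    U (F * u ^ 4) ≈⟨ U-cong (*-congˡ (^-cong 4 u≋)) ⟩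
    U (F * (h₅⁻¹ * (q ^ 2 * ψ̃)) ^ 4) ≈⟨ U-cong (solve 4 (λ f i q z → f :* (i :* (q :^ 2 :* z)) :^ 4 := i :^ 4 :* (q :^ 8 :* z :^ 3 :* (f :* z))) ≋-refl F h₅⁻¹ q ψ̃) ⟩
    U (h₅⁻¹ ^ 4 * (q ^ 8 * ψ̃ ^ 3 * (F * ψ̃))) ≈⟨ U-cong (*-congˡ (*-congˡ Fψ̃)) ⟩
    U (h₅⁻¹ ^ 4 * (q ^ 8 * ψ̃ ^ 3 * (q * Ẽ ^ 2))) ≈⟨ U-cong (*-congˡ (solve 3 (λ q e z → q :^ 8 :* z :^ 3 :* (q :* e :^ 2) := q :^ 5 :* (q :^ 4 :* ((e :* z) :^ 2 :* z))) ≋-refl q Ẽ ψ̃)) ⟩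
    U (h₅⁻¹ ^ 4 * (q ^ 5 * (q ^ 4 * ((Ẽ * ψ̃) ^ 2 * ψ̃)))) ≈⟨ q⁵-out 4 _ ⟩
    h⁻¹ ^ 4 * q * U (q ^ 4 * ((Ẽ * ψ̃) ^ 2 * ψ̃)) ≈⟨ *-congˡ (U-cong (*-congˡ (*-cong (≋-trans (^-cong 2 (≋-sym Ẽ₂²≋Ẽψ̃)) D-b⁴) ≋-refl))) ⟩
    h⁻¹ ^ 4 * q * U (q ^ 4 * (D b⁴ * ψ̃)) ≈⟨ *-congˡ (U-cong (*-congˡ (≋-sym (D-⊠ b⁴ Z)))) ⟩
    h⁻¹ ^ 4 * q * U (q ^ 4 * D (b⁴ ⊠ Z)) ≈⟨ *-congˡ (≋-trans (U-q⁴D (b⁴ ⊠ Z)) (*-congˡ b⁴Z-c₁)) ⟩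
    h⁻¹ ^ 4 * q * (q * (h ^ 2 + C (+ 5) * q * h - C (+ 25) * q ^ 2))
      ≈⟨ solve 3 (λ q h i → i :^ 4 :* q :* (q :* (h :^ 2 :+ con (+ 5) :* q :* h :- con (+ 25) :* q :^ 2))
           := (q :* i) :^ 2 :* (h :* i) :^ 2 :+ con (+ 5) :* (q :* i) :^ 3 :* (h :* i) :- con (+ 25) :* (q :* i) :^ 4) ≋-refl q h h⁻¹ ⟩
    (q * h⁻¹) ^ 2 * (h * h⁻¹) ^ 2 + C (+ 5) * (q * h⁻¹) ^ 3 * (h * h⁻¹) - C (+ 25) * (q * h⁻¹) ^ 4
      ≈⟨ +-cong (+-cong (*-cong (^-cong 2 qh⁻¹≋G) (^-cong 2 hh⁻¹)) (*-cong (*-congˡ (^-cong 3 qh⁻¹≋G)) hh⁻¹)) (-‿cong (*-congˡ (^-cong 4 qh⁻¹≋G))) ⟩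
    G ^ 2 * 1# ^ 2 + C (+ 5) * G ^ 3 * 1# - C (+ 25) * G ^ 4
      ≈⟨ solve 1 (λ x → x :^ 2 :* :1 :^ 2 :+ con (+ 5) :* x :^ 3 :* :1 :- con (+ 25) :* x :^ 4 := x :^ 2 :+ con (+ 5) :* x :^ 3 :- con (+ 25) :* x :^ 4) ≋-refl G ⟩
    ⟪ φ₄ ⟫ ∎

  U-Fu⁵ : U (F * u ^ 5) ≋ ⟪ φ₅ ⟫
  U-Fu⁵ = begin
    U (F * u ^ 5) ≈⟨ U-cong (*-congˡ (^-cong 5 u≋)) ⟩
    U (F * (h₅⁻¹ * (q ^ 2 * ψ̃)) ^ 5) ≈⟨ U-cong (solve 4 (λ f i q z → f :* (i :* (q :^ 2 :* z)) :^ 5 := i :^ 5 :* (q :^ 10 :* z :^ 4 :* (f :* z))) ≋-refl F h₅⁻¹ q ψ̃) ⟩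
    U (h₅⁻¹ ^ 5 * (q ^ 10 * ψ̃ ^ 4 * (F * ψ̃))) ≈⟨ U-cong (*-congˡ (*-congˡ Fψ̃)) ⟩
    -- The power q¹¹ contains q⁵ twice. The inserted `:1` stands for `h₅⁻¹ ^ 0`, so that `q⁵-out`
    -- applies a second time.
    U (h₅⁻¹ ^ 5 * (q ^ 10 * ψ̃ ^ 4 * (q * Ẽ ^ 2))) ≈⟨ U-cong (*-congˡ (solve 3 (λ q e z → q :^ 10 :* z :^ 4 :* (q :* e :^ 2) := q :^ 5 :* (:1 :* (q :^ 5 :* (q :* ((e :* z) :^ 2 :* (z :* z)))))) ≋-refl q Ẽ ψ̃)) ⟩
    U (h₅⁻¹ ^ 5 * (q ^ 5 * (h₅⁻¹ ^ 0 * (q ^ 5 * (q * ((Ẽ * ψ̃) ^ 2 * (ψ̃ * ψ̃))))))) ≈⟨ q⁵-out 5 _ ⟩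
    h⁻¹ ^ 5 * q * U (h₅⁻¹ ^ 0 * (q ^ 5 * (q * ((Ẽ * ψ̃) ^ 2 * (ψ̃ * ψ̃))))) ≈⟨ *-congˡ (q⁵-out 0 _) ⟩
    h⁻¹ ^ 5 * q * (1# * q * U (q * ((Ẽ * ψ̃) ^ 2 * (ψ̃ * ψ̃)))) ≈⟨ *-congˡ (*-congˡ (U-cong (*-congˡ (*-cong (≋-trans (^-cong 2 (≋-sym Ẽ₂²≋Ẽψ̃)) D-b⁴) (≋-sym (D-⊠ Z Z)))))) ⟩
    h⁻¹ ^ 5 * q * (1# * q * U (q * (D b⁴ * D (Z ⊠ Z)))) ≈⟨ *-congˡ (*-congˡ (U-cong (*-congˡ (≋-sym (D-⊠ b⁴ (Z ⊠ Z)))))) ⟩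
    h⁻¹ ^ 5 * q * (1# * q * U (q * D (b⁴ ⊠ (Z ⊠ Z)))) ≈⟨ *-congˡ (*-congˡ (≋-trans (U-qD (b⁴ ⊠ (Z ⊠ Z))) (*-congˡ b⁴Z²-c₄))) ⟩
    h⁻¹ ^ 5 * q * (1# * q * (q * (C (ℤ.- + 25) * q ^ 2))) ≈⟨ solve 2 (λ q i → i :^ 5 :* q :* (:1 :* q :* (q :* (con (ℤ.- + 25) :* q :^ 2))) := :- (con (+ 25) :* (q :* i) :^ 5)) ≋-refl q h⁻¹ ⟩
    - (C (+ 25) * (q * h⁻¹) ^ 5) ≈⟨ -‿cong (*-congˡ (^-cong 5 qh⁻¹≋G)) ⟩
    ⟪ φ₅ ⟫ ∎

  G-cancel : ∀ {f g} → G * f ≋ G * g → f ≋ g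
  G-cancel {f} {g} p = q^-*-cancel 1 (begin
    q * f ≈⟨ *-cong (≋-sym Gh) ≋-refl ⟩
    G * h * f ≈⟨ solve 3 (λ g h f → g :* h :* f := h :* (g :* f)) ≋-refl G h f ⟩
    h * (G * f) ≈⟨ *-congˡ p ⟩
    h * (G * g) ≈⟨ solve 3 (λ g h f → h :* (g :* f) := g :* h :* f) ≋-refl G h g ⟩
    G * h * g ≈⟨ *-cong Gh ≋-refl ⟩
    q * g ∎)

  G^-cancel : ∀ k {f g} → G ^ k * f ≋ G ^ k * g → f ≋ g
  G^-cancel zero    p = ≋-trans (≋-sym (*-identityˡ _)) (≋-trans p (*-identityˡ _))
  G^-cancel (suc k) p = G^-cancel k (G-cancel (≋-trans (≋-sym (*-assoc G _ _)) (≋-trans p (*-assoc G _ _))))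

  -- The recurrence is run backwards: its lowest coefficient is G², which can be cancelled.
  U-Fu⁰ : U (F * u ^ 0) ≋ ⟪ φ₀ ⟫
  U-Fu⁰ = G^-cancel 2 (begin
    G ^ 2 * T
      ≈⟨ solve 2 (λ a r → a := a :+ r :- r) ≋-refl (G ^ 2 * T) R′ ⟩
    G ^ 2 * T + R′ - R′
      ≈⟨ +-cong (≋-sym (≋-trans (recurrence-at (π₀ x) (π₁ x) (π₂ x) (π₃ x) (π₄ x) u⁵ F 0)
           (≋-trans (+-cong (+-cong (+-cong (+-congˡ (*-congˡ U-Fu¹)) (*-congˡ U-Fu²)) (*-congˡ U-Fu³)) (*-congˡ U-Fu⁴))
             (solve 5 (λ a b c d e → a :+ b :+ c :+ d :+ e := a :+ (b :+ c :+ d :+ e)) ≋-refl _ _ _ _ _)))) ≋-refl ⟩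
    U (F * u ^ 5) - R′
      ≈⟨ +-cong U-Fu⁵ ≋-refl ⟩
    ⟪ φ₅ :- (π₁ x :* φ₁ :+ π₂ x :* φ₂ :+ π₃ x :* φ₃ :+ π₄ x :* φ₄) ⟫
      ≈⟨ evaluate (φ₅ :- (π₁ x :* φ₁ :+ π₂ x :* φ₂ :+ π₃ x :* φ₃ :+ π₄ x :* φ₄)) (x :^ 2 :* φ₀) ≋-refl ⟩
    G ^ 2 * ⟪ φ₀ ⟫ ∎)
    where
    T R′ : Series
    T = U (F * u ^ 0)
    R′ = ⟪ π₁ x :* φ₁ :+ π₂ x :* φ₂ :+ π₃ x :* φ₃ :+ π₄ x :* φ₄ ⟫

  U-Fu⁶ : U (F * u ^ 6) ≋ ⟪ φ₆ ⟫
  U-Fu⁶ = ≋-trans (next F 1 φ₁ φ₂ φ₃ φ₄ φ₅ U-Fu¹ U-Fu² U-Fu³ U-Fu⁴ U-Fu⁵) (evaluate (u-step φ₁ φ₂ φ₃ φ₄ φ₅) φ₆ ≋-refl)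

  U-Fu⁷ : U (F * u ^ 7) ≋ ⟪ φ₇ ⟫
  U-Fu⁷ = ≋-trans (next F 2 φ₂ φ₃ φ₄ φ₅ φ₆ U-Fu² U-Fu³ U-Fu⁴ U-Fu⁵ U-Fu⁶) (evaluate (u-step φ₂ φ₃ φ₄ φ₅ φ₆) φ₇ ≋-refl)

  U-Fu⁸ : U (F * u ^ 8) ≋ ⟪ φ₈ ⟫
  U-Fu⁸ = ≋-trans (next F 3 φ₃ φ₄ φ₅ φ₆ φ₇ U-Fu³ U-Fu⁴ U-Fu⁵ U-Fu⁶ U-Fu⁷) (evaluate (u-step φ₃ φ₄ φ₅ φ₆ φ₇) φ₈ ≋-refl)

-- The 5-adic filtration

opaque
  monomial : ℕ → ℕ → Series
  monomial w k = C (+ (5 ℕ.^ w)) * G ^ k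

  monomial≋ : ∀ w k → monomial w k ≋ C (+ (5 ℕ.^ w)) * G ^ k
  monomial≋ w k = ≋-refl

-- The ℤ-span of the monomials 5ʷGᵏ with P w k.
data Span (P : ℕ → ℕ → Set) (f : Series) : Set where
  nil  : f ≋ 0# → Span P f
  cons : ∀ c w k g → P w k → Span P g → f ≋ C c * monomial w k + g → Span P f

module _ where
  open Solver

  module _ {P : ℕ → ℕ → Set} where

    Span-resp : ∀ {f g} → f ≋ g → Span P f → Span P g
    Span-resp p (nil r)              = nil (≋-trans (≋-sym p) r)
    Span-resp p (cons c w k g Pwk s r) = cons c w k g Pwk s (≋-trans (≋-sym p) r)

    Span-+ : ∀ {f g} → Span P f → Span P g → Span P (f + g)
    Span-+ (nil r) t = Span-resp (≋-sym (≋-trans (+-cong r ≋-refl) (+-identityˡ _))) t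
    Span-+ (cons c w k f′ Pwk s r) t = cons c w k _ Pwk (Span-+ s t) (≋-trans (+-cong r ≋-refl) (+-assoc _ _ _))

    Span-· : ∀ {f} c → Span P f → Span P (C c * f)
    Span-· c (nil r) = nil (≋-trans (*-congˡ r) (zeroʳ _))
    Span-· c (cons d w k f′ Pwk s r) = cons (c ℤ.* d) w k _ Pwk (Span-· c s) (≋-trans (*-congˡ r)
      (≋-trans (solve 4 (λ c d m f → c :* (d :* m :+ f) := c :* d :* m :+ c :* f) ≋-refl (C c) (C d) (monomial w k) f′)
        (+-cong (*-cong (≋-sym (C-* c d)) ≋-refl) ≋-refl)))

    Span-monomial : ∀ w k → P w k → Span P (monomial w k)
    Span-monomial w k Pwk = cons 1ℤ w k 0# Pwk (nil ≋-refl) (solve 1 (λ m → m := con 1ℤ :* m :+ con 0ℤ) ≋-refl (monomial w k))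

  record Linear (T : Series → Series) : Set where
    field
      T-cong : ∀ {f g} → f ≋ g → T f ≋ T g
      T-+    : ∀ f g → T (f + g) ≋ T f + T g
      T-·    : ∀ c f → T (C c * f) ≋ C c * T f

  Span-linear : ∀ {P P′ T f} → Linear T → (∀ w k → P w k → Span P′ (T (monomial w k))) → Span P f → Span P′ (T f)
  Span-linear {T = T} lin onMonomials (nil r) = nil (begin
    T _ ≈⟨ T-cong (≋-trans r (solve 1 (λ z → con 0ℤ := con 0ℤ :* z) ≋-refl 0#)) ⟩
    T (C 0ℤ * 0#) ≈⟨ T-· 0ℤ 0# ⟩
    C 0ℤ * T 0# ≈⟨ zeroˡ _ ⟩
    0# ∎)
    where
    open Linear lin
    open ≋-Reasoning
  Span-linear {T = T} lin onMonomials (cons c w k g Pwk s r) = Span-resp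
    (≋-sym (≋-trans (T-cong r) (≋-trans (T-+ _ g) (+-cong (T-· c _) ≋-refl))))
    (Span-+ (Span-· c (onMonomials w k Pwk)) (Span-linear lin onMonomials s))
    where open Linear lin

  *-linear : ∀ g → Linear (g *_)
  *-linear g = record
    { T-cong = *-congˡ
    ; T-+    = distribˡ g
    ; T-·    = λ c f → solve 3 (λ g c f → g :* (c :* f) := c :* (g :* f)) ≋-refl g (C c) f }

  monomial-* : ∀ w w′ k k′ → monomial w k * monomial w′ k′ ≋ monomial (w ℕ.+ w′) (k ℕ.+ k′)
  monomial-* w w′ k k′ = begin
    monomial w k * monomial w′ k′ ≈⟨ *-cong (monomial≋ w k) (monomial≋ w′ k′) ⟩
    C (+ (5 ℕ.^ w)) * G ^ k * (C (+ (5 ℕ.^ w′)) * G ^ k′) ≈⟨ solve 4 (λ a b c d → a :* b :* (c :* d) := a :* c :* (:1 :* d :* b)) ≋-refl (C (+ (5 ℕ.^ w))) (G ^ k) (C (+ (5 ℕ.^ w′))) (G ^ k′) ⟩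
    C (+ (5 ℕ.^ w)) * C (+ (5 ℕ.^ w′)) * (1# * G ^ k′ * G ^ k) ≈⟨ *-cong (≋-sym (C-* (+ (5 ℕ.^ w)) (+ (5 ℕ.^ w′)))) (*-^-+ 1# G k k′) ⟩
    C (+ (5 ℕ.^ w) ℤ.* + (5 ℕ.^ w′)) * (1# * G ^ (k ℕ.+ k′)) ≈⟨ *-cong (pointwise λ n → cong (λ z → C z n)
                                                                     (trans (sym (ℤ.pos-* (5 ℕ.^ w) (5 ℕ.^ w′))) (cong +_ (sym (ℕ.^-distribˡ-+-* 5 w w′))))) (*-identityˡ _) ⟩
    C (+ (5 ℕ.^ (w ℕ.+ w′))) * G ^ (k ℕ.+ k′) ≈⟨ ≋-sym (monomial≋ (w ℕ.+ w′) (k ℕ.+ k′)) ⟩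
    monomial (w ℕ.+ w′) (k ℕ.+ k′) ∎
    where open ≋-Reasoning

  Span-* : ∀ {P P′ P″ f g} → (∀ {w w′ k k′} → P w k → P′ w′ k′ → P″ (w ℕ.+ w′) (k ℕ.+ k′)) →
    Span P f → Span P′ g → Span P″ (f * g)
  Span-* {f = f} PP′ s t = Span-linear (*-linear f) (λ w′ k′ P′w′k′ → Span-resp (*-comm _ f)
    (Span-linear (*-linear (monomial w′ k′)) (λ w k Pwk → Span-resp (≋-trans (≋-sym (monomial-* w w′ k k′)) (*-comm _ _))
      (Span-monomial _ _ (PP′ Pwk P′w′k′))) s)) t

  -- The monomials of M(c) that are divisible by 5ᵃ and by Gᵇ.
  Bounded : (a b c : ℕ) → ℕ → ℕ → Set
  Bounded a b c w k = a ℕ.≤ w × b ℕ.≤ k × 5 ℕ.* k ℕ.≤ 6 ℕ.* w ℕ.+ c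

  bounded? : ∀ a b c w k → Dec (Bounded a b c w k)
  bounded? a b c w k = (a ℕ.≤? w) ×-dec (b ℕ.≤? k) ×-dec (5 ℕ.* k ℕ.≤? 6 ℕ.* w ℕ.+ c)

  Bounded-* : ∀ a b c {a′ b′ c′ w w′ k k′} → Bounded a b c w k → Bounded a′ b′ c′ w′ k′ →
    Bounded (a ℕ.+ a′) (b ℕ.+ b′) (c ℕ.+ c′) (w ℕ.+ w′) (k ℕ.+ k′)
  Bounded-* a b c {a′} {b′} {c′} {w} {w′} {k} {k′} (a≤w , b≤k , le) (a′≤w′ , b′≤k′ , le′) =
    ℕ.+-mono-≤ a≤w a′≤w′ , ℕ.+-mono-≤ b≤k b′≤k′ ,
    (begin
      5 ℕ.* (k ℕ.+ k′) ≡⟨ ℕ.*-distribˡ-+ 5 k k′ ⟩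
      5 ℕ.* k ℕ.+ 5 ℕ.* k′ ≤⟨ ℕ.+-mono-≤ le le′ ⟩
      6 ℕ.* w ℕ.+ c ℕ.+ (6 ℕ.* w′ ℕ.+ c′) ≡⟨ N.solve 4 (λ w c w′ c′ → N.con 6 N.:* w N.:+ c N.:+ (N.con 6 N.:* w′ N.:+ c′) N.:= N.con 6 N.:* (w N.:+ w′) N.:+ (c N.:+ c′)) refl w c w′ c′ ⟩
      6 ℕ.* (w ℕ.+ w′) ℕ.+ (c ℕ.+ c′) ∎)
    where
    open ℕ.≤-Reasoning
    module N = ℕ-Solver

  expansion : List (ℤ × ℕ × ℕ) → Polynomial 1
  expansion []                 = con 0ℤ
  expansion ((c , w , k) ∷ ts) = con c :* (con (+ (5 ℕ.^ w)) :* x :^ k) :+ expansion ts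

  Span-expansion : ∀ {P} ts → All (λ t → P (proj₁ (proj₂ t)) (proj₂ (proj₂ t))) ts → Span P ⟪ expansion ts ⟫
  Span-expansion [] [] = nil ≋-refl
  Span-expansion ((c , w , k) ∷ ts) (Pwk ∷ Pts) = cons c w k _ Pwk (Span-expansion ts Pts)
    (+-cong (*-congˡ (≋-trans (*-congˡ (power k)) (≋-sym (monomial≋ w k)))) ≋-refl)
    where
    power : ∀ k → ⟪ x :^ k ⟫ ≋ G ^ k
    power zero    = ≋-refl
    power (suc k) = *-congˡ (power k)

  -- `ts` is a certificate: an explicit list of monomials whose bounds are decided by evaluation and
  -- whose sum the normaliser compares with `p`.
  Span-⟪⟫ : ∀ a b c p ts → {True (all? (λ t → bounded? a b c (proj₁ (proj₂ t)) (proj₂ (proj₂ t))) ts)} →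
    ⟦ expansion ts ⟧↓ (G ∷ []) ≋ ⟦ p ⟧↓ (G ∷ []) → Span (Bounded a b c) ⟪ p ⟫
  Span-⟪⟫ a b c p ts {bounds} eq = Span-resp (evaluate (expansion ts) p eq) (Span-expansion ts (toWitness bounds))

  -- For each i the extreme monomial 5ⁱG^(i+1) of κᵢ attains 5k = 6w + 5 - i. The slope 6/5 thus
  -- fits all five coefficients at once.
  Span-κ₀ : Span (Bounded 0 1 5) ⟪ κ₀ x ⟫
  Span-κ₀ = Span-⟪⟫ 0 1 5 (κ₀ x) ((+ 1 , 0 , 1) ∷ []) ≋-refl

  Span-κ₁ : Span (Bounded 0 1 4) ⟪ κ₁ x ⟫
  Span-κ₁ = Span-⟪⟫ 0 1 4 (κ₁ x) ((+ 1 , 1 , 2) ∷ (-[1+ 1 ] , 1 , 1) ∷ []) ≋-refl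

  Span-κ₂ : Span (Bounded 0 1 3) ⟪ κ₂ x ⟫
  Span-κ₂ = Span-⟪⟫ 0 1 3 (κ₂ x) ((+ 1 , 2 , 3) ∷ (-[1+ 1 ] , 2 , 2) ∷ (+ 7 , 1 , 1) ∷ []) ≋-refl

  Span-κ₃ : Span (Bounded 0 1 2) ⟪ κ₃ x ⟫
  Span-κ₃ = Span-⟪⟫ 0 1 2 (κ₃ x) ((+ 1 , 3 , 4) ∷ (-[1+ 1 ] , 3 , 3) ∷ (+ 7 , 2 , 2) ∷ (-[1+ 11 ] , 1 , 1) ∷ []) ≋-refl

  Span-κ₄ : Span (Bounded 0 1 1) ⟪ κ₄ x ⟫
  Span-κ₄ = Span-⟪⟫ 0 1 1 (κ₄ x) ((+ 1 , 4 , 5) ∷ (-[1+ 1 ] , 4 , 4) ∷ (+ 7 , 3 , 3) ∷ (-[1+ 11 ] , 2 , 2) ∷ (+ 11 , 1 , 1) ∷ []) ≋-refl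

  Bounded-weaken : ∀ {a b c w k} → Bounded a b c w k → Bounded 0 0 c w k
  Bounded-weaken (_ , _ , le) = ℕ.z≤n , ℕ.z≤n , le

  Span-mono : ∀ {P P′ f} → (∀ {w k} → P w k → P′ w k) → Span P f → Span P′ f
  Span-mono P⊆P′ (nil r) = nil r
  Span-mono P⊆P′ (cons c w k g Pwk s r) = cons c w k g (P⊆P′ Pwk) (Span-mono P⊆P′ s) r

  -- The factor u⁸ makes the first values U(φ Gˢ⁻⁴) of the recurrence polynomial
  -- in G: as Gu² = Γ, it turns Gˢ into Γ⁴Gˢ⁻⁴.
  module Growth (φ : Series) (c : ℕ) where

    Value : ℕ → ℕ → Set
    Value b s = Σ[ X ∈ Series ] Span (Bounded 0 b (s ℕ.+ c)) X × U (φ * u ^ 8 * G ^ s) ≋ G ^ 4 * X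

    weaken : ∀ {b s} → Value b s → Value 0 s
    weaken (X , s , eq) = X , Span-mono Bounded-weaken s , eq

    -- The bounds fit together because κᵢ lies in M(5-i) and the value at s+i in M(s+i+c). As G
    -- divides every κᵢ, each new value is divisible by G.
    step : ∀ s → Value 0 s → Value 0 (1 ℕ.+ s) → Value 0 (2 ℕ.+ s) → Value 0 (3 ℕ.+ s) → Value 0 (4 ℕ.+ s) → Value 1 (5 ℕ.+ s)
    step s (X₀ , s₀ , e₀) (X₁ , s₁ , e₁) (X₂ , s₂ , e₂) (X₃ , s₃ , e₃) (X₄ , s₄ , e₄) =
      ⟪ κ₀ x ⟫ * X₀ + ⟪ κ₁ x ⟫ * X₁ + ⟪ κ₂ x ⟫ * X₂ + ⟪ κ₃ x ⟫ * X₃ + ⟪ κ₄ x ⟫ * X₄ ,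
      Span-+ (Span-+ (Span-+ (Span-+ (Span-* (Bounded-* 0 1 5) Span-κ₀ s₀) (Span-* (Bounded-* 0 1 4) Span-κ₁ s₁))
        (Span-* (Bounded-* 0 1 3) Span-κ₂ s₂)) (Span-* (Bounded-* 0 1 2) Span-κ₃ s₃)) (Span-* (Bounded-* 0 1 1) Span-κ₄ s₄) ,
      ≋-trans (recurrence-at (κ₀ x) (κ₁ x) (κ₂ x) (κ₃ x) (κ₄ x) G⁵ (φ * u ^ 8) s)
        (≋-trans (+-cong (+-cong (+-cong (+-cong (*-congˡ e₀) (*-congˡ e₁)) (*-congˡ e₂)) (*-congˡ e₃)) (*-congˡ e₄))
          (solve 11 (λ g k₀ k₁ k₂ k₃ k₄ x₀ x₁ x₂ x₃ x₄ →
            k₀ :* (g :* x₀) :+ k₁ :* (g :* x₁) :+ k₂ :* (g :* x₂) :+ k₃ :* (g :* x₃) :+ k₄ :* (g :* x₄)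
            := g :* (k₀ :* x₀ :+ k₁ :* x₁ :+ k₂ :* x₂ :+ k₃ :* x₃ :+ k₄ :* x₄)) ≋-refl (G ^ 4) ⟪ κ₀ x ⟫ ⟪ κ₁ x ⟫ ⟪ κ₂ x ⟫ ⟪ κ₃ x ⟫ ⟪ κ₄ x ⟫ X₀ X₁ X₂ X₃ X₄))

    module _ (v₀ : Value 0 0) (v₁ : Value 0 1) (v₂ : Value 0 2) (v₃ : Value 0 3) (v₄ : Value 0 4) where

      Window : ℕ → Set
      Window s = Value 0 s × Value 0 (1 ℕ.+ s) × Value 0 (2 ℕ.+ s) × Value 0 (3 ℕ.+ s) × Value 0 (4 ℕ.+ s)

      new : ∀ s → Window s → Value 1 (5 ℕ.+ s)
      new s (a₀ , a₁ , a₂ , a₃ , a₄) = step s a₀ a₁ a₂ a₃ a₄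

      slide : ∀ s → Window s → Window (suc s)
      slide s as@(a₀ , a₁ , a₂ , a₃ , a₄) = a₁ , a₂ , a₃ , a₄ , weaken {s = 5 ℕ.+ s} (new s as)

      window : ∀ s → Window s
      window zero    = v₀ , v₁ , v₂ , v₃ , v₄
      window (suc s) = slide s (window s)

      U-φG^ : ∀ s → Span (Bounded 0 1 (5 ℕ.+ s ℕ.+ c)) (U (φ * G ^ (1 ℕ.+ s)))
      U-φG^ s = Span-resp (G^-cancel 4 (≋-trans (≋-sym (proj₂ (proj₂ value))) reduce)) (proj₁ (proj₂ value))
        where
        open ≋-Reasoning
        value : Value 1 (5 ℕ.+ s)
        value = new s (window s)
        reduce : U (φ * u ^ 8 * G ^ (5 ℕ.+ s)) ≋ G ^ 4 * U (φ * G ^ (1 ℕ.+ s))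
        reduce = begin
          U (φ * u ^ 8 * G ^ (5 ℕ.+ s)) ≈⟨ U-cong (solve 4 (λ f u g p → f :* u :^ 8 :* (g :* (g :* (g :* (g :* p)))) := (g :* u :^ 2) :^ 4 :* (f :* p)) ≋-refl φ u G (G ^ (1 ℕ.+ s))) ⟩
          U ((G * u ^ 2) ^ 4 * (φ * G ^ (1 ℕ.+ s))) ≈⟨ U-cong (*-cong (^-cong 4 Gu²) ≋-refl) ⟩
          U (⟪ x :^ 4 ⟫₅ * (φ * G ^ (1 ℕ.+ s))) ≈⟨ U-⟪⟫ (x :^ 4) (φ * G ^ (1 ℕ.+ s)) ⟩
          G ^ 4 * U (φ * G ^ (1 ℕ.+ s)) ∎

    -- By u⁸Gˢ = Γˢu^(8-2s), the five initial values come from U(φuʲ) with j = 8, 6, 4, 2, 0.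
    initial : ∀ s j t r → s ℕ.* 2 ℕ.+ j ≡ 8 → U (φ * u ^ j) ≋ ⟪ t ⟫ →
      G ^ s * ⟪ t ⟫ ≋ G ^ 4 * ⟪ r ⟫ → Span (Bounded 0 0 (s ℕ.+ c)) ⟪ r ⟫ → Value 0 s
    initial s j t r 2s+j≡8 value eq span = ⟪ r ⟫ , span , (begin
      U (φ * u ^ 8 * G ^ s) ≈⟨ U-cong (subst (λ k → φ * u ^ k * G ^ s ≋ (G * u ^ 2) ^ s * (φ * u ^ j)) 2s+j≡8 (regroup s)) ⟩
      U ((G * u ^ 2) ^ s * (φ * u ^ j)) ≈⟨ U-cong (*-cong (≋-trans (^-cong s Gu²) (≋-sym (S-^ 5 G s))) ≋-refl) ⟩
      U (S 5 (G ^ s) * (φ * u ^ j)) ≈⟨ U-S (G ^ s) (φ * u ^ j) ⟩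
      G ^ s * U (φ * u ^ j) ≈⟨ *-congˡ value ⟩
      G ^ s * ⟪ t ⟫ ≈⟨ eq ⟩
      G ^ 4 * ⟪ r ⟫ ∎)
      where
      open ≋-Reasoning
      regroup : ∀ s → φ * u ^ (s ℕ.* 2 ℕ.+ j) * G ^ s ≋ (G * u ^ 2) ^ s * (φ * u ^ j)
      regroup zero    = *-comm _ _
      regroup (suc s) = begin
        φ * (u * (u * u ^ (s ℕ.* 2 ℕ.+ j))) * (G * G ^ s) ≈⟨ solve 5 (λ f u v g p → f :* (u :* (u :* v)) :* (g :* p) := g :* u :^ 2 :* (f :* v :* p)) ≋-refl φ u (u ^ (s ℕ.* 2 ℕ.+ j)) G (G ^ s) ⟩
        G * u ^ 2 * (φ * u ^ (s ℕ.* 2 ℕ.+ j) * G ^ s) ≈⟨ *-congˡ (regroup s) ⟩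
        G * u ^ 2 * ((G * u ^ 2) ^ s * (φ * u ^ j)) ≈⟨ ≋-sym (*-assoc _ _ _) ⟩
        (G * u ^ 2) ^ suc s * (φ * u ^ j) ∎

  -- For φ = 1 the shift 2 is dictated by the initial values: their monomials 125G⁴, 25G³, 5G², G at
  -- s = 0, 1, 2, 3 all attain the bound. For F the initial values fit without a shift.
  module Growth-1 = Growth 1# 2
  module Growth-F = Growth F 0

  U-G^ : ∀ s → Span (Bounded 0 1 (7 ℕ.+ s)) (U (G ^ (1 ℕ.+ s)))
  U-G^ s = Span-mono (λ {w} (a , b , le) → a , b , ℕ.≤-trans le (ℕ.≤-reflexive (cong (λ z → 6 ℕ.* w ℕ.+ (5 ℕ.+ z)) (ℕ.+-comm s 2))))
    (Span-resp (U-cong (*-identityˡ _)) (Growth-1.U-φG^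
      (Growth-1.initial 0 8 τ₈ ρ₀ refl U-u⁸ (evaluate (x :^ 0 :* τ₈) (x :^ 4 :* ρ₀) ≋-refl) (Span-⟪⟫ 0 0 2 ρ₀ ((+ 126 , 0 , 0) ∷ (-[1+ 0 ] , 3 , 4) ∷ []) ≋-refl))
      (Growth-1.initial 1 6 τ₆ ρ₁ refl U-u⁶ (evaluate (x :^ 1 :* τ₆) (x :^ 4 :* ρ₁) ≋-refl) (Span-⟪⟫ 0 0 3 ρ₁ ((+ 26 , 0 , 0) ∷ (-[1+ 0 ] , 2 , 3) ∷ []) ≋-refl))
      (Growth-1.initial 2 4 τ₄ ρ₂ refl U-u⁴ (evaluate (x :^ 2 :* τ₄) (x :^ 4 :* ρ₂) ≋-refl) (Span-⟪⟫ 0 0 4 ρ₂ ((+ 6 , 0 , 0) ∷ (-[1+ 0 ] , 1 , 2) ∷ []) ≋-refl))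
      (Growth-1.initial 3 2 τ₂ ρ₃ refl U-u² (evaluate (x :^ 3 :* τ₂) (x :^ 4 :* ρ₃) ≋-refl) (Span-⟪⟫ 0 0 5 ρ₃ ((+ 2 , 0 , 0) ∷ (-[1+ 0 ] , 0 , 1) ∷ []) ≋-refl))
      (Growth-1.initial 4 0 τ₀ ρ₄ refl U-u⁰ (evaluate (x :^ 4 :* τ₀) (x :^ 4 :* ρ₄) ≋-refl) (Span-⟪⟫ 0 0 6 ρ₄ ((+ 1 , 0 , 0) ∷ []) ≋-refl)) s))
    where
    ρ₀ ρ₁ ρ₂ ρ₃ ρ₄ : Polynomial 1
    ρ₀ = con (+ 126) :- 125 :· 4
    ρ₁ = con (+ 26) :- 25 :· 3
    ρ₂ = con (+ 6) :- 5 :· 2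
    ρ₃ = con (+ 2) :- x
    ρ₄ = con (+ 1)

  private
    ς₀ ς₁ ς₂ ς₃ ς₄ : Polynomial 1
    ς₀ = 85 :· 1 :- con (+ 5) :- 300 :· 2 :+ 625 :· 4
    ς₁ = 35 :· 1 :- con (+ 1) :- 150 :· 2 :+ 125 :· 3
    ς₂ = con (+ 1) :+ 5 :· 1 :- 25 :· 2
    ς₃ = con (+ 1)
    ς₄ = 5 :· 1

    v₀ : Growth-F.Value 0 0
    v₀ = Growth-F.initial 0 8 φ₈ ς₀ refl U-Fu⁸ (evaluate (x :^ 0 :* φ₈) (x :^ 4 :* ς₀) ≋-refl) (Span-⟪⟫ 0 0 0 ς₀ ((+ 17 , 1 , 1) ∷ (-[1+ 0 ] , 1 , 0) ∷ (-[1+ 11 ] , 2 , 2) ∷ (+ 1 , 4 , 4) ∷ []) ≋-refl)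
    v₁ : Growth-F.Value 0 1
    v₁ = Growth-F.initial 1 6 φ₆ ς₁ refl U-Fu⁶ (evaluate (x :^ 1 :* φ₆) (x :^ 4 :* ς₁) ≋-refl) (Span-⟪⟫ 0 0 1 ς₁ ((+ 7 , 1 , 1) ∷ (-[1+ 0 ] , 0 , 0) ∷ (-[1+ 5 ] , 2 , 2) ∷ (+ 1 , 3 , 3) ∷ []) ≋-refl)
    v₂ : Growth-F.Value 0 2
    v₂ = Growth-F.initial 2 4 φ₄ ς₂ refl U-Fu⁴ (evaluate (x :^ 2 :* φ₄) (x :^ 4 :* ς₂) ≋-refl) (Span-⟪⟫ 0 0 2 ς₂ ((+ 1 , 0 , 0) ∷ (+ 1 , 1 , 1) ∷ (-[1+ 0 ] , 2 , 2) ∷ []) ≋-refl)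
    v₃ : Growth-F.Value 0 3
    v₃ = Growth-F.initial 3 2 φ₂ ς₃ refl U-Fu² (evaluate (x :^ 3 :* φ₂) (x :^ 4 :* ς₃) ≋-refl) (Span-⟪⟫ 0 0 3 ς₃ ((+ 1 , 0 , 0) ∷ []) ≋-refl)
    v₄ : Growth-F.Value 0 4
    v₄ = Growth-F.initial 4 0 φ₀ ς₄ refl U-Fu⁰ (evaluate (x :^ 4 :* φ₀) (x :^ 4 :* ς₄) ≋-refl) (Span-⟪⟫ 0 0 4 ς₄ ((+ 1 , 1 , 1) ∷ []) ≋-refl)

  U-FG^ : ∀ s → Span (Bounded 0 1 (5 ℕ.+ s)) (U (F * G ^ (1 ℕ.+ s)))
  U-FG^ s = Span-mono (λ (a , b , le) → a , b , ℕ.≤-trans le (ℕ.≤-reflexive (cong (λ z → _ ℕ.+ (5 ℕ.+ z)) (ℕ.+-identityʳ s))))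
    (Growth-F.U-φG^ v₀ v₁ v₂ v₃ v₄ s)

  -- This improvement on U-FG^ is the source of the factor 5 gained in each L_{2α+1}.
  U-FG : Span (Bounded 1 1 5) (U (F * G ^ 1))
  U-FG = Span-resp (G^-cancel 4 (≋-sym (≋-trans (≋-sym reduce) value)))
    (Span-⟪⟫ 1 1 5 r ((-[1+ 3 ] , 1 , 1) ∷ (+ 61 , 1 , 2) ∷ (-[1+ 58 ] , 2 , 3) ∷ (+ 31 , 3 , 4) ∷ (-[1+ 8 ] , 4 , 5) ∷ (+ 1 , 5 , 6) ∷ []) ≋-refl)
    where
    open ≋-Reasoning
    r : Polynomial 1
    r = 305 :· 2 :- 20 :· 1 :- 1475 :· 3 :+ 3875 :· 4 :- 5625 :· 5 :+ 3125 :· 6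
    step : Polynomial 1
    -- Modulo 5 only the product κ₀ς₀ survives here, and 5 divides ς₀. This is where the factor 5 of
    -- U(FG) comes from.
    step = κ₀ x :* (x :^ 4 :* ς₀) :+ κ₁ x :* (x :^ 4 :* ς₁) :+ κ₂ x :* (x :^ 4 :* ς₂) :+ κ₃ x :* (x :^ 4 :* ς₃) :+ κ₄ x :* (x :^ 4 :* ς₄)
    reduce : U (F * u ^ 8 * G ^ 5) ≋ G ^ 4 * U (F * G ^ 1)
    reduce = begin
      U (F * u ^ 8 * G ^ 5) ≈⟨ U-cong (solve 3 (λ f u g → f :* u :^ 8 :* g :^ 5 := (g :* u :^ 2) :^ 4 :* (f :* g :^ 1)) ≋-refl F u G) ⟩
      U ((G * u ^ 2) ^ 4 * (F * G ^ 1)) ≈⟨ U-cong (*-cong (^-cong 4 Gu²) ≋-refl) ⟩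
      U (⟪ x :^ 4 ⟫₅ * (F * G ^ 1)) ≈⟨ U-⟪⟫ (x :^ 4) (F * G ^ 1) ⟩
      G ^ 4 * U (F * G ^ 1) ∎
    value : U (F * u ^ 8 * G ^ 5) ≋ G ^ 4 * ⟪ r ⟫
    value = ≋-trans (recurrence-at (κ₀ x) (κ₁ x) (κ₂ x) (κ₃ x) (κ₄ x) G⁵ (F * u ^ 8) 0)
      (≋-trans (+-cong (+-cong (+-cong (+-cong (*-congˡ (eq v₀)) (*-congˡ (eq v₁))) (*-congˡ (eq v₂))) (*-congˡ (eq v₃))) (*-congˡ (eq v₄)))
        (evaluate step (x :^ 4 :* r) ≋-refl))
      where
      eq : ∀ {s} (v : Growth-F.Value 0 s) → U (F * u ^ 8 * G ^ s) ≋ G ^ 4 * proj₁ v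
      eq v = proj₂ (proj₂ v)

-- The multiples of G in 5ᵃM(11) and 5ᵃM(8); the summand 6a accounts for the factor 5ᵃ without a
-- subtraction. The threshold 11 = 5 + 6 arises because U(FG) lies in M(5) and is divisible by 5,
-- hence lies in 5M(11); the threshold 8 because U(G²) lies in M(8).
Odd Even : ℕ → ℕ → ℕ → Set
Odd  a w k = a ℕ.≤ w × 1 ℕ.≤ k × 5 ℕ.* k ℕ.+ 6 ℕ.* a ℕ.≤ 6 ℕ.* w ℕ.+ 11
Even a w k = a ℕ.≤ w × 1 ℕ.≤ k × 5 ℕ.* k ℕ.+ 6 ℕ.* a ℕ.≤ 6 ℕ.* w ℕ.+ 8

module _ where
  open Solver

  U-linear : Linear U
  U-linear = record
    { T-cong = U-cong
    ; T-+    = U-+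
    ; T-·    = λ c f → ≋-trans (U-cong (*-cong (≋-sym (S-C 5 c)) ≋-refl)) (U-S (C c) f) }

  UF-linear : Linear (λ f → U (F * f))
  UF-linear = record
    { T-cong = λ p → U-cong (*-congˡ p)
    ; T-+    = λ f g → ≋-trans (U-cong (distribˡ F f g)) (U-+ (F * f) (F * g))
    ; T-·    = λ c f → ≋-trans (U-cong (solve 3 (λ F c f → F :* (c :* f) := c :* (F :* f)) ≋-refl F (C c) f)) (Linear.T-· U-linear c (F * f)) }

  Span-5^ : ∀ {P P′ f} w → (∀ {w′ k} → P w′ k → P′ (w ℕ.+ w′) k) → Span P f → Span P′ (C (+ (5 ℕ.^ w)) * f)
  Span-5^ w shift s = Span-linear (*-linear (C (+ (5 ℕ.^ w)))) (λ w′ k Pw′k → Span-resp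
    (≋-trans (≋-sym (monomial-* w w′ 0 k)) (*-cong (≋-trans (monomial≋ w 0) (*-identityʳ _)) ≋-refl)) (Span-monomial _ _ (shift Pw′k))) s

  private module N = ℕ-Solver

  -- In M(11) both G and G² may occur without a factor 5, and for these a ≤ w is enough, just so for
  -- G². From G³ on, the bound of `Odd` itself is strong enough, since 5j shrinks to j.
  exponent-even : ∀ {a w j} → Odd a w (1 ℕ.+ j) → 7 ℕ.+ j ℕ.+ 6 ℕ.* a ℕ.≤ 6 ℕ.* w ℕ.+ 8
  exponent-even {a} {w} {0} (a≤w , _ , _) = ℕ.≤-trans (ℕ.≤-reflexive (ℕ.+-comm 7 (6 ℕ.* a))) (ℕ.+-mono-≤ (ℕ.*-monoʳ-≤ 6 a≤w) (ℕ.n≤1+n 7))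
  exponent-even {a} {w} {1} (a≤w , _ , _) = ℕ.≤-trans (ℕ.≤-reflexive (ℕ.+-comm 8 (6 ℕ.* a))) (ℕ.+-mono-≤ (ℕ.*-monoʳ-≤ 6 a≤w) ℕ.≤-refl)
  exponent-even {a} {w} {suc (suc j)} (_ , _ , le) = ℕ.+-cancelʳ-≤ 3 _ _ (begin
    9 ℕ.+ j ℕ.+ 6 ℕ.* a ℕ.+ 3 ≤⟨ ℕ.m≤m+n _ (3 ℕ.+ 4 ℕ.* j) ⟩
    9 ℕ.+ j ℕ.+ 6 ℕ.* a ℕ.+ 3 ℕ.+ (3 ℕ.+ 4 ℕ.* j) ≡⟨ N.solve 2 (λ j a → N.con 9 N.:+ j N.:+ N.con 6 N.:* a N.:+ N.con 3 N.:+ (N.con 3 N.:+ N.con 4 N.:* j)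
                                                            N.:= N.con 5 N.:* (N.con 3 N.:+ j) N.:+ N.con 6 N.:* a) refl j a ⟩
    5 ℕ.* (3 ℕ.+ j) ℕ.+ 6 ℕ.* a ≤⟨ le ⟩
    6 ℕ.* w ℕ.+ 11 ≡⟨ sym (ℕ.+-assoc (6 ℕ.* w) 8 3) ⟩
    6 ℕ.* w ℕ.+ 8 ℕ.+ 3 ∎)
    where open ℕ.≤-Reasoning

  combine : ∀ {a c d w w′ k} → 5 ℕ.* k ℕ.≤ 6 ℕ.* w′ ℕ.+ c → c ℕ.+ 6 ℕ.* a ℕ.≤ 6 ℕ.* w ℕ.+ d → 5 ℕ.* k ℕ.+ 6 ℕ.* a ℕ.≤ 6 ℕ.* (w ℕ.+ w′) ℕ.+ d
  combine {a} {c} {d} {w} {w′} {k} le le′ = begin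
    5 ℕ.* k ℕ.+ 6 ℕ.* a ≤⟨ ℕ.+-monoˡ-≤ (6 ℕ.* a) le ⟩
    6 ℕ.* w′ ℕ.+ c ℕ.+ 6 ℕ.* a ≡⟨ ℕ.+-assoc (6 ℕ.* w′) c (6 ℕ.* a) ⟩
    6 ℕ.* w′ ℕ.+ (c ℕ.+ 6 ℕ.* a) ≤⟨ ℕ.+-monoʳ-≤ (6 ℕ.* w′) le′ ⟩
    6 ℕ.* w′ ℕ.+ (6 ℕ.* w ℕ.+ d) ≡⟨ N.solve 3 (λ w w′ d → N.con 6 N.:* w′ N.:+ (N.con 6 N.:* w N.:+ d) N.:= N.con 6 N.:* (w N.:+ w′) N.:+ d) refl w w′ d ⟩
    6 ℕ.* (w ℕ.+ w′) ℕ.+ d ∎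
    where open ℕ.≤-Reasoning

  Odd⇒Even : ∀ {a f} → Span (Odd a) f → Span (Even a) (U f)
  Odd⇒Even {a} = Span-linear U-linear onMonomials
    where
    onMonomials : ∀ w k → Odd a w k → Span (Even a) (U (monomial w k))
    onMonomials w zero (_ , () , _)
    onMonomials w (suc j) odd@(a≤w , _ , _) = Span-resp
      (≋-sym (≋-trans (U-cong (monomial≋ w (suc j))) (Linear.T-· U-linear (+ (5 ℕ.^ w)) (G ^ suc j))))
      (Span-5^ w (λ {w′} {k} (_ , 1≤k , le) → ℕ.≤-trans a≤w (ℕ.m≤m+n w w′) , 1≤k , combine {a} {7 ℕ.+ j} {8} {w} {w′} {k} le (exponent-even {a} {w} {j} odd)) (U-G^ j))

  -- For k ≥ 2 the inequality 10 ≤ 5k ≤ 6(w-a) + 8 forces w > a, so the factor 5 to be gained is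
  -- already present in the coefficient. Only the first power of G has to obtain it from `U-FG`.
  exponent-odd : ∀ {a w j} → Even a w (2 ℕ.+ j) → suc a ℕ.≤ w × (6 ℕ.+ j ℕ.+ 6 ℕ.* suc a ℕ.≤ 6 ℕ.* w ℕ.+ 11)
  exponent-odd {a} {w} {j} (_ , _ , le) = ℕ.*-cancelˡ-< 6 a w (ℕ.+-cancelʳ-< 8 _ _ (begin-strict
      6 ℕ.* a ℕ.+ 8 <⟨ ℕ.n<1+n _ ⟩
      1 ℕ.+ (6 ℕ.* a ℕ.+ 8) ≤⟨ ℕ.m≤m+n _ (1 ℕ.+ 5 ℕ.* j) ⟩
      1 ℕ.+ (6 ℕ.* a ℕ.+ 8) ℕ.+ (1 ℕ.+ 5 ℕ.* j) ≡⟨ N.solve 2 (λ a j → N.con 1 N.:+ (N.con 6 N.:* a N.:+ N.con 8) N.:+ (N.con 1 N.:+ N.con 5 N.:* j) N.:= N.con 5 N.:* (N.con 2 N.:+ j) N.:+ N.con 6 N.:* a) refl a j ⟩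
      5 ℕ.* (2 ℕ.+ j) ℕ.+ 6 ℕ.* a ≤⟨ le ⟩
      6 ℕ.* w ℕ.+ 8 ∎))
    , (begin
      6 ℕ.+ j ℕ.+ 6 ℕ.* suc a ≤⟨ ℕ.m≤m+n _ (1 ℕ.+ 4 ℕ.* j) ⟩
      6 ℕ.+ j ℕ.+ 6 ℕ.* suc a ℕ.+ (1 ℕ.+ 4 ℕ.* j) ≡⟨ N.solve 2 (λ a j → N.con 6 N.:+ j N.:+ N.con 6 N.:* (N.con 1 N.:+ a) N.:+ (N.con 1 N.:+ N.con 4 N.:* j) N.:= N.con 5 N.:* (N.con 2 N.:+ j) N.:+ N.con 6 N.:* a N.:+ N.con 3) refl a j ⟩
      5 ℕ.* (2 ℕ.+ j) ℕ.+ 6 ℕ.* a ℕ.+ 3 ≤⟨ ℕ.+-monoˡ-≤ 3 le ⟩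
      6 ℕ.* w ℕ.+ 8 ℕ.+ 3 ≡⟨ ℕ.+-assoc (6 ℕ.* w) 8 3 ⟩
      6 ℕ.* w ℕ.+ 11 ∎)
    where open ℕ.≤-Reasoning

  Even⇒Odd : ∀ {a f} → Span (Even a) f → Span (Odd (suc a)) (U (F * f))
  Even⇒Odd {a} = Span-linear UF-linear onMonomials
    where
    out : ∀ w k → C (+ (5 ℕ.^ w)) * U (F * G ^ k) ≋ U (F * monomial w k)
    out w k = ≋-sym (≋-trans (U-cong (*-congˡ (monomial≋ w k))) (Linear.T-· UF-linear (+ (5 ℕ.^ w)) (G ^ k)))
    onMonomials : ∀ w k → Even a w k → Span (Odd (suc a)) (U (F * monomial w k))
    onMonomials w zero (_ , () , _)
    onMonomials w 1 (a≤w , _ , _) = Span-resp (out w 1) (Span-5^ w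
      (λ {w′} {k} (1≤w′ , 1≤k , le) → ℕ.≤-trans (ℕ.≤-reflexive (ℕ.+-comm 1 a)) (ℕ.+-mono-≤ a≤w 1≤w′) , 1≤k ,
        combine {suc a} {5} {11} {w} {w′} {k} le (ℕ.≤-trans (ℕ.≤-reflexive (N.solve 1 (λ a → N.con 5 N.:+ N.con 6 N.:* (N.con 1 N.:+ a) N.:= N.con 6 N.:* a N.:+ N.con 11) refl a))
          (ℕ.+-monoˡ-≤ 11 (ℕ.*-monoʳ-≤ 6 a≤w)))) U-FG)
    onMonomials w (suc (suc j)) even = Span-resp (out w (2 ℕ.+ j)) (Span-5^ w
      (λ {w′} {k} (_ , 1≤k , le) → ℕ.≤-trans (proj₁ (exponent-odd {a} {w} {j} even)) (ℕ.m≤m+n w w′) , 1≤k ,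
        combine {suc a} {6 ℕ.+ j} {11} {w} {w′} {k} le (proj₂ (exponent-odd {a} {w} {j} even))) (U-FG^ (suc j)))

  L-odd′ : ∀ α → L (suc (2 ℕ.* α)) ≋ U (F * L (2 ℕ.* α))
  L-odd′ α = pointwise λ n → trans (cong (λ f → f n) (L-odd α))
    (trans (cong (λ f → U₅ f n) (sym (*≡⊛ F (L (2 ℕ.* α))))) (cong (λ f → f n) (sym (U≡U₅ (F * L (2 ℕ.* α))))))

  L-even′ : ∀ α → L (suc (suc (2 ℕ.* α))) ≋ U (L (suc (2 ℕ.* α)))
  L-even′ α = pointwise λ n → trans (cong (λ f → f n) (L-even α)) (cong (λ f → f n) (sym (U≡U₅ (L (suc (2 ℕ.* α))))))

  L-Span : ∀ α → Span (Odd (suc α)) (L (suc (2 ℕ.* α)))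
  L-Span zero = Span-resp (≋-sym (≋-trans (L-odd′ 0) U-Fu⁰))
    (cons (+ 1) 1 1 0# (ℕ.≤-refl , ℕ.≤-refl , ℕ.m≤m+n 11 6) (nil ≋-refl)
      (≋-trans (solve 1 (λ m → m := con (+ 1) :* m :+ con 0ℤ) ≋-refl (C (+ 5) * G ^ 1)) (+-cong (*-congˡ (≋-sym (monomial≋ 1 1))) ≋-refl)))
  L-Span (suc α) = Span-resp (≋-sym (L-odd′ (suc α))) (Even⇒Odd (subst (λ n → Span (Even (suc α)) (L n)) (sym (ℕ.*-suc 2 α))
    (Span-resp (≋-sym (L-even′ α)) (Odd⇒Even (L-Span α)))))

-- Uniqueness of the expansion

partialSum : ℕ → (ℕ → ℤ) → ℤ
partialSum D a = sumℤ {D} (λ i → a (toℕ i))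

partialSum-zero : ∀ D a → (∀ j → a j ≡ 0ℤ) → partialSum D a ≡ 0ℤ
partialSum-zero zero    a a≡0 = refl
partialSum-zero (suc D) a a≡0 = cong₂ ℤ._+_ (a≡0 0) (partialSum-zero D (λ j → a (suc j)) (λ j → a≡0 (suc j)))

partialSum-cong : ∀ D {a b} → (∀ j → a j ≡ b j) → partialSum D a ≡ partialSum D b
partialSum-cong zero    p = refl
partialSum-cong (suc D) p = cong₂ ℤ._+_ (p 0) (partialSum-cong D (λ j → p (suc j)))

partialSum-+ : ∀ D a b → partialSum D (λ j → a j ℤ.+ b j) ≡ partialSum D a ℤ.+ partialSum D b
partialSum-+ zero    a b = refl
partialSum-+ (suc D) a b = trans (cong (λ z → a 0 ℤ.+ b 0 ℤ.+ z) (partialSum-+ D (λ j → a (suc j)) (λ j → b (suc j))))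
  (solve 4 (λ a b c d → (a :+ b) :+ (c :+ d) := (a :+ c) :+ (b :+ d)) refl (a 0) (b 0) (partialSum D (λ j → a (suc j))) (partialSum D (λ j → b (suc j))))
  where open ℤ-Solver

at-index : ℕ → ℤ → ℕ → ℤ
at-index zero    v zero    = v
at-index zero    v (suc j) = 0ℤ
at-index (suc i) v zero    = 0ℤ
at-index (suc i) v (suc j) = at-index i v j

partialSum-at : ∀ D i v g → i ℕ.< D → partialSum D (λ j → at-index i v j ℤ.* g j) ≡ v ℤ.* g i
partialSum-at (suc D) zero    v g _           = trans (cong (λ z → v ℤ.* g 0 ℤ.+ z) (partialSum-zero D (λ j → 0ℤ ℤ.* g (suc j)) (λ j → refl))) (ℤ.+-identityʳ _)
partialSum-at (suc D) (suc i) v g (ℕ.s≤s i<D) = trans (ℤ.+-identityˡ _) (partialSum-at D i v (λ j → g (suc j)) i<D)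

-- `expand` holds for every sufficiently large length, so that expansions of different degrees can
-- be added and compared at a common one.
record Expansion (γ : ℕ → Series) (p : ℤ) (f : Series) : Set where
  field
    degree      : ℕ
    coefficient : ℕ → ℤ
    expand      : ∀ D → degree ℕ.≤ D → ∀ n → f n ≡ partialSum D (λ j → p ℤ.* coefficient j ℤ.* γ j n)

-- `γ` lets the powers of G be taken in the form in which the theorem has them. A coefficient c5ʷ
-- with a ≤ w is rewritten as 5ᵃ times c5^(w-a).
Span⇒Expansion : ∀ {γ} → (∀ j → G ^ suc j ≋ γ j) → ∀ {a f} → Span (Odd a) f → Expansion γ (+ (5 ℕ.^ a)) f
Span⇒Expansion {γ} γ≋ {a} (nil r) = record
  { degree = 0 ; coefficient = λ _ → 0ℤ
  ; expand = λ D _ n → trans (at r n) (trans (C0-at n) (sym (partialSum-zero D _ (λ j → cong (ℤ._* γ j n) (ℤ.*-zeroʳ (+ (5 ℕ.^ a))))))) }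
Span⇒Expansion γ≋ (cons c w zero g (_ , () , _) s r)
Span⇒Expansion {γ} γ≋ {a} {f} (cons c w (suc i) g (a≤w , _) s r) = record
  { degree = suc i ℕ.+ degree ; coefficient = λ j → at-index i v j ℤ.+ coefficient j ; expand = expand′ }
  where
  open Expansion (Span⇒Expansion γ≋ s)
  open ≡-Reasoning
  p v : ℤ
  p = + (5 ℕ.^ a)
  v = c ℤ.* + (5 ℕ.^ (w ℕ.∸ a))
  pv : p ℤ.* v ≡ c ℤ.* + (5 ℕ.^ w)
  pv = begin
    p ℤ.* (c ℤ.* + (5 ℕ.^ (w ℕ.∸ a))) ≡⟨ Z.solve 3 (λ p c t → p Z.:* (c Z.:* t) Z.:= c Z.:* (p Z.:* t)) refl p c (+ (5 ℕ.^ (w ℕ.∸ a))) ⟩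
    c ℤ.* (p ℤ.* + (5 ℕ.^ (w ℕ.∸ a))) ≡⟨ cong (c ℤ.*_) (sym (ℤ.pos-* (5 ℕ.^ a) (5 ℕ.^ (w ℕ.∸ a)))) ⟩
    c ℤ.* + (5 ℕ.^ a ℕ.* 5 ℕ.^ (w ℕ.∸ a)) ≡⟨ cong (λ z → c ℤ.* + z) (trans (sym (ℕ.^-distribˡ-+-* 5 a (w ℕ.∸ a))) (cong (5 ℕ.^_) (ℕ.m+[n∸m]≡n a≤w))) ⟩
    c ℤ.* + (5 ℕ.^ w) ∎
    where module Z = ℤ-Solver
  leading : ∀ n → (C c * monomial w (suc i)) n ≡ p ℤ.* v ℤ.* γ i n
  leading n = begin
    (C c * monomial w (suc i)) n ≡⟨ C-*-at c (monomial w (suc i)) n ⟩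
    c ℤ.* monomial w (suc i) n ≡⟨ cong (c ℤ.*_) (trans (at (≋-trans (monomial≋ w (suc i)) (*-congˡ (γ≋ i))) n) (C-*-at (+ (5 ℕ.^ w)) (γ i) n)) ⟩
    c ℤ.* (+ (5 ℕ.^ w) ℤ.* γ i n) ≡⟨ sym (ℤ.*-assoc c (+ (5 ℕ.^ w)) (γ i n)) ⟩
    c ℤ.* + (5 ℕ.^ w) ℤ.* γ i n ≡⟨ cong (ℤ._* γ i n) (sym pv) ⟩
    p ℤ.* v ℤ.* γ i n ∎
  expand′ : ∀ D → suc i ℕ.+ degree ℕ.≤ D → ∀ n → f n ≡ partialSum D (λ j → p ℤ.* (at-index i v j ℤ.+ coefficient j) ℤ.* γ j n)
  expand′ D le n = begin
    f n
      ≡⟨ trans (at r n) (+-at (C c * monomial w (suc i)) g n) ⟩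
    (C c * monomial w (suc i)) n ℤ.+ g n
      ≡⟨ cong₂ ℤ._+_ (trans (leading n) (trans (Z.solve 3 (λ p v x → p Z.:* v Z.:* x Z.:= v Z.:* (p Z.:* x)) refl p v (γ i n))
           (sym (partialSum-at D i v (λ j → p ℤ.* γ j n) (ℕ.≤-trans (ℕ.m≤m+n (suc i) degree) le)))))
           (expand D (ℕ.≤-trans (ℕ.m≤n+m degree (suc i)) le) n) ⟩
    _
      ≡⟨ sym (partialSum-+ D (λ j → at-index i v j ℤ.* (p ℤ.* γ j n)) (λ j → p ℤ.* coefficient j ℤ.* γ j n)) ⟩
    _
      ≡⟨ partialSum-cong D (λ j → Z.solve 4 (λ p a c x → a Z.:* (p Z.:* x) Z.:+ p Z.:* c Z.:* x Z.:= p Z.:* (a Z.:+ c) Z.:* x) refl p (at-index i v j) (coefficient j) (γ j n)) ⟩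
    partialSum D (λ j → p ℤ.* (at-index i v j ℤ.+ coefficient j) ℤ.* γ j n) ∎
    where module Z = ℤ-Solver

-- Passage to rational coefficients

toℚᵘ-/1 : ∀ p → ℚ.toℚᵘ (p ℚ./ 1) ℚᵘ.≃ mkℚᵘ p 0
toℚᵘ-/1 p = ℚ.toℚᵘ-fromℚᵘ (mkℚᵘ p 0)

/1-+ : ∀ m n → (m ℤ.+ n) ℚ./ 1 ≡ m ℚ./ 1 ℚ.+ n ℚ./ 1
/1-+ m n = ℚ.toℚᵘ-injective (ℚᵘ.≃-trans (toℚᵘ-/1 (m ℤ.+ n)) (ℚᵘ.≃-sym (ℚᵘ.≃-trans (ℚ.toℚᵘ-homo-+ (m ℚ./ 1) (n ℚ./ 1))
  (ℚᵘ.≃-trans (ℚᵘ.+-cong (toℚᵘ-/1 m) (toℚᵘ-/1 n)) (*≡* (solve 2 (λ m n → (m :* con 1ℤ :+ n :* con 1ℤ) :* con 1ℤ := (m :+ n) :* con 1ℤ) refl m n))))))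
  where open ℤ-Solver

/1-* : ∀ m n → (m ℤ.* n) ℚ./ 1 ≡ (m ℚ./ 1) ℚ.* (n ℚ./ 1)
/1-* m n = ℚ.toℚᵘ-injective (ℚᵘ.≃-trans (toℚᵘ-/1 (m ℤ.* n)) (ℚᵘ.≃-sym (ℚᵘ.≃-trans (ℚ.toℚᵘ-homo-* (m ℚ./ 1) (n ℚ./ 1))
  (ℚᵘ.≃-trans (ℚᵘ.*-cong (toℚᵘ-/1 m) (toℚᵘ-/1 n)) (*≡* refl)))))

partialSumℚ : ℕ → (ℕ → ℚ) → ℚ
partialSumℚ D a = sumℚ {D} (λ i → a (toℕ i))

partialSumℚ-zero : ∀ D a → (∀ j → a j ≡ 0ℚ) → partialSumℚ D a ≡ 0ℚ
partialSumℚ-zero zero    a a≡0 = refl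
partialSumℚ-zero (suc D) a a≡0 = trans (cong₂ ℚ._+_ (a≡0 0) (partialSumℚ-zero D (λ j → a (suc j)) (λ j → a≡0 (suc j)))) (ℚ.+-identityˡ 0ℚ)

partialSum-/1 : ∀ D (c g : ℕ → ℤ) → partialSum D (λ j → c j ℤ.* g j) ℚ./ 1 ≡ partialSumℚ D (λ j → (c j ℚ./ 1) ℚ.* (g j ℚ./ 1))
partialSum-/1 zero    c g = refl
partialSum-/1 (suc D) c g = trans (/1-+ (c 0 ℤ.* g 0) _) (cong₂ ℚ._+_ (/1-* (c 0) (g 0)) (partialSum-/1 D (λ j → c (suc j)) (λ j → g (suc j))))

extend : ∀ {d} → Vector ℚ d → ℕ → ℚ
extend {zero}  l j       = 0ℚ
extend {suc d} l zero    = l zero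
extend {suc d} l (suc j) = extend {d} (λ i → l (suc i)) j

extend-toℕ : ∀ {d} (l : Vector ℚ d) i → extend l (toℕ i) ≡ l i
extend-toℕ l zero    = refl
extend-toℕ l (suc i) = extend-toℕ (λ i → l (suc i)) i

sum-extend : ∀ {d} e (l : Vector ℚ d) (g : ℕ → ℚ) → sumℚ (λ i → l i ℚ.* g (toℕ i)) ≡ partialSumℚ (d ℕ.+ e) (λ j → extend l j ℚ.* g j)
sum-extend {zero}  e l g = sym (partialSumℚ-zero e _ (λ j → ℚ.*-zeroˡ (g j)))
sum-extend {suc d} e l g = cong (λ z → l zero ℚ.* g 0 ℚ.+ z) (sum-extend e (λ i → l (suc i)) (λ j → g (suc j)))

partialSumℚ-isolate : ∀ D i a b → i ℕ.< D → partialSumℚ D a ≡ partialSumℚ D b → (∀ j → j ≢ i → a j ≡ b j) → a i ≡ b i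
partialSumℚ-isolate (suc D) zero a b _ eq others = ∙-cancelʳ _ (a 0) (b 0)
  (trans eq (cong (b 0 ℚ.+_) (sym (same D (λ j → others (suc j) (λ ()))))))
  where
  open Algebra.Properties.Group ℚ.+-0-group using (∙-cancelʳ)
  same : ∀ D {a b} → (∀ j → a j ≡ b j) → partialSumℚ D a ≡ partialSumℚ D b
  same zero    p = refl
  same (suc D) p = cong₂ ℚ._+_ (p 0) (same D (λ j → p (suc j)))
partialSumℚ-isolate (suc D) (suc i) a b (ℕ.s≤s i<D) eq others =
  partialSumℚ-isolate D i (λ j → a (suc j)) (λ j → b (suc j)) i<D
    (∙-cancelˡ (a 0) _ _ (trans eq (cong (ℚ._+ partialSumℚ D (λ j → b (suc j))) (sym (others 0 (λ ()))))))
    (λ j j≢i → others (suc j) (λ p → j≢i (ℕ.suc-injective p)))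
  where open Algebra.Properties.Group ℚ.+-0-group using (∙-cancelˡ)

-- The series γ j starts with q^(j+1), so the linear system is unitriangular: at q^(i+1) the later γ
-- j vanish, the earlier coefficients agree by induction, and only the i-th remains.
unique-coefficients : ∀ (γ : ℕ → Series) → (∀ j n → n ℕ.< suc j → γ j n ≡ 0ℤ) → (∀ j → γ j (suc j) ≡ 1ℤ) →
  ∀ D (a b : ℕ → ℚ) → (∀ n → partialSumℚ D (λ j → a j ℚ.* (γ j n ℚ./ 1)) ≡ partialSumℚ D (λ j → b j ℚ.* (γ j n ℚ./ 1))) →
  ∀ i → i ℕ.< D → a i ≡ b i
unique-coefficients γ low leading D a b eq i i<D = upTo (suc i) i ℕ.≤-refl i<D
  where
  upTo : ∀ m i → i ℕ.< m → i ℕ.< D → a i ≡ b i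
  upTo (suc m) i (ℕ.s≤s i≤m) i<D = begin
    a i ≡⟨ sym (ℚ.*-identityʳ (a i)) ⟩
    a i ℚ.* 1ℚ ≡⟨ cong (λ z → a i ℚ.* (z ℚ./ 1)) (sym (leading i)) ⟩
    a i ℚ.* (γ i (suc i) ℚ./ 1) ≡⟨ partialSumℚ-isolate D i (λ j → a j ℚ.* (γ j (suc i) ℚ./ 1)) (λ j → b j ℚ.* (γ j (suc i) ℚ./ 1)) i<D (eq (suc i)) others ⟩
    b i ℚ.* (γ i (suc i) ℚ./ 1) ≡⟨ cong (λ z → b i ℚ.* (z ℚ./ 1)) (leading i) ⟩
    b i ℚ.* 1ℚ ≡⟨ ℚ.*-identityʳ (b i) ⟩
    b i ∎
    where
    open ≡-Reasoning
    others : ∀ j → j ≢ i → a j ℚ.* (γ j (suc i) ℚ./ 1) ≡ b j ℚ.* (γ j (suc i) ℚ./ 1)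
    others j j≢i with ℕ.<-cmp j i
    ... | tri< j<i _ _ = cong (ℚ._* (γ j (suc i) ℚ./ 1)) (upTo m j (ℕ.<-≤-trans j<i i≤m) (ℕ.<-trans j<i i<D))
    ... | tri≈ _ j≡i _ = ⊥-elim (j≢i j≡i)
    ... | tri> _ _ i<j = trans (cong (λ z → a j ℚ.* (z ℚ./ 1)) (low j (suc i) (ℕ.s≤s i<j)))
      (trans (ℚ.*-zeroʳ (a j)) (sym (trans (cong (λ z → b j ℚ.* (z ℚ./ 1)) (low j (suc i) (ℕ.s≤s i<j))) (ℚ.*-zeroʳ (b j)))))

-- One integral expansion with coefficients divisible by p settles both claims. Any rational
-- expansion, padded by zeros to a common length, must coincide with it.
Expansion⇒theorem : ∀ (γ : ℕ → Series) → (∀ j n → n ℕ.< suc j → γ j n ≡ 0ℤ) → (∀ j → γ j (suc j) ≡ 1ℤ) →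
  ∀ {p f} → Expansion γ p f →
  (∃[ d ] Σ[ l ∈ Vector ℚ d ] (∀ n → f n ℚ./ 1 ≡ sumℚ λ i → l i ℚ.* (γ (toℕ i) n ℚ./ 1))) ×
  (∀ {d} (l : Vector ℚ d) → (∀ n → f n ℚ./ 1 ≡ sumℚ λ i → l i ℚ.* (γ (toℕ i) n ℚ./ 1)) →
    ∀ i → ∃[ k ] (l i ≡ k ℚ./ 1 × p ∣ k))
Expansion⇒theorem γ low leading {p} {f} ex =
  (degree , (λ i → p ℤ.* coefficient (toℕ i) ℚ./ 1) , λ n → expandℚ degree ℕ.≤-refl n) ,
  λ {d} l eq i → p ℤ.* coefficient (toℕ i) ,
    trans (sym (extend-toℕ l i)) (unique-coefficients γ low leading (d ℕ.+ degree) (extend l) (λ j → p ℤ.* coefficient j ℚ./ 1)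
      (λ n → trans (sym (sum-extend degree l (λ j → γ j n ℚ./ 1))) (trans (sym (eq n)) (expandℚ (d ℕ.+ degree) (ℕ.m≤n+m degree d) n)))
      (toℕ i) (ℕ.<-≤-trans (Fin.toℕ<n i) (ℕ.m≤m+n d degree))) ,
    ∣⇒∣ᵤ (divides (coefficient (toℕ i)) (ℤ.*-comm p (coefficient (toℕ i))))
  where
  open Expansion ex
  expandℚ : ∀ D → degree ℕ.≤ D → ∀ n → f n ℚ./ 1 ≡ partialSumℚ D (λ j → p ℤ.* coefficient j ℚ./ 1 ℚ.* (γ j n ℚ./ 1))
  expandℚ D le n = trans (cong (λ z → z ℚ./ 1) (expand D le n)) (partialSum-/1 D (λ j → p ℤ.* coefficient j) (λ j → γ j n))

-- G is q times a series with constant term 1; this gives the two triangularity conditions on its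
-- powers.
G^-expansion : ∀ k → G ⊛^ k ≋ q^ k * h⁻¹ ^ k
G^-expansion k = ≋-trans (⊛^≋^ G k) (≋-trans (^-cong k G≋qh⁻¹) (≋-trans (product k) (*-cong (≋-sym (q^≋q^ k)) ≋-refl)))
  where
  open Solver
  product : ∀ k → (q * h⁻¹) ^ k ≋ q ^ k * h⁻¹ ^ k
  product zero    = ≋-sym (*-identityˡ 1#)
  product (suc k) = ≋-trans (*-congˡ (product k))
    (solve 4 (λ q i a b → q :* i :* (a :* b) := q :* a :* (i :* b)) ≋-refl q h⁻¹ (q ^ k) (h⁻¹ ^ k))

G^-low : ∀ j n → n ℕ.< suc j → (G ⊛^ suc j) n ≡ 0ℤ
G^-low j n n≤j = trans (at (G^-expansion (suc j)) n) (trans (below (q^-small (suc j) (h⁻¹ ^ suc j) ℕ.≤-refl) n n≤j) (C0-at n))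

G^-leading : ∀ j → (G ⊛^ suc j) (suc j) ≡ 1ℤ
G^-leading j = begin
  (G ⊛^ suc j) (suc j) ≡⟨ at (G^-expansion (suc j)) (suc j) ⟩
  (q^ suc j * h⁻¹ ^ suc j) (suc j) ≡⟨ cong (q^ suc j * h⁻¹ ^ suc j) (sym (ℕ.+-identityʳ (suc j))) ⟩
  (q^ suc j * h⁻¹ ^ suc j) (suc j ℕ.+ 0) ≡⟨ q^-*-shift (suc j) (h⁻¹ ^ suc j) 0 ⟩
  (h⁻¹ ^ suc j) 0 ≡⟨ ^-at-0≡1 h⁻¹ (suc j) refl ⟩
  1ℤ ∎
  where open ≡-Reasoning

theorem2p1 : (α : ℕ) →
    (∃[ d ] Σ[ l ∈ Vector ℚ d ] L (2 *ℕ α +ℕ 1) ≈ l [G]) ×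
    (∀ {d} (l : Vector ℚ d) → L (2 *ℕ α +ℕ 1) ≈ l [G] →
    ∀ i → ∃[ k ] (l i ≡ k /ℚ 1 × + (5 ^ℕ (α +ℕ 1)) ∣ k))
theorem2p1 α = Expansion⇒theorem (λ j → G ⊛^ suc j) G^-low G^-leading
  (Span⇒Expansion (λ j → ≋-sym (⊛^≋^ G (suc j)))
    (subst₂ (λ a n → Span (Odd a) (L n)) (ℕ.+-comm 1 α) (ℕ.+-comm 1 (2 ℕ.* α)) (L-Span α)))
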